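{- There exist trees whose disjoint convex obstacle number is at least $4$.
   Context: An obstacle representation of a graph $G$ consists of an injective placement of the vertices of $G$ as points in the plane together with a set of polygons (obstacles), such that the vertex points together with the polygon vertices are in general position (no three collinear), and two vertices $u,v$ are adjacent in $G$ if and only if the straight-line segment $\overline{uv}$ does not meet any obstacle. The disjoint convex obstacle number of $G$ is the smallest number of obstacles in an obstacle representation of $G$ in which all obstacles are convex polygons and are pairwise disjoint. -}

module Defs where

open import Data.Nat using (ℕ; zero; suc) renaming (_<_ to _<ℕ_; _≤_ to _≤ℕ_)
open import Data.Fin using (Fin; zero; suc; toℕ; inject₁; fromℕ)
open import Data.Bool using (Bool; true; false)
open import Data.Product using (Σ; ∃; ∃-syntax; _×_; _,_)
open import Data.Sum using (_⊎_; inj₁; inj₂)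
open import Relation.Nullary using (¬_)
open import Relation.Binary using (Tri)
open import Relation.Binary.PropositionalEquality using (_≡_)

-- The real numbers, axiomatised as a Dedekind-complete ordered field
-- (unique up to isomorphism, classically).  Equality is propositional.

record CompleteOrderedField : Set₁ where
  infixl 6 _+_ _-_
  infixl 7 _*_
  infix 4 _<_ _≤_
  field
    R    : Set
    0#   : R
    1#   : R
    _+_  : R → R → R
    _*_  : R → R → R
    -_   : R → R
    _<_  : R → R → Set
    +-assoc   : ∀ x y z → (x + y) + z ≡ x + (y + z)
    +-comm    : ∀ x y → x + y ≡ y + x
    +-identity : ∀ x → 0# + x ≡ x
    +-inverse : ∀ x → x + (- x) ≡ 0#
    *-assoc   : ∀ x y z → (x * y) * z ≡ x * (y * z)
    *-comm    : ∀ x y → x * y ≡ y * x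
    *-identity : ∀ x → 1# * x ≡ x
    *-inverse : ∀ x → ¬ (x ≡ 0#) → ∃[ y ] (x * y ≡ 1#)
    distrib   : ∀ x y z → x * (y + z) ≡ (x * y) + (x * z)
    0≢1       : ¬ (0# ≡ 1#)
    <-trans   : ∀ {x y z} → x < y → y < z → x < z
    <-tri     : ∀ x y → Tri (x < y) (x ≡ y) (y < x)
    +-mono-<  : ∀ {x y} z → x < y → x + z < y + z
    *-pos     : ∀ {x y} → 0# < x → 0# < y → 0# < x * y
  _-_ : R → R → R
  x - y = x + (- y)
  _≤_ : R → R → Set
  x ≤ y = x < y ⊎ x ≡ y
  field
    sup : (P : R → Set) → ∃ P → (∃[ b ] (∀ x → P x → x ≤ b)) →
          ∃[ s ] ((∀ x → P x → x ≤ s) × (∀ b → (∀ x → P x → x ≤ b) → s ≤ b))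

record Graph (n : ℕ) : Set where
  field
    adj       : Fin n → Fin n → Bool
    adj-sym   : ∀ u v → adj u v ≡ adj v u
    adj-irrefl : ∀ u → adj u u ≡ false

module _ {n : ℕ} (G : Graph n) where
  open Graph G

  Adj : Fin n → Fin n → Set
  Adj u v = adj u v ≡ true

  data Walk : Fin n → Fin n → Set where
    here : ∀ {u} → Walk u u
    step : ∀ {u w v} → Adj u w → Walk w v → Walk u v

  Connected : Set
  Connected = ∀ u v → Walk u v

  record Cycle : Set where
    field
      k     : ℕ
      c     : Fin (suc (suc (suc k))) → Fin n
      inj   : ∀ i j → c i ≡ c j → i ≡ j
      edges : ∀ (i : Fin (suc (suc k))) → Adj (c (inject₁ i)) (c (suc i))
      close : Adj (c (fromℕ (suc (suc k)))) (c zero)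

  Acyclic : Set
  Acyclic = ¬ Cycle

  IsTree : Set
  IsTree = (0 <ℕ n) × Connected × Acyclic

module Geometry (F : CompleteOrderedField) where
  open CompleteOrderedField F

  Point : Set
  Point = R × R

  px : Point → R
  px (x , _) = x
  py : Point → R
  py (_ , y) = y

  -- twice the signed area of triangle pqr; zero iff p,q,r collinear
  orient : Point → Point → Point → R
  orient p q r = ((px q - px p) * (py r - py p)) - ((py q - py p) * (px r - px p))

  Collinear : Point → Point → Point → Set
  Collinear p q r = orient p q r ≡ 0#

  ∑ : (k : ℕ) → (Fin k → R) → R
  ∑ zero    f = 0#
  ∑ (suc k) f = f zero + ∑ k (λ i → f (suc i))

  -- a convex polygon: at least 3 vertices listed in counterclockwise order
  -- and in strictly convex position (every triple in cyclic order is a left turn)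
  record ConvexPolygon : Set where
    field
      m      : ℕ
      vert   : Fin (suc (suc (suc m))) → Point
      convex : ∀ i j k → toℕ i <ℕ toℕ j → toℕ j <ℕ toℕ k →
               0# < orient (vert i) (vert j) (vert k)

  InPolygon : ConvexPolygon → Point → Set
  InPolygon P q =
    ∃[ w ] ((∀ i → 0# ≤ w i)
           × (∑ N w ≡ 1#)
           × (∑ N (λ i → w i * px (vert i)) ≡ px q)
           × (∑ N (λ i → w i * py (vert i)) ≡ py q))
    where
      open ConvexPolygon P
      N = suc (suc (suc m))

  SegmentMeets : Point → Point → ConvexPolygon → Set
  SegmentMeets u v P =
    ∃[ t ] ((0# ≤ t) × (t ≤ 1#) ×
            InPolygon P (((1# - t) * px u) + (t * px v) , ((1# - t) * py u) + (t * py v)))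

  Index : (n h : ℕ) → (Fin h → ConvexPolygon) → Set
  Index n h obs = Fin n ⊎ Σ (Fin h) (λ o → Fin (suc (suc (suc (ConvexPolygon.m (obs o))))))

  pt : {n h : ℕ} → (Fin n → Point) → (obs : Fin h → ConvexPolygon) → Index n h obs → Point
  pt pos obs (inj₁ v)       = pos v
  pt pos obs (inj₂ (o , i)) = ConvexPolygon.vert (obs o) i

  record DisjointConvexObstacleRep {n : ℕ} (G : Graph n) (h : ℕ) : Set where
    field
      pos       : Fin n → Point
      obstacle  : Fin h → ConvexPolygon
      distinct    : ∀ (a b : Index n h obstacle) → pt pos obstacle a ≡ pt pos obstacle b → a ≡ b
      noCollinear : ∀ (a b c : Index n h obstacle) → ¬ (a ≡ b) → ¬ (b ≡ c) → ¬ (a ≡ c) →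
                    ¬ Collinear (pt pos obstacle a) (pt pos obstacle b) (pt pos obstacle c)
      disjoint    : ∀ o o' → ¬ (o ≡ o') → ∀ q →
                    ¬ (InPolygon (obstacle o) q × InPolygon (obstacle o') q)
      represents  : ∀ u v → ¬ (u ≡ v) →
                    (Adj G u v → ∀ o → ¬ SegmentMeets (pos u) (pos v) (obstacle o))
                    × ((∀ o → ¬ SegmentMeets (pos u) (pos v) (obstacle o)) → Adj G u v)

  DcobsAtLeast : {n : ℕ} → Graph n → ℕ → Set
  DcobsAtLeast G k = ∀ h → h <ℕ k → ¬ DisjointConvexObstacleRep G h

{-# OPTIONS --safe #-}
-- Suppose three obstacles suffice.  Everything depends only on the order type of the vertices and the polygon
-- corners.  Two crossing edges of a tree span a quadrilateral with at most one side in the tree, and the other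
-- sides need different obstacles; so crossing edges are joined by an edge, and then use up all three obstacles.
-- By Ramsey's theorem a vertex v of large degree has neighbours a₀, a₁, …, each with children of its own, that
-- all look alike.  One obstacle P lies behind all the aᵢ.  The edges from the aᵢ to their children cannot stay in
-- consecutive wedges at v, since the obstacle Q that hides the children from v would have to change places with
-- P along the rays from v.  Hence the edge from aⱼ to a child crosses vaᵢ whenever i < j, and the third obstacle S
-- hides the children of aⱼ from aᵢ.  The same argument at a = a₂ shows that S is the obstacle behind the children
-- of a, and that for two of them, b and y, the edge from b to its child c crosses ay.  Wherever c lies, the
-- obstacle hiding c from y is P or Q, and would have to cross an edge.
--
-- The facts about order types involve at most nine points each, and are proved by case trees over the
-- orientations of triples.

module Submission where

open import Defs
open import Data.Nat using (ℕ)
open import Data.Product using (Σ; ∃-syntax; _×_)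

-- The bridge from polygons to orientations: in general position, a segment with its ends outside a
-- convex polygon meets it exactly when it crosses a chord joining two corners (in one direction up
-- to double negation). All conditions on the drawing thus become conditions on signs of triples,
-- and convexity enters by quantifying over all pairs of corners.
--
-- The metric content that survives is that two disjoint convex sets come in the same order on all
-- rays from an outside point that meet both.
--
-- The definition of a representation yields a blocking obstacle for a nonadjacent pair only under a
-- double negation. The goal being `⊥`, this suffices, and the lemmas conclude with negations or
-- double negations. The Ramsey colourings need real decisions; trichotomy supplies them.
--
-- Each selection keeps five members because the wedge argument uses three consecutive edges, while
-- an obstacle is shown to lie behind a vertex from the two neighbours of that vertex in the order.

-- Order types and a checker for refutations in them.

module OrderTypes where

  open import Data.Nat using (ℕ; zero; suc; _≡ᵇ_; _<ᵇ_; _/_; _%_)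
  open import Data.Nat.Properties using (≡ᵇ⇒≡)
  open import Data.Bool using (Bool; true; false; _∧_; _∨_; T; not; if_then_else_)
  open import Data.Product using (∃-syntax; _×_; _,_; proj₁; proj₂)
  open import Data.Sum using (_⊎_; inj₁; inj₂)
  open import Data.List using (List; []; _∷_; map; _++_)
  open import Data.List.Relation.Unary.All using (All; []; _∷_)
  open import Data.Maybe using (Maybe; just; nothing)
  open import Data.Empty using (⊥; ⊥-elim)
  open import Data.Unit using (⊤; tt)
  open import Relation.Nullary using (¬_)
  open import Relation.Binary.PropositionalEquality using (_≡_; _≢_; refl; sym; trans; subst)

  -- These are Knuth's axioms for counterclockwise systems. Transitivity is included in both mirror
  -- forms, `source` and `sink`, so that a reflected order type is again one. Equality of points is
  -- left undecided; `general` asks for proofs of distinctness.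
  record OrderType (Pt : Set) : Set₁ where
    field
      Pos      : Pt → Pt → Pt → Set
      rotate   : ∀ {a b c} → Pos a b c → Pos b c a
      asym     : ∀ {a b c} → Pos a b c → ¬ Pos b a c
      interior : ∀ {p q r t} → Pos t q r → Pos p t r → Pos p q t → Pos p q r
      source   : ∀ {t s p q r} → Pos t s p → Pos t s q → Pos t s r → Pos t p q → Pos t q r → Pos t p r
      sink     : ∀ {t s p q r} → Pos t p s → Pos t q s → Pos t r s → Pos t p q → Pos t q r → Pos t p r
      general  : ∀ {a b c} → a ≢ b → b ≢ c → a ≢ c → Pos a b c ⊎ Pos b a c

    Opp : Pt → Pt → Pt → Pt → Pt → Pt → Set
    Opp a b c a' b' c' = (Pos a b c × Pos b' a' c') ⊎ (Pos b a c × Pos a' b' c')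

    Cross : Pt → Pt → Pt → Pt → Set
    Cross a b c d = Opp a b c a b d × Opp c d a c d b

    InTri : Pt → Pt → Pt → Pt → Set
    InTri a b c p = (Pos a b p × Pos b c p × Pos c a p) ⊎ (Pos b a p × Pos c b p × Pos a c p)

    irrefl₁₂ : ∀ {a c} → ¬ Pos a a c
    irrefl₁₂ p = asym p p

  mirror : ∀ {Pt} → OrderType Pt → OrderType Pt
  mirror M = record
    { Pos = λ a b c → Pos b a c
    ; rotate = λ p → rotate (rotate p)
    ; asym = λ p q → asym p q
    ; interior = λ tqr ptr pqt → interior ptr tqr pqt
    ; source = λ tsp tsq tsr tpq tqr → rotate (rotate (sink (rotate tsr) (rotate tsq) (rotate tsp) (rotate tqr) (rotate tpq)))
    ; sink = λ tps tqs trs tpq tqr → rotate (rotate (source (rotate trs) (rotate tqs) (rotate tps) (rotate tqr) (rotate tpq)))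
    ; general = λ a≢b b≢c a≢c → swap (general a≢b b≢c a≢c)
    } where
    open OrderType M
    open import Data.Sum using (swap)

  record Triple : Set where
    constructor ⟨_,_,_⟩
    field fst snd trd : ℕ

  rev : Triple → Triple
  rev ⟨ i , j , k ⟩ = ⟨ j , i , k ⟩

  -- With the smallest number in front, the three rotations of a triple of distinct numbers
  -- coincide, and lookup becomes literal comparison.
  canon : Triple → Triple
  canon ⟨ i , j , k ⟩ =
    if (i <ᵇ j) ∧ (i <ᵇ k) then ⟨ i , j , k ⟩ else
    if (j <ᵇ k) then ⟨ j , k , i ⟩ else ⟨ k , i , j ⟩

  sameTriple : Triple → Triple → Bool
  sameTriple ⟨ i , j , k ⟩ ⟨ i' , j' , k' ⟩ = (i ≡ᵇ i') ∧ (j ≡ᵇ j') ∧ (k ≡ᵇ k')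

  -- A form is a hypothesis about numbered points.  Obstacles are the groups 1 and 2, and miss, out, nbeh and
  -- nbeh₂ quantify over all points of a group g, also those that are not numbered.
  data Form : Set where
    opp            : Triple → Triple → Form
    cross ncross   : (a b c d : ℕ) → Form
    tri ntri       : (a b c p : ℕ) → Form
    miss           : (g a b : ℕ) → Form
    out            : (g a : ℕ) → Form
    nbeh           : (g a b : ℕ) → Form
    nbeh₂          : (g a b c : ℕ) → Form
    disj           : Form

  same : Triple → Triple → Form
  same t t' = opp t (rev t')

  -- Points in a step are given by the decimal digits of a number.  O uses an opposition and F a forbidden
  -- pattern of form k, numbered m, where km stands for 10k + m; I, S and K use the interior, source and
  -- sink axioms; E transports a sign along an equality of points.
  data Step : Set where
    O  : (km : ℕ) → Step
    F  : (km ps : ℕ) → Step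
    I S K E : (ps : ℕ) → Step

  infixr 4 _&_
  infix 5 _∎
  -- `osplit` branches on the first triple of an opposition. The opposition provides the two signs
  -- by itself, so in contrast to `split` no proof of distinctness is required.
  data Cert : Set where
    _∎     : Step → Cert
    _&_    : Step → Cert → Cert
    split  : ℕ → Cert → Cert → Cert
    osplit : ℕ → Cert → Cert → Cert
    eq?    : ℕ → Cert → Cert → Cert

  -- Each `m` selects one of the four disjuncts of `Cross`, so that forbidding a crossing amounts to
  -- four clauses.
  crossPattern : (m a b c d : ℕ) → List Triple
  crossPattern 0 a b c d = ⟨ a , b , c ⟩ ∷ ⟨ b , a , d ⟩ ∷ ⟨ c , d , a ⟩ ∷ ⟨ d , c , b ⟩ ∷ []
  crossPattern 1 a b c d = ⟨ a , b , c ⟩ ∷ ⟨ b , a , d ⟩ ∷ ⟨ d , c , a ⟩ ∷ ⟨ c , d , b ⟩ ∷ []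
  crossPattern 2 a b c d = ⟨ b , a , c ⟩ ∷ ⟨ a , b , d ⟩ ∷ ⟨ c , d , a ⟩ ∷ ⟨ d , c , b ⟩ ∷ []
  crossPattern _ a b c d = ⟨ b , a , c ⟩ ∷ ⟨ a , b , d ⟩ ∷ ⟨ d , c , a ⟩ ∷ ⟨ c , d , b ⟩ ∷ []

  triPattern : (m a b c p : ℕ) → List Triple
  triPattern 0 a b c p = ⟨ a , b , p ⟩ ∷ ⟨ b , c , p ⟩ ∷ ⟨ c , a , p ⟩ ∷ []
  triPattern _ a b c p = ⟨ b , a , p ⟩ ∷ ⟨ c , b , p ⟩ ∷ ⟨ a , c , p ⟩ ∷ []

  -- Different tags guarantee different points, but equal tags guarantee nothing: corners of one
  -- obstacle that come from different hypotheses may coincide. This is why certificates contain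
  -- `eq?`.
  record Model : Set₁ where
    field
      {Pt}  : Set
      order : OrderType Pt
      Group : ℕ → Pt → Set
      ρ     : ℕ → Pt
      tag   : ℕ → ℕ
      inGroup : ∀ i → Group (tag i) (ρ i)
      apart   : ∀ i j → (tag i ≡ᵇ tag j) ≡ false → ρ i ≢ ρ j
    open OrderType order public

    ⟦_⟧ₜ : Triple → Set
    ⟦ ⟨ i , j , k ⟩ ⟧ₜ = Pos (ρ i) (ρ j) (ρ k)

    ⟦_⟧ : Form → Set
    ⟦ opp ⟨ a , b , c ⟩ ⟨ a' , b' , c' ⟩ ⟧ = Opp (ρ a) (ρ b) (ρ c) (ρ a') (ρ b') (ρ c')
    ⟦ cross a b c d ⟧  = Cross (ρ a) (ρ b) (ρ c) (ρ d)
    ⟦ ncross a b c d ⟧ = ¬ Cross (ρ a) (ρ b) (ρ c) (ρ d)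
    ⟦ tri a b c p ⟧    = InTri (ρ a) (ρ b) (ρ c) (ρ p)
    ⟦ ntri a b c p ⟧   = ¬ InTri (ρ a) (ρ b) (ρ c) (ρ p)
    ⟦ miss g a b ⟧ = ∀ {s t} → Group g s → Group g t → ¬ Cross (ρ a) (ρ b) s t
    ⟦ out g a ⟧    = ∀ {s t r} → Group g s → Group g t → Group g r → ¬ InTri s t r (ρ a)
    ⟦ nbeh g a b ⟧ = ∀ {s t} → Group g s → Group g t → ¬ InTri (ρ a) s t (ρ b)
    ⟦ nbeh₂ g a b c ⟧ = ∀ {s t} → Group g s → Group g t → ¬ (InTri (ρ a) s t (ρ b) × InTri (ρ a) s t (ρ c))
    ⟦ disj ⟧ = (∀ {s s' t t'} → Group 1 s → Group 1 s' → Group 2 t → Group 2 t' → ¬ Cross s s' t t')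
             × (∀ {s s' s'' t} → Group 1 s → Group 1 s' → Group 1 s'' → Group 2 t → ¬ InTri s s' s'' t)
             × (∀ {s t t' t''} → Group 2 t → Group 2 t' → Group 2 t'' → Group 1 s → ¬ InTri t t' t'' s)

  digit₀ digit₁ digit₂ digit₃ digit₄ : ℕ → ℕ
  digit₀ n = n % 10
  digit₁ n = (n / 10) % 10
  digit₂ n = (n / 100) % 10
  digit₃ n = (n / 1000) % 10
  digit₄ n = n / 10000

  nth : List Form → ℕ → Maybe Form
  nth [] _ = nothing
  nth (f ∷ _) zero = just f
  nth (_ ∷ fs) (suc n) = nth fs n

  -- Propagation of orientations through clauses.

  module Check (tag : ℕ → ℕ) (forms : List Form) where

    record State : Set where
      constructor state
      field
        known    : List Triple
        distinct : List (ℕ × ℕ)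
        equal    : List (ℕ × ℕ)
    open State

    data Result : Set where
      closed : Result
      add    : Triple → Result
      fail   : Result

    member : Triple → List Triple → Bool
    member t [] = false
    member t (u ∷ us) = sameTriple t u ∨ member t us

    holds : State → Triple → Bool
    holds σ t = member (canon t) (known σ)

    memberPair : ℕ → ℕ → List (ℕ × ℕ) → Bool
    memberPair i j [] = false
    memberPair i j ((i' , j') ∷ ps) = ((i ≡ᵇ i') ∧ (j ≡ᵇ j')) ∨ memberPair i j ps

    occurs : ℕ → Triple → Bool
    occurs i ⟨ a , b , c ⟩ = (i ≡ᵇ a) ∨ (i ≡ᵇ b) ∨ (i ≡ᵇ c)

    together : ℕ → ℕ → List Triple → Bool
    together i j [] = false
    together i j (t ∷ ts) = (occurs i t ∧ occurs j t) ∨ together i j ts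

    -- A degenerate triple is never oriented, so occurring together in a known triple proves
    -- distinctness.
    differ : State → ℕ → ℕ → Bool
    differ σ i j = not (tag i ≡ᵇ tag j) ∨ (not (i ≡ᵇ j) ∧ (together i j (known σ) ∨ memberPair i j (distinct σ)))

    differ₃ : State → Triple → Bool
    differ₃ σ ⟨ i , j , k ⟩ = differ σ i j ∧ differ σ j k ∧ differ σ i k

    unknown : State → List Triple → List Triple
    unknown σ [] = []
    unknown σ (t ∷ ts) = if holds σ t then unknown σ ts else t ∷ unknown σ ts

    -- Unit propagation: the list holds the undecided members of a clause. A single one is reversed,
    -- provided that its points are distinct and `general` applies.
    resolve : State → List Triple → Result
    resolve σ [] = closed
    resolve σ (t ∷ []) = if differ₃ σ t then add (rev t) else fail
    resolve σ (_ ∷ _ ∷ _) = fail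

    forbid : State → List Triple → Result
    forbid σ ts = resolve σ (unknown σ ts)

    exclude : State → Triple → Triple → Result
    exclude σ t u =
      if holds σ t then (if holds σ u then closed else add (rev u)) else
      if holds σ (rev t) then (if holds σ (rev u) then closed else add u) else
      if holds σ u then add (rev t) else
      if holds σ (rev u) then add t else fail

    opposites : Form → ℕ → Maybe (Triple × Triple)
    opposites (opp t u) _ = just (t , u)
    opposites (cross a b c d) 0 = just (⟨ a , b , c ⟩ , ⟨ a , b , d ⟩)
    opposites (cross a b c d) _ = just (⟨ c , d , a ⟩ , ⟨ c , d , b ⟩)
    opposites (tri a b c p) 0 = just (⟨ a , b , p ⟩ , ⟨ c , b , p ⟩)
    opposites (tri a b c p) _ = just (⟨ b , c , p ⟩ , ⟨ a , c , p ⟩)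
    opposites _ _ = nothing

    inG : ℕ → ℕ → Bool
    inG g i = tag i ≡ᵇ g

    patterns : Form → (m ps : ℕ) → Maybe (List Triple)
    patterns (ncross a b c d) m _ = just (crossPattern m a b c d)
    patterns (ntri a b c p) m _ = just (triPattern m a b c p)
    patterns (miss g a b) m ps =
      if inG g (digit₁ ps) ∧ inG g (digit₀ ps) then just (crossPattern m a b (digit₁ ps) (digit₀ ps)) else nothing
    patterns (out g a) m ps =
      if inG g (digit₂ ps) ∧ inG g (digit₁ ps) ∧ inG g (digit₀ ps)
      then just (triPattern m (digit₂ ps) (digit₁ ps) (digit₀ ps) a) else nothing
    patterns (nbeh g a b) m ps =
      if inG g (digit₁ ps) ∧ inG g (digit₀ ps) then just (triPattern m a (digit₁ ps) (digit₀ ps) b) else nothing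
    patterns (nbeh₂ g a b c) m ps =
      if inG g (digit₁ ps) ∧ inG g (digit₀ ps)
      then just (triPattern m a (digit₁ ps) (digit₀ ps) b ++ triPattern m a (digit₁ ps) (digit₀ ps) c) else nothing
    patterns disj m ps =
      if inG 1 (digit₃ ps) ∧ inG 1 (digit₂ ps) ∧ inG 2 (digit₁ ps) ∧ inG 2 (digit₀ ps)
      then just (crossPattern m (digit₃ ps) (digit₂ ps) (digit₁ ps) (digit₀ ps)) else
      if inG 1 (digit₃ ps) ∧ inG 1 (digit₂ ps) ∧ inG 1 (digit₁ ps) ∧ inG 2 (digit₀ ps)
      then just (triPattern m (digit₃ ps) (digit₂ ps) (digit₁ ps) (digit₀ ps)) else
      if inG 2 (digit₃ ps) ∧ inG 2 (digit₂ ps) ∧ inG 2 (digit₁ ps) ∧ inG 1 (digit₀ ps)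
      then just (triPattern m (digit₃ ps) (digit₂ ps) (digit₁ ps) (digit₀ ps)) else nothing
    patterns _ _ _ = nothing

    excludeM : State → Maybe (Triple × Triple) → Result
    excludeM σ nothing = fail
    excludeM σ (just (t , u)) = exclude σ t u

    forbidM : State → Maybe (List Triple) → Result
    forbidM σ nothing = fail
    forbidM σ (just ts) = forbid σ ts

    oppositesAt : ℕ → Maybe (Triple × Triple)
    oppositesAt km = go (nth forms (km / 10))
      where
      go : Maybe Form → Maybe (Triple × Triple)
      go nothing = nothing
      go (just f) = opposites f (km % 10)

    patternAt : ℕ → ℕ → Maybe (List Triple)
    patternAt km ps = go (nth forms (km / 10))
      where
      go : Maybe Form → Maybe (List Triple)
      go nothing = nothing
      go (just f) = patterns f (km % 10) ps

    -- The axiom as a clause: its premises, with the reverse of its conclusion (rotated) as the last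
    -- entry.
    interiorPattern : (p q r t : ℕ) → List Triple
    interiorPattern p q r t = ⟨ t , q , r ⟩ ∷ ⟨ p , t , r ⟩ ∷ ⟨ p , q , t ⟩ ∷ ⟨ p , r , q ⟩ ∷ []

    sourcePattern sinkPattern : (t s p q r : ℕ) → List Triple
    sourcePattern t s p q r = ⟨ t , s , p ⟩ ∷ ⟨ t , s , q ⟩ ∷ ⟨ t , s , r ⟩ ∷ ⟨ t , p , q ⟩ ∷ ⟨ t , q , r ⟩ ∷ ⟨ t , r , p ⟩ ∷ []
    sinkPattern t s p q r = ⟨ t , p , s ⟩ ∷ ⟨ t , q , s ⟩ ∷ ⟨ t , r , s ⟩ ∷ ⟨ t , p , q ⟩ ∷ ⟨ t , q , r ⟩ ∷ ⟨ t , r , p ⟩ ∷ []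

    transfer : State → (i j x y : ℕ) → Result
    transfer σ i j x y =
      if memberPair i j (equal σ) then
        (if holds σ ⟨ i , x , y ⟩ then (if holds σ ⟨ x , j , y ⟩ then closed else add ⟨ j , x , y ⟩) else
         if holds σ ⟨ x , i , y ⟩ then (if holds σ ⟨ j , x , y ⟩ then closed else add ⟨ x , j , y ⟩) else
         if holds σ ⟨ j , x , y ⟩ then add ⟨ i , x , y ⟩ else
         if holds σ ⟨ x , j , y ⟩ then add ⟨ x , i , y ⟩ else fail)
      else fail

    apply : State → Step → Result
    apply σ (O km) = excludeM σ (oppositesAt km)
    apply σ (F km ps) = forbidM σ (patternAt km ps)
    apply σ (I ps) = forbid σ (interiorPattern (digit₃ ps) (digit₂ ps) (digit₁ ps) (digit₀ ps))
    apply σ (S ps) = forbid σ (sourcePattern (digit₄ ps) (digit₃ ps) (digit₂ ps) (digit₁ ps) (digit₀ ps))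
    apply σ (K ps) = forbid σ (sinkPattern (digit₄ ps) (digit₃ ps) (digit₂ ps) (digit₁ ps) (digit₀ ps))
    apply σ (E ps) = transfer σ (digit₃ ps) (digit₂ ps) (digit₁ ps) (digit₀ ps)

    contradicts : Result → Bool
    contradicts closed = true
    contradicts _ = false

    learn : Triple → State → State
    learn t (state ks ds es) = state (canon t ∷ ks) ds es

    triple : ℕ → Triple
    triple n = ⟨ digit₂ n , digit₁ n , digit₀ n ⟩

    check : State → Cert → Bool
    continue : State → Result → Cert → Bool
    ocheck : State → Maybe (Triple × Triple) → Cert → Cert → Bool

    check σ (s ∎) = contradicts (apply σ s)
    check σ (s & c) = continue σ (apply σ s) c
    check σ (split n c d) = differ₃ σ (triple n) ∧ check (learn (triple n) σ) c ∧ check (learn (rev (triple n)) σ) d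
    check σ (osplit km c d) = ocheck σ (oppositesAt km) c d
    -- Coincidence lets `E` transport signs from one number to the other; distinctness licenses
    -- further splits.
    check (state ks ds es) (eq? n c d) =
      check (state ks ds ((digit₁ n , digit₀ n) ∷ es)) c ∧
      check (state ks ((digit₁ n , digit₀ n) ∷ (digit₀ n , digit₁ n) ∷ ds) es) d

    continue σ closed c = true
    continue σ (add t) c = check (learn t σ) c
    continue σ fail c = false

    ocheck σ nothing c d = false
    ocheck σ (just (t , u)) c d = check (learn t σ) c ∧ check (learn (rev t) σ) d

    -- Only the positive sign of the first triple is examined; `refute` gets the other one by
    -- reflection.
    checkRoot : ℕ → Cert → Bool
    checkRoot km c = go (oppositesAt km)
      where
      go : Maybe (Triple × Triple) → Bool
      go nothing = false
      go (just (t , u)) = check (learn t (state [] [] [])) c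

  -- Soundness of the checker.

  module Sound (m : Model) (forms : List Form) (hyps : All (Model.⟦_⟧ m) forms) where
    open Model m
    open Check tag forms

    ∧-split : ∀ {a b} → (a ∧ b) ≡ true → a ≡ true × b ≡ true
    ∧-split {true} {true} _ = refl , refl

    ∨-split : ∀ {a b} → (a ∨ b) ≡ true → a ≡ true ⊎ b ≡ true
    ∨-split {true} _ = inj₁ refl
    ∨-split {false} e = inj₂ e

    not-true : ∀ {a} → not a ≡ true → a ≡ false
    not-true {false} _ = refl

    ≡ᵇ-sound : ∀ {i j} → (i ≡ᵇ j) ≡ true → i ≡ j
    ≡ᵇ-sound {i} {j} e = ≡ᵇ⇒≡ i j (subst T (sym e) tt)

    canon-from : ∀ t → ⟦ canon t ⟧ₜ → ⟦ t ⟧ₜ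
    canon-from ⟨ i , j , k ⟩ p with (i <ᵇ j) ∧ (i <ᵇ k)
    ... | true = p
    ... | false with j <ᵇ k
    ...   | true = rotate (rotate p)
    ...   | false = rotate p

    canon-to : ∀ t → ⟦ t ⟧ₜ → ⟦ canon t ⟧ₜ
    canon-to ⟨ i , j , k ⟩ p with (i <ᵇ j) ∧ (i <ᵇ k)
    ... | true = p
    ... | false with j <ᵇ k
    ...   | true = rotate p
    ...   | false = rotate (rotate p)

    sameTriple-sound : ∀ t u → sameTriple t u ≡ true → t ≡ u
    sameTriple-sound ⟨ i , j , k ⟩ ⟨ i' , j' , k' ⟩ e
      with ≡ᵇ-sound {i} {i'} (proj₁ (∧-split e)) | ∧-split {j ≡ᵇ j'} (proj₂ (∧-split {i ≡ᵇ i'} e))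
    ... | refl | e₂ , e₃ with ≡ᵇ-sound {j} {j'} e₂ | ≡ᵇ-sound {k} {k'} e₃
    ... | refl | refl = refl

    record Valid (σ : State) : Set where
      constructor valid
      field
        known✓    : All ⟦_⟧ₜ (State.known σ)
        distinct✓ : All (λ { (i , j) → ρ i ≢ ρ j }) (State.distinct σ)
        equal✓    : All (λ { (i , j) → ρ i ≡ ρ j }) (State.equal σ)

    member-sound : ∀ {t us} → All ⟦_⟧ₜ us → member t us ≡ true → ⟦ t ⟧ₜ
    member-sound {t} {u ∷ us} (p ∷ ps) e with ∨-split {sameTriple t u} e
    ... | inj₁ e₁ = subst ⟦_⟧ₜ (sym (sameTriple-sound t u e₁)) p
    ... | inj₂ e₂ = member-sound ps e₂

    holds-sound : ∀ {σ} t → Valid σ → holds σ t ≡ true → ⟦ t ⟧ₜ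
    holds-sound t v e = canon-from t (member-sound (Valid.known✓ v) e)

    pair-sound : ∀ {P : ℕ × ℕ → Set} {ps} i j → All P ps → memberPair i j ps ≡ true → P (i , j)
    pair-sound {ps = (i' , j') ∷ _} i j (p ∷ ps) e with ∨-split {(i ≡ᵇ i') ∧ (j ≡ᵇ j')} e
    ... | inj₂ e₂ = pair-sound i j ps e₂
    ... | inj₁ e₁ with ≡ᵇ-sound {i} {i'} (proj₁ (∧-split e₁)) | ≡ᵇ-sound {j} {j'} (proj₂ (∧-split {i ≡ᵇ i'} e₁))
    ...   | refl | refl = p

    Distinct₃ : Triple → Set
    Distinct₃ ⟨ i , j , k ⟩ = ρ i ≢ ρ j × ρ j ≢ ρ k × ρ i ≢ ρ k

    pos-distinct : ∀ t → ⟦ t ⟧ₜ → Distinct₃ t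
    pos-distinct ⟨ i , j , k ⟩ p =
        (λ e → irrefl₁₂ (subst (λ x → Pos x (ρ j) (ρ k)) e p))
      , (λ e → irrefl₁₂ (subst (λ x → Pos x (ρ k) (ρ i)) e (rotate p)))
      , (λ e → irrefl₁₂ (subst (λ x → Pos (ρ k) x (ρ j)) e (rotate (rotate p))))

    occurs-sound : ∀ i a b c → occurs i ⟨ a , b , c ⟩ ≡ true → i ≡ a ⊎ i ≡ b ⊎ i ≡ c
    occurs-sound i a b c e with ∨-split {i ≡ᵇ a} e
    ... | inj₁ e₁ = inj₁ (≡ᵇ-sound e₁)
    ... | inj₂ e₂ with ∨-split {i ≡ᵇ b} e₂
    ...   | inj₁ e₃ = inj₂ (inj₁ (≡ᵇ-sound e₃))
    ...   | inj₂ e₃ = inj₂ (inj₂ (≡ᵇ-sound e₃))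

    occurring-distinct : ∀ i j t → i ≢ j → occurs i t ≡ true → occurs j t ≡ true → Distinct₃ t → ρ i ≢ ρ j
    occurring-distinct i j ⟨ a , b , c ⟩ i≢j oi oj (ab , bc , ac)
      with occurs-sound i a b c oi | occurs-sound j a b c oj
    ... | inj₁ refl        | inj₁ refl        = ⊥-elim (i≢j refl)
    ... | inj₁ refl        | inj₂ (inj₁ refl) = ab
    ... | inj₁ refl        | inj₂ (inj₂ refl) = ac
    ... | inj₂ (inj₁ refl) | inj₁ refl        = λ e → ab (sym e)
    ... | inj₂ (inj₁ refl) | inj₂ (inj₁ refl) = ⊥-elim (i≢j refl)
    ... | inj₂ (inj₁ refl) | inj₂ (inj₂ refl) = bc
    ... | inj₂ (inj₂ refl) | inj₁ refl        = λ e → ac (sym e)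
    ... | inj₂ (inj₂ refl) | inj₂ (inj₁ refl) = λ e → bc (sym e)
    ... | inj₂ (inj₂ refl) | inj₂ (inj₂ refl) = ⊥-elim (i≢j refl)

    together-sound : ∀ i j ts → i ≢ j → All ⟦_⟧ₜ ts → together i j ts ≡ true → ρ i ≢ ρ j
    together-sound i j (t ∷ ts) i≢j (p ∷ ps) e with ∨-split {occurs i t ∧ occurs j t} e
    ... | inj₁ e₁ = occurring-distinct i j t i≢j (proj₁ (∧-split e₁)) (proj₂ (∧-split {occurs i t} e₁)) (pos-distinct t p)
    ... | inj₂ e₂ = together-sound i j ts i≢j ps e₂

    ≡ᵇ-refl : ∀ i → (i ≡ᵇ i) ≡ true
    ≡ᵇ-refl zero = refl
    ≡ᵇ-refl (suc i) = ≡ᵇ-refl i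

    ≡ᵇ-false : ∀ {i j} → (i ≡ᵇ j) ≡ false → i ≢ j
    ≡ᵇ-false {i} e refl with trans (sym (≡ᵇ-refl i)) e
    ... | ()

    differ-sound : ∀ {σ} i j → Valid σ → differ σ i j ≡ true → ρ i ≢ ρ j
    differ-sound {σ} i j v e with ∨-split {not (tag i ≡ᵇ tag j)} e
    ... | inj₁ e₁ = apart i j (not-true e₁)
    ... | inj₂ e₂ with ∧-split {not (i ≡ᵇ j)} e₂
    ...   | ne , e₃ with ∨-split {together i j (State.known σ)} e₃
    ...     | inj₁ e₄ = together-sound i j (State.known σ) (≡ᵇ-false (not-true ne)) (Valid.known✓ v) e₄
    ...     | inj₂ e₄ = pair-sound i j (Valid.distinct✓ v) e₄

    differ₃-sound : ∀ {σ} t → Valid σ → differ₃ σ t ≡ true → Distinct₃ t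
    differ₃-sound {σ} ⟨ i , j , k ⟩ v e with ∧-split {differ σ i j} e
    ... | e₁ , e' with ∧-split {differ σ j k} e'
    ...   | e₂ , e₃ = differ-sound i j v e₁ , differ-sound j k v e₂ , differ-sound i k v e₃

    either : ∀ t → Distinct₃ t → ⟦ t ⟧ₜ ⊎ ⟦ rev t ⟧ₜ
    either ⟨ i , j , k ⟩ (ij , jk , ik) = general ij jk ik

    Meaning : Result → Set
    Meaning closed = ⊥
    Meaning (add t) = ⟦ t ⟧ₜ
    Meaning fail = ⊤

    unknown-sound : ∀ {σ} → Valid σ → ∀ ts → All ⟦_⟧ₜ (unknown σ ts) → All ⟦_⟧ₜ ts
    unknown-sound v [] _ = []
    unknown-sound {σ} v (t ∷ ts) ps with holds σ t in e
    ... | true = holds-sound t v e ∷ unknown-sound v ts ps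
    unknown-sound {σ} v (t ∷ ts) (p ∷ ps) | false = p ∷ unknown-sound v ts ps

    resolve-sound : ∀ {σ} → Valid σ → ∀ ts → ¬ All ⟦_⟧ₜ ts → Meaning (resolve σ ts)
    resolve-sound v [] n = n []
    resolve-sound {σ} v (t ∷ []) n with differ₃ σ t in e
    ... | false = tt
    ... | true with either t (differ₃-sound t v e)
    ...   | inj₁ p = ⊥-elim (n (p ∷ []))
    ...   | inj₂ p = p
    resolve-sound v (_ ∷ _ ∷ _) n = tt

    forbid-sound : ∀ {σ} → Valid σ → ∀ ts → ¬ All ⟦_⟧ₜ ts → Meaning (forbid σ ts)
    forbid-sound {σ} v ts n = resolve-sound v (unknown σ ts) (λ ps → n (unknown-sound v ts ps))

    Opposite : Triple → Triple → Set
    Opposite t u = (⟦ t ⟧ₜ × ⟦ rev u ⟧ₜ) ⊎ (⟦ rev t ⟧ₜ × ⟦ u ⟧ₜ)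

    contra : ∀ t → ⟦ t ⟧ₜ → ⟦ rev t ⟧ₜ → ⊥
    contra ⟨ _ , _ , _ ⟩ = asym

    exclude-sound : ∀ {σ} → Valid σ → ∀ t u → Opposite t u → Meaning (exclude σ t u)
    exclude-sound {σ} v t u o with holds σ t in et
    ... | true with holds σ u in eu
    exclude-sound {σ} v t u (inj₁ (_ , q)) | true | true = contra u (holds-sound u v eu) q
    exclude-sound {σ} v t u (inj₂ (p , _)) | true | true = contra t (holds-sound t v et) p
    exclude-sound {σ} v t u (inj₁ (_ , q)) | true | false = q
    exclude-sound {σ} v t u (inj₂ (p , _)) | true | false = ⊥-elim (contra t (holds-sound t v et) p)
    exclude-sound {σ} v t u o | false with holds σ (rev t) in er
    ... | true with holds σ (rev u) in eu
    exclude-sound {σ} v t u (inj₁ (p , _)) | false | true | true = contra t p (holds-sound (rev t) v er)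
    exclude-sound {σ} v t u (inj₂ (_ , q)) | false | true | true = contra u q (holds-sound (rev u) v eu)
    exclude-sound {σ} v t u (inj₁ (p , _)) | false | true | false = ⊥-elim (contra t p (holds-sound (rev t) v er))
    exclude-sound {σ} v t u (inj₂ (_ , q)) | false | true | false = q
    exclude-sound {σ} v t u o | false | false with holds σ u in eu
    exclude-sound {σ} v t u (inj₁ (_ , q)) | false | false | true = ⊥-elim (contra u (holds-sound u v eu) q)
    exclude-sound {σ} v t u (inj₂ (p , _)) | false | false | true = p
    ... | false with holds σ (rev u) in ev
    exclude-sound {σ} v t u (inj₁ (p , _)) | false | false | false | true = p
    exclude-sound {σ} v t u (inj₂ (_ , q)) | false | false | false | true = ⊥-elim (contra u q (holds-sound (rev u) v ev))
    exclude-sound {σ} v t u o | false | false | false | false = tt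

    nth-sound : ∀ {P : Form → Set} {fs} → All P fs → ∀ n {f} → nth fs n ≡ just f → P f
    nth-sound (p ∷ ps) zero refl = p
    nth-sound (p ∷ ps) (suc n) e = nth-sound ps n e

    opposites-sound : ∀ f m {t u} → ⟦ f ⟧ → opposites f m ≡ just (t , u) → Opposite t u
    opposites-sound (opp _ _) m h refl = h
    opposites-sound (cross a b c d) 0 h refl = proj₁ h
    opposites-sound (cross a b c d) (suc _) h refl = proj₂ h
    opposites-sound (tri a b c p) 0 (inj₁ (x , y , z)) refl = inj₁ (x , y)
    opposites-sound (tri a b c p) 0 (inj₂ (x , y , z)) refl = inj₂ (x , y)
    opposites-sound (tri a b c p) (suc _) (inj₁ (x , y , z)) refl = inj₁ (y , z)
    opposites-sound (tri a b c p) (suc _) (inj₂ (x , y , z)) refl = inj₂ (y , z)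

    crossPattern-sound : ∀ m a b c d → All ⟦_⟧ₜ (crossPattern m a b c d) → Cross (ρ a) (ρ b) (ρ c) (ρ d)
    crossPattern-sound 0 a b c d (x ∷ y ∷ z ∷ w ∷ []) = inj₁ (x , y) , inj₁ (z , w)
    crossPattern-sound 1 a b c d (x ∷ y ∷ z ∷ w ∷ []) = inj₁ (x , y) , inj₂ (z , w)
    crossPattern-sound 2 a b c d (x ∷ y ∷ z ∷ w ∷ []) = inj₂ (x , y) , inj₁ (z , w)
    crossPattern-sound (suc (suc (suc _))) a b c d (x ∷ y ∷ z ∷ w ∷ []) = inj₂ (x , y) , inj₂ (z , w)

    triPattern-sound : ∀ m a b c p → All ⟦_⟧ₜ (triPattern m a b c p) → InTri (ρ a) (ρ b) (ρ c) (ρ p)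
    triPattern-sound 0 a b c p (x ∷ y ∷ z ∷ []) = inj₁ (x , y , z)
    triPattern-sound (suc _) a b c p (x ∷ y ∷ z ∷ []) = inj₂ (x , y , z)

    triPattern₂-sound : ∀ m a b c p q → All ⟦_⟧ₜ (triPattern m a b c p ++ triPattern m a b c q) →
                        InTri (ρ a) (ρ b) (ρ c) (ρ p) × InTri (ρ a) (ρ b) (ρ c) (ρ q)
    triPattern₂-sound 0 a b c p q (x ∷ y ∷ z ∷ x' ∷ y' ∷ z' ∷ []) = inj₁ (x , y , z) , inj₁ (x' , y' , z')
    triPattern₂-sound (suc _) a b c p q (x ∷ y ∷ z ∷ x' ∷ y' ∷ z' ∷ []) = inj₂ (x , y , z) , inj₂ (x' , y' , z')

    inG-sound : ∀ g i → inG g i ≡ true → Group g (ρ i)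
    inG-sound g i e = subst (λ h → Group h (ρ i)) (≡ᵇ-sound e) (inGroup i)

    pattern-sound : ∀ f m ps {ts} → ⟦ f ⟧ → patterns f m ps ≡ just ts → ¬ All ⟦_⟧ₜ ts
    pattern-sound (ncross a b c d) m ps h refl all = h (crossPattern-sound m a b c d all)
    pattern-sound (ntri a b c p) m ps h refl all = h (triPattern-sound m a b c p all)
    pattern-sound (miss g a b) m ps h e all with inG g (digit₁ ps) in e₁ | inG g (digit₀ ps) in e₀
    pattern-sound (miss g a b) m ps h refl all | true | true =
      h (inG-sound g _ e₁) (inG-sound g _ e₀) (crossPattern-sound m a b _ _ all)
    pattern-sound (out g a) m ps h e all with inG g (digit₂ ps) in e₂ | inG g (digit₁ ps) in e₁ | inG g (digit₀ ps) in e₀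
    pattern-sound (out g a) m ps h refl all | true | true | true =
      h (inG-sound g _ e₂) (inG-sound g _ e₁) (inG-sound g _ e₀) (triPattern-sound m _ _ _ a all)
    pattern-sound (nbeh g a b) m ps h e all with inG g (digit₁ ps) in e₁ | inG g (digit₀ ps) in e₀
    pattern-sound (nbeh g a b) m ps h refl all | true | true =
      h (inG-sound g _ e₁) (inG-sound g _ e₀) (triPattern-sound m a _ _ b all)
    pattern-sound (nbeh₂ g a b c) m ps h e all with inG g (digit₁ ps) in e₁ | inG g (digit₀ ps) in e₀
    pattern-sound (nbeh₂ g a b c) m ps h refl all | true | true =
      h (inG-sound g _ e₁) (inG-sound g _ e₀) (triPattern₂-sound m a _ _ b c all)
    pattern-sound disj m ps (h , h' , h'') e all
      with inG 1 (digit₃ ps) ∧ inG 1 (digit₂ ps) ∧ inG 2 (digit₁ ps) ∧ inG 2 (digit₀ ps) in e₁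
    pattern-sound disj m ps (h , h' , h'') refl all | true with ∧-split {inG 1 (digit₃ ps)} e₁
    ... | x , r with ∧-split {inG 1 (digit₂ ps)} r
    ... | y , r' with ∧-split {inG 2 (digit₁ ps)} r'
    ... | z , w = h (inG-sound 1 _ x) (inG-sound 1 _ y) (inG-sound 2 _ z) (inG-sound 2 _ w) (crossPattern-sound m _ _ _ _ all)
    pattern-sound disj m ps (h , h' , h'') e all | false
      with inG 1 (digit₃ ps) ∧ inG 1 (digit₂ ps) ∧ inG 1 (digit₁ ps) ∧ inG 2 (digit₀ ps) in e₂
    pattern-sound disj m ps (h , h' , h'') refl all | false | true with ∧-split {inG 1 (digit₃ ps)} e₂
    ... | x , r with ∧-split {inG 1 (digit₂ ps)} r
    ... | y , r' with ∧-split {inG 1 (digit₁ ps)} r'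
    ... | z , w = h' (inG-sound 1 _ x) (inG-sound 1 _ y) (inG-sound 1 _ z) (inG-sound 2 _ w) (triPattern-sound m _ _ _ _ all)
    pattern-sound disj m ps (h , h' , h'') e all | false | false
      with inG 2 (digit₃ ps) ∧ inG 2 (digit₂ ps) ∧ inG 2 (digit₁ ps) ∧ inG 1 (digit₀ ps) in e₃
    pattern-sound disj m ps (h , h' , h'') refl all | false | false | true with ∧-split {inG 2 (digit₃ ps)} e₃
    ... | x , r with ∧-split {inG 2 (digit₂ ps)} r
    ... | y , r' with ∧-split {inG 2 (digit₁ ps)} r'
    ... | z , w = h'' (inG-sound 2 _ x) (inG-sound 2 _ y) (inG-sound 2 _ z) (inG-sound 1 _ w) (triPattern-sound m _ _ _ _ all)

    oppositesAt-sound : ∀ km {t u} → oppositesAt km ≡ just (t , u) → Opposite t u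
    oppositesAt-sound km e with nth forms (km / 10) in ef
    ... | just f = opposites-sound f _ (nth-sound hyps (km / 10) ef) e

    patternAt-sound : ∀ km ps {ts} → patternAt km ps ≡ just ts → ¬ All ⟦_⟧ₜ ts
    patternAt-sound km ps e with nth forms (km / 10) in ef
    ... | just f = pattern-sound f _ ps (nth-sound hyps (km / 10) ef) e

    transfer-sound : ∀ {σ} → Valid σ → ∀ i j x y → Meaning (transfer σ i j x y)
    transfer-sound {σ} v i j x y with memberPair i j (State.equal σ) in e
    ... | false = tt
    ... | true with pair-sound i j (Valid.equal✓ v) e
    ...   | i≡j with holds σ ⟨ i , x , y ⟩ in e₁
    ...     | true with holds σ ⟨ x , j , y ⟩ in e₂
    ...       | true = asym (subst (λ z → Pos z (ρ x) (ρ y)) i≡j (holds-sound _ v e₁)) (holds-sound _ v e₂)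
    ...       | false = subst (λ z → Pos z (ρ x) (ρ y)) i≡j (holds-sound _ v e₁)
    transfer-sound {σ} v i j x y | true | i≡j | false with holds σ ⟨ x , i , y ⟩ in e₁
    ...     | true with holds σ ⟨ j , x , y ⟩ in e₂
    ...       | true = asym (subst (λ z → Pos (ρ x) z (ρ y)) i≡j (holds-sound _ v e₁)) (holds-sound _ v e₂)
    ...       | false = subst (λ z → Pos (ρ x) z (ρ y)) i≡j (holds-sound _ v e₁)
    transfer-sound {σ} v i j x y | true | i≡j | false | false with holds σ ⟨ j , x , y ⟩ in e₁
    ...     | true = subst (λ z → Pos z (ρ x) (ρ y)) (sym i≡j) (holds-sound _ v e₁)
    ...     | false with holds σ ⟨ x , j , y ⟩ in e₂
    ...       | true = subst (λ z → Pos (ρ x) z (ρ y)) (sym i≡j) (holds-sound _ v e₂)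
    ...       | false = tt

    apply-sound : ∀ {σ} → Valid σ → ∀ s → Meaning (apply σ s)
    apply-sound {σ} v (O km) with oppositesAt km in e
    ... | nothing = tt
    ... | just (t , u) = exclude-sound v t u (oppositesAt-sound km e)
    apply-sound {σ} v (F km ps) with patternAt km ps in e
    ... | nothing = tt
    ... | just ts = forbid-sound v ts (patternAt-sound km ps e)
    apply-sound v (I ps) = forbid-sound v (interiorPattern (digit₃ ps) (digit₂ ps) (digit₁ ps) (digit₀ ps)) λ { (x ∷ y ∷ z ∷ w ∷ []) → asym (interior x y z) (rotate (rotate w)) }
    apply-sound v (S ps) = forbid-sound v (sourcePattern (digit₄ ps) (digit₃ ps) (digit₂ ps) (digit₁ ps) (digit₀ ps)) λ { (a ∷ b ∷ c ∷ d ∷ e ∷ f ∷ []) → asym (source a b c d e) (rotate (rotate f)) }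
    apply-sound v (K ps) = forbid-sound v (sinkPattern (digit₄ ps) (digit₃ ps) (digit₂ ps) (digit₁ ps) (digit₀ ps)) λ { (a ∷ b ∷ c ∷ d ∷ e ∷ f ∷ []) → asym (sink a b c d e) (rotate (rotate f)) }
    apply-sound v (E ps) = transfer-sound v _ _ _ _

    learn-valid : ∀ {σ} t → ⟦ t ⟧ₜ → Valid σ → Valid (learn t σ)
    learn-valid t p (valid ks ds es) = valid (canon-to t p ∷ ks) ds es

    check-sound : ∀ {σ} → Valid σ → ∀ c → check σ c ≡ true → ⊥
    check-sound {σ} v (s ∎) e with apply σ s | apply-sound v s
    ... | closed | ()
    check-sound {σ} v (s & c) e with apply σ s | apply-sound v s
    ... | closed | ()
    ... | add t | p = check-sound (learn-valid t p v) c e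
    check-sound {σ} v (split n c d) e with ∧-split {differ₃ σ (triple n)} e
    ... | e₁ , e' with ∧-split {check (learn (triple n) σ) c} e'
    ...   | e₂ , e₃ with either (triple n) (differ₃-sound (triple n) v e₁)
    ...     | inj₁ p = check-sound (learn-valid (triple n) p v) c e₂
    ...     | inj₂ p = check-sound (learn-valid (rev (triple n)) p v) d e₃
    check-sound {σ} v (osplit km c d) e with oppositesAt km in eo
    ... | just (t , u) with ∧-split {check (learn t σ) c} e | oppositesAt-sound km eo
    ...   | e₁ , _ | inj₁ (p , _) = check-sound (learn-valid t p v) c e₁
    ...   | _ , e₂ | inj₂ (p , _) = check-sound (learn-valid (rev t) p v) d e₂
    check-sound {state ks ds es} (valid k✓ d✓ e✓) (eq? n c d) e
      with ∧-split {check (state ks ds ((digit₁ n , digit₀ n) ∷ es)) c} e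
    -- Equality of points is not decidable here, but `⊥` follows from the double negation that the
    -- second branch provides.
    ... | e₁ , e₂ = ¬eq (λ i≡j → check-sound (valid k✓ d✓ (i≡j ∷ e✓)) c e₁)
      where
      ¬eq : ¬ ¬ (ρ (digit₁ n) ≡ ρ (digit₀ n))
      ¬eq i≢j = check-sound (valid k✓ (i≢j ∷ (λ j≡i → i≢j (sym j≡i)) ∷ d✓) e✓) d e₂

  mirrorModel : Model → Model
  mirrorModel m = record { Model m ; order = mirror (Model.order m) }

  -- Forms are invariant under reflection because they only compare signs with one another, or allow
  -- both orientations of a triangle.
  swapForm : ∀ m f → Model.⟦_⟧ m f → Model.⟦_⟧ (mirrorModel m) f
  swapForm m f h = go f h
    where
    open Model m
    module N = Model (mirrorModel m)
    open import Data.Sum using (swap)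
    both : ∀ {a b c d} → N.Cross a b c d → Cross a b c d
    both (x , y) = swap x , swap y
    go : ∀ f → ⟦ f ⟧ → N.⟦_⟧ f
    go (opp ⟨ _ , _ , _ ⟩ ⟨ _ , _ , _ ⟩) h = swap h
    go (cross a b c d) (x , y) = swap x , swap y
    go (ncross a b c d) h x = h (both x)
    go (tri a b c p) h = swap h
    go (ntri a b c p) h x = h (swap x)
    go (miss g a b) h s t x = h s t (both x)
    go (out g a) h s t r x = h s t r (swap x)
    go (nbeh g a b) h s t x = h s t (swap x)
    go (nbeh₂ g a b c) h s t (x , y) = h s t (swap x , swap y)
    go disj (h , h' , h'') = (λ s s' t t' x → h s s' t t' (both x)) , (λ s s' s'' t x → h' s s' s'' t (swap x)) , (λ t t' t'' s x → h'' t t' t'' s (swap x))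

  mirrored : ∀ m t → Model.⟦_⟧ₜ m (rev t) → Model.⟦_⟧ₜ (mirrorModel m) t
  mirrored m ⟨ _ , _ , _ ⟩ p = p

  -- If the first triple of the chosen opposition is negative, the same certificate is run in the
  -- mirror image, where it is positive.
  refute : ∀ m forms → All (Model.⟦_⟧ m) forms → ∀ km c → Check.checkRoot (Model.tag m) forms km c ≡ true → ⊥
  refute m forms hyps km c e with Check.oppositesAt (Model.tag m) forms km in eo
  ... | just (t , u) with Sound.oppositesAt-sound m forms hyps km eo
  ...   | inj₁ (p , _) = Sound.check-sound m forms hyps (Sound.learn-valid m forms hyps t p (Sound.valid [] [] [])) c e
  ...   | inj₂ (p , _) = Sound.check-sound m′ forms hyps′ (Sound.learn-valid m′ forms hyps′ t p′ (Sound.valid [] [] [])) c e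
    where
    m′ = mirrorModel m
    open import Data.List.Relation.Unary.All using () renaming (map to mapAll)
    hyps′ = mapAll (λ {f} → swapForm m f) hyps
    p′ : Model.⟦_⟧ₜ m′ t
    p′ = mirrored m t p

-- Case trees that refute configurations of points.

module Certificates where

  open import Data.List using ([]; _∷_; List)
  open OrderTypes

  -- In every certificate the numbers follow the lists given to `model` or `model₂` where it is
  -- cited: vertices, then corners of the first obstacle, then corners of the second.
  sides-adjacent-forms : List Form
  sides-adjacent-forms = cross 0 1 2 3 ∷ cross 0 3 4 5 ∷ cross 3 1 6 7 ∷ miss 1 0 1 ∷ miss 1 2 3 ∷ []

  sides-adjacent-cert : Cert
  sides-adjacent-cert =
    O 20 & osplit 21 (O 21 & I 1367 ∎) (O 21 & eq? 3 (E 316 & E 317 & E 367 & F 31 67 ∎) (eq? 12 (E 1236 & E 1237 & F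
    42 67 & E 1267 ∎) (osplit 1 (O 1 & osplit 0 (O 0 & I 1023 ∎) (O 0 & split 237 (S 37216 & F 42 67 & K 73216 & S
    13027 & K 17306 & F 31 67 & S 71206 & S 71306 & S 2137 ∎) (K 31027 & split 17 (S 13027 & S 21307 & eq? 57 (E 5723 &
    E 5703 & E 5702 & O 10 & osplit 11 (O 11 & I 3045 ∎) (O 11 & K 35024 & S 53024 & F 41 45 ∎)) (eq? 47 (E 4723 & E
    4703 & E 4702 & O 10 & osplit 11 (O 11 & K 34025 & S 43025 & F 42 45 ∎) (O 11 & I 345 ∎)) (split 35 (O 10 & osplit
    11 (O 11 & split 234 (S 30214 & K 31427 & F 41 47 & K 20347 & K 3214 & S 4135 & K 40135 & F 32 45 ∎) (K 34025 & F
    42 45 & K 53204 & S 43025 & K 20135 & K 3214 & S 4135 & F 32 45 & S 50214 ∎)) (O 11 & I 345 ∎)) (O 10 & osplit 11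
    (O 11 & I 3045 ∎) (O 11 & split 235 (S 30215 & S 30527 & F 41 57 & K 20357 & K 3215 & S 5134 & K 50134 & F 31 45 ∎)
    (K 35024 & F 41 45 & S 53024 & K 3215 & S 21305 & K 50124 & F 31 45 & S 5134 ∎)))))) (K 17306 & S 71306 & F 31 67
    ∎)))) (O 1 & osplit 0 (O 0 & split 236 (split 34 (O 10 & osplit 11 (O 11 & I 3045 ∎) (O 11 & split 234 (S 34205 & F
    41 45 & S 53024 & K 43205 & S 20315 & S 3124 & K 4315 & F 31 45 & K 50124 ∎) (K 30124 & split 14 (K 4315 & S 40315 &
    F 31 45 ∎) (S 3124 & K 13204 & eq? 46 (E 4623 ∎) (S 31246 & F 42 46 & S 20436 & K 46203 & S 43126 & F 32 46 & S
    4126 ∎))))) (O 10 & osplit 11 (O 11 & split 235 (S 35204 & F 42 45 & S 43025 & K 53204 & K 2314 & S 3125 & K 21035 &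
    S 50214 & F 32 45 ∎) (K 30125 & split 15 (K 5314 & S 50314 & F 32 45 ∎) (S 3125 & S 20315 & eq? 56 (E 5623 ∎) (S
    31256 & F 42 56 & S 20536 & K 56203 & S 53126 & F 32 56 & S 5126 ∎)))) (O 11 & I 345 ∎))) (K 36127 & F 42 67 & K
    73216 & S 63127 & S 12037 & K 21037 & S 71206 & K 13206 & F 31 67 ∎)) (O 0 & I 123 ∎)))))

  sides-opposite-forms : List Form
  sides-opposite-forms = cross 0 1 2 3 ∷ cross 0 3 4 5 ∷ cross 1 2 6 7 ∷ miss 1 0 1 ∷ miss 1 2 3 ∷ []

  sides-opposite-cert : Cert
  sides-opposite-cert =
    O 1 & osplit 0 (O 0 & I 1023 ∎) (O 0 & split 34 (O 10 & osplit 11 (O 11 & I 3045 ∎) (O 11 & split 235 (S 30215 &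
    split 15 (K 3215 & S 13025 & eq? 56 (E 5601 & E 5602 & E 5612 & O 20 & osplit 21 (O 21 & S 16027 & K 61027 & F 31
    67 ∎) (O 21 & I 1267 ∎)) (eq? 57 (E 5701 & E 5702 & E 5712 & O 20 & osplit 21 (O 21 & I 2167 ∎) (O 21 & K 71026 & F
    32 67 & S 17026 ∎)) (split 126 (O 20 & osplit 21 (O 21 & I 2167 ∎) (O 21 & split 17 (S 17026 & F 32 67 & K 71026 &
    K 3217 & S 21307 & S 72036 & F 42 67 & K 27136 ∎) (K 12307 & S 13507 & F 31 57 & K 3157 & K 31027 & K 27136 & S
    72136 & F 42 67 ∎))) (O 20 & osplit 21 (O 21 & split 236 (K 26137 & F 41 67 & K 72316 & K 31627 & K 31027 & K 12306 &
    S 30216 & I 3067 & F 31 67 & S 16027 ∎) (S 21306 & S 21356 & F 41 56 & S 30526 & K 31026 & K 12306 & S 16027 & K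
    61027 & F 31 67 ∎)) (O 21 & I 1267 ∎))))) (S 5134 & K 50134 & F 31 45 ∎)) (K 35024 & F 41 45 & K 43205 & S 53024 &
    S 2134 & K 20134 & S 40215 & K 3215 & F 31 45 ∎))) (O 10 & osplit 11 (O 11 & split 234 (S 30214 & split 14 (K 3214 &
    K 20134 & eq? 46 (E 4601 & E 4602 & E 4612 & O 20 & osplit 21 (O 21 & S 16027 & K 61027 & F 31 67 ∎) (O 21 & I 1267
    ∎)) (eq? 47 (E 4701 & E 4702 & E 4712 & O 20 & osplit 21 (O 21 & I 2167 ∎) (O 21 & K 71026 & F 32 67 & S 17026 ∎))
    (split 126 (O 20 & osplit 21 (O 21 & I 2167 ∎) (O 21 & split 237 (K 27136 & F 42 67 & S 72136 & K 12307 & S 17026 &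
    F 32 67 & K 71026 & S 72036 & K 3217 ∎) (S 21307 & K 20347 & F 41 47 & K 31427 & K 12307 & S 17026 & K 71026 & F 32
    67 ∎))) (O 20 & osplit 21 (O 21 & split 236 (K 26137 & F 41 67 & K 72316 & K 31627 & K 31027 & K 12306 & S 30216 &
    I 3067 & F 31 67 & S 16027 ∎) (S 21306 & K 20346 & F 41 46 & K 31426 & K 12306 & S 16027 & K 61027 & F 31 67 ∎)) (O
    21 & I 1267 ∎))))) (S 4135 & K 40135 & F 32 45 ∎)) (K 34025 & F 42 45 & K 53204 & S 43025 & K 20135 & K 3214 & S
    4135 & F 32 45 & S 50214 ∎)) (O 11 & I 345 ∎)))

  sector-forms : List Form
  sector-forms = cross 0 1 2 3 ∷ cross 0 3 4 5 ∷ tri 0 6 7 1 ∷ miss 1 0 1 ∷ miss 1 2 3 ∷ []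

  sector-cert : Cert
  sector-cert =
    O 11 & osplit 10 (O 10 & I 3045 ∎) (O 10 & eq? 2 (E 245 & E 234 & E 235 & F 42 45 ∎) (eq? 13 (E 1345 & E 1304 & E
    1305 & F 32 45 ∎) (osplit 20 (O 20 & O 21 & F 33 67 & split 13 (O 0 & osplit 1 (O 1 & split 14 (K 3214 & split 234
    (K 20134 & S 30214 & eq? 46 (E 4601 ∎) (split 136 (S 13406 & S 13067 & F 31 46 & K 3146 & K 7136 & S 30217 & eq? 47
    (E 4716 ∎) (S 30417 & S 14067 & K 7146 & S 40217 & F 41 47 ∎)) (I 1036 & S 30216 & S 30416 & K 3146 & F 41 46 & F
    31 46 & S 40216 ∎))) (K 34025 & S 43025 & F 42 45 ∎)) (S 4135 & F 32 45 & S 50314 & K 40135 & S 13025 & S 30214 & K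
    34025 & F 42 45 & K 53214 ∎)) (O 1 & I 123 ∎)) (O 0 & osplit 1 (O 1 & I 1023 ∎) (O 1 & split 15 (K 5314 & F 32 45 &
    S 50314 & S 12035 & K 30125 & K 53214 & F 42 45 & S 35204 ∎) (S 3125 & split 235 (S 35204 & K 53204 & F 42 45 ∎) (S
    20315 & K 30125 & eq? 56 (E 5617 & K 13057 & E 5607 & I 137 & K 30127 & K 30157 & K 50127 & F 42 57 ∎) (eq? 57 (E
    5701 ∎) (split 137 (I 137 & K 30127 & K 30157 & S 3517 & F 42 57 & F 32 57 & K 50127 ∎) (K 13057 & K 13067 & F 32
    57 & K 15067 & S 3517 & S 6517 & K 50126 & S 56103 & S 6317 & F 42 56 & K 30126 ∎)))))))) (O 20 & O 21 & I 1067 &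
    split 13 (O 0 & osplit 1 (O 1 & split 14 (K 3214 & split 234 (K 20134 & S 30214 & eq? 46 (E 4617 & S 13407 & E 4607 &
    I 1037 & S 30217 & S 30417 & S 40217 & F 41 47 ∎) (split 37 (I 1037 & K 6137 & S 13607 & K 3216 & S 30216 & S 30416 &
    K 20346 & F 41 46 ∎) (eq? 47 (E 4701 ∎) (K 3147 & F 31 47 & S 13407 & S 30217 & S 30417 & S 40217 & F 41 47 ∎))))
    (K 34025 & S 43025 & F 42 45 ∎)) (S 4135 & F 32 45 & S 50314 & K 40135 & S 13025 & S 30214 & K 34025 & F 42 45 & K
    53214 ∎)) (O 1 & I 123 ∎)) (O 0 & osplit 1 (O 1 & I 1023 ∎) (O 1 & split 15 (K 5314 & F 32 45 & S 50314 & S 12035 &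
    K 30125 & K 53214 & F 42 45 & S 35204 ∎) (S 3125 & split 235 (S 35204 & K 53204 & F 42 45 ∎) (S 20315 & K 30125 &
    eq? 56 (E 5601 ∎) (split 136 (I 136 & K 30126 & S 3516 & F 32 56 & K 50126 & S 56103 & F 42 56 ∎) (K 13056 & K
    13607 & F 32 56 & S 3516 & S 7316 & S 3127 & K 30127 & eq? 57 (E 5716 ∎) (K 30157 & S 20537 & F 42 57 ∎)))))))))))

  behind-middle-forms : List Form
  behind-middle-forms = same ⟨ 0 , 1 , 2 ⟩ ⟨ 0 , 2 , 3 ⟩ ∷ same ⟨ 0 , 1 , 2 ⟩ ⟨ 0 , 1 , 3 ⟩ ∷ cross 1 2 4 5 ∷ cross 2 3 6 7 ∷ miss 1 0 2 ∷ miss 1 0 1 ∷ miss 1 0 3 ∷ out 1 0 ∷ out 1 2 ∷ nbeh 1 0 2 ∷ []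

  behind-middle-cert : Cert
  behind-middle-cert =
    O 0 & osplit 21 (O 21 & split 124 (O 20 & I 2145 ∎) (O 20 & split 25 (S 25014 & F 42 45 & S 42105 & F 51 45 & K
    52014 ∎) (split 15 (osplit 31 (O 31 & split 236 (O 30 & I 3267 ∎) (O 30 & split 26 (eq? 56 (E 5602 ∎) (F 90 56 & F
    42 56 & S 1526 & K 56012 & F 51 56 ∎)) (F 90 67 & K 27306 ∎))) (O 31 & split 236 (O 30 & split 26 (eq? 56 (E 5602
    ∎) (F 90 56 & F 42 56 & S 1526 & K 56012 & F 51 56 ∎)) (K 26307 & F 42 67 & K 72036 & F 61 67 & S 62307 ∎)) (O 30 &
    I 2367 ∎))) (K 15204 & S 51204 & F 51 45 ∎)))) (O 21 & split 124 (O 20 & split 24 (S 24015 & F 41 45 & S 52104 & F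
    52 45 & K 42015 ∎) (F 90 45 & split 14 (osplit 31 (O 31 & split 236 (O 30 & I 3267 ∎) (O 30 & split 26 (eq? 46 (E
    4602 ∎) (F 90 46 & F 42 46 & S 1426 & K 46012 & F 51 46 ∎)) (F 90 67 & K 27306 ∎))) (O 31 & split 236 (O 30 & split
    26 (eq? 46 (E 4602 ∎) (F 90 46 & F 42 46 & S 1426 & K 46012 & F 51 46 ∎)) (K 26307 & F 42 67 & K 72036 & F 61 67 &
    S 62307 ∎)) (O 30 & I 2367 ∎))) (S 41205 & F 52 45 & S 52104 ∎))) (O 20 & I 1245 ∎))

  behind-shields-forms : List Form
  behind-shields-forms = tri 0 3 4 1 ∷ cross 0 2 5 6 ∷ miss 1 0 1 ∷ miss 1 1 2 ∷ []

  behind-shields-cert : Cert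
  behind-shields-cert =
    O 10 & osplit 11 (O 11 & I 2056 ∎) (O 11 & eq? 1 (E 125 & E 126 & E 156 & F 31 56 ∎) (eq? 12 (E 1205 & E 1206 & F
    21 56 & E 1256 ∎) (osplit 0 (O 0 & O 1 & F 23 34 & eq? 45 (E 4502 & E 4501 & split 16 (K 5216 & K 4123 & eq? 36 (E
    3601 ∎) (K 2316 & F 22 36 & split 126 (S 12036 & K 63012 & F 32 36 ∎) (K 26015 & S 62015 & F 31 56 ∎))) (F 21 56 &
    K 60125 & F 31 56 & S 50216 ∎)) (eq? 36 (E 3605 & E 3601 & split 156 (F 21 56 & K 52106 & S 6125 & S 3145 & F 21 45 &
    K 12405 & F 31 45 & I 124 & K 20415 ∎) (K 60125 & E 3615 & F 31 56 & K 26015 & E 3612 & S 50216 & K 12034 & K 15034 &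
    F 31 45 & I 124 & K 20415 ∎)) (eq? 46 (E 4602 & E 4605 & E 4613 & E 4601 & E 4603 & split 126 (K 63012 & E 4612 & F
    32 36 & I 124 & S 12034 ∎) (S 62015 & E 4612 & F 31 56 & S 50216 & E 4615 & K 26015 & K 12034 & eq? 35 (E 3506 ∎)
    (K 15034 & S 3145 & F 31 35 & S 53102 ∎))) (eq? 35 (E 3502 & E 3514 & E 3501 & split 125 (K 52106 & E 3512 & F 31
    56 & K 60125 & S 25106 & K 4123 & S 12034 & K 10426 & S 20146 & F 32 46 ∎) (E 3512 & I 1023 & K 12034 & I 124 & K
    20415 & F 31 45 ∎)) (split 12 (split 16 (split 126 (split 123 (S 12034 & S 12036 & K 10426 & F 22 36 & F 32 46 & K
    2316 & S 20146 & K 4123 ∎) (I 1023 & K 2316 & F 22 36 & K 63012 & F 32 36 ∎)) (K 26015 & S 62015 & F 31 56 ∎)) (S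
    6125 & F 21 56 & S 50216 & F 31 56 & K 60125 ∎)) (split 15 (K 5216 & F 21 56 & K 60125 & F 31 56 & S 50216 ∎)
    (split 125 (S 25106 & K 52106 & F 31 56 ∎) (split 124 (I 124 & K 20415 & S 2145 & F 31 45 & F 21 45 ∎) (K 12034 & K
    12405 & F 21 45 & K 15034 & S 3145 & F 31 35 & S 53102 ∎))))))))) (O 0 & O 1 & F 20 34 & eq? 45 (E 4502 & E 4506 &
    E 4513 & E 4501 & E 4503 & split 125 (K 52106 & E 4512 & F 31 56 & K 60125 & E 4516 & S 25106 & S 12304 & eq? 36 (E
    3605 ∎) (S 16304 & K 3416 & F 32 36 & K 63012 ∎)) (S 53102 & E 4512 & F 31 35 & I 1024 & K 12304 ∎)) (eq? 36 (E
    3602 & E 3614 & E 3601 & split 126 (E 3612 & I 123 & S 12304 & I 1024 & S 20146 & F 32 46 ∎) (S 62015 & E 3612 & F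
    31 56 & S 50216 & K 26015 & S 4213 & K 12304 & S 10245 & K 20415 & F 31 45 ∎)) (eq? 46 (E 4602 & E 4601 & split 15
    (F 21 56 & S 50216 & F 31 56 & K 60125 ∎) (S 6125 & S 4213 & eq? 35 (E 3501 ∎) (S 2135 & F 21 35 & split 125 (S
    25106 & K 52106 & F 31 56 ∎) (K 12305 & S 53102 & F 31 35 ∎)))) (eq? 35 (E 3506 & E 3501 & split 156 (F 21 56 & S
    62015 & K 5216 & K 3416 & F 22 46 & S 12046 & F 32 46 & I 1024 & S 20146 ∎) (S 50216 & E 3516 & F 31 56 & S 25106 &
    E 3512 & K 60125 & S 12304 & S 16304 & F 32 46 & I 1024 & S 20146 ∎)) (split 12 (split 16 (split 126 (split 124 (S
    12304 & S 12046 & F 22 46 & S 16304 & K 3416 & F 32 36 & K 63012 ∎) (I 1024 & S 20146 & K 2416 & F 32 46 & F 22 46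
    ∎)) (K 26015 & S 62015 & F 31 56 ∎)) (S 6125 & F 21 56 & S 50216 & F 31 56 & K 60125 ∎)) (split 15 (K 5216 & F 21
    56 & K 60125 & F 31 56 & S 50216 ∎) (split 125 (S 25106 & K 52106 & F 31 56 ∎) (split 123 (I 123 & S 2135 & F 21 35 &
    S 53102 & F 31 35 ∎) (K 12304 & K 12305 & S 10245 & F 21 35 & F 31 45 & S 2135 & K 20415 & S 4213 ∎))))))))))))

  between-forms : List Form
  between-forms = opp ⟨ 0 , 1 , 2 ⟩ ⟨ 0 , 2 , 3 ⟩ ∷ opp ⟨ 0 , 1 , 2 ⟩ ⟨ 0 , 1 , 3 ⟩ ∷ cross 1 2 4 5 ∷ tri 0 6 7 2 ∷ ncross 2 3 0 1 ∷ miss 1 0 1 ∷ miss 1 0 2 ∷ miss 1 2 3 ∷ []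

  between-cert : Cert
  between-cert =
    O 0 & O 10 & F 42 0 & osplit 30 (O 30 & O 31 & split 124 (O 20 & osplit 21 (O 21 & I 2145 ∎) (O 21 & split 24 (S
    24015 & F 61 45 & S 52104 & F 52 45 & K 42015 ∎) (S 20134 & split 14 (K 2314 & eq? 47 (E 4702 ∎) (split 127 (K
    21047 & F 62 47 & K 47012 & F 51 47 & S 1427 ∎) (I 1027 & K 23017 & S 1427 & F 62 47 & S 47203 & F 72 47 ∎))) (K
    14205 & S 41205 & F 52 45 ∎)))) (O 20 & osplit 21 (O 21 & split 25 (S 25014 & F 62 45 & S 42105 & F 51 45 & K 52014
    ∎) (S 20135 & split 15 (K 2315 & eq? 57 (E 5702 ∎) (split 57 (F 62 57 & S 57203 & F 72 57 & K 23057 ∎) (F 63 57 & S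
    1527 & K 57012 & F 51 57 ∎))) (K 15204 & S 51204 & F 51 45 ∎))) (O 21 & I 1245 ∎))) (O 30 & split 124 (O 20 &
    osplit 21 (O 21 & I 2145 ∎) (O 21 & split 24 (S 24015 & F 61 45 & S 52104 & F 52 45 & K 42015 ∎) (S 20134 & split
    14 (K 2314 & eq? 46 (E 4602 ∎) (split 246 (F 63 46 & K 23046 & S 46203 & F 72 46 ∎) (F 62 46 & K 46012 & F 51 46 &
    S 1426 ∎))) (K 14205 & S 41205 & F 52 45 ∎)))) (O 20 & osplit 21 (O 21 & split 25 (S 25014 & F 62 45 & S 42105 & F
    51 45 & K 52014 ∎) (S 20135 & split 15 (K 2315 & eq? 56 (E 5602 ∎) (split 256 (K 21056 & K 23056 & I 1026 & F 72 56 &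
    S 1526 & S 56203 ∎) (F 62 56 & K 56012 & F 51 56 & S 1526 ∎))) (K 15204 & S 51204 & F 51 45 ∎))) (O 21 & I 1245
    ∎)))

  common-chord-forms : List Form
  common-chord-forms = tri 0 3 4 1 ∷ tri 0 5 6 2 ∷ miss 1 0 1 ∷ miss 1 0 2 ∷ out 1 0 ∷ nbeh₂ 1 0 1 2 ∷ []

  common-chord-cert : Cert
  common-chord-cert =
    O 0 & O 1 & F 23 34 & eq? 12 (E 1203 & E 1234 & F 50 34 & E 1204 ∎) (osplit 10 (O 10 & O 11 & I 256 & eq? 45 (E
    4502 & E 4506 & eq? 36 (E 3604 ∎) (F 40 346 & S 3146 & K 6234 & F 32 36 & F 50 36 & F 22 36 ∎)) (eq? 36 (E 3604 & E
    3602 & F 40 456 & S 5426 & K 4123 & F 31 45 & K 4215 & F 51 45 & F 21 45 ∎) (eq? 46 (E 4625 & E 4602 & E 4605 &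
    split 23 (K 4123 & K 4215 & F 21 45 & F 51 45 ∎) (F 32 34 & F 50 34 ∎)) (split 45 (F 40 456 & K 6245 & F 40 346 & S
    3146 & K 6234 & F 22 36 & F 32 36 & F 50 36 ∎) (split 24 (F 31 45 & split 23 (K 4123 & K 4215 & F 21 45 & F 51 45
    ∎) (F 32 34 & F 50 34 ∎)) (S 5426 & F 40 346 & S 3146 & K 6234 & F 22 36 & F 32 36 & F 50 36 ∎)))))) (O 10 & O 11 &
    F 30 56 & eq? 45 (E 4526 & E 4502 & E 4506 & split 23 (K 4123 & K 4216 & F 21 46 & F 51 46 ∎) (F 32 34 & F 50 34
    ∎)) (eq? 46 (E 4602 & E 4605 & eq? 35 (E 3504 ∎) (F 40 345 & S 3145 & K 5234 & F 32 35 & F 50 35 & F 22 35 ∎)) (eq?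
    35 (E 3504 & E 3502 & F 41 456 & S 6425 & K 4123 & F 31 46 & K 4216 & F 51 46 & F 21 46 ∎) (split 46 (F 41 456 & K
    5246 & F 40 345 & S 3145 & K 5234 & F 22 35 & F 32 35 & F 50 35 ∎) (split 24 (F 31 46 & split 23 (K 4123 & K 4216 &
    F 21 46 & F 51 46 ∎) (F 32 34 & F 50 34 ∎)) (S 6425 & F 40 345 & S 3145 & K 5234 & F 22 35 & F 32 35 & F 50 35
    ∎)))))))

  -- The last four forms deny `Nearer`: neither end of the first chord lies before the second chord,
  -- and neither end of the second lies beyond the first.
  nearer-blocks-forms : List Form
  nearer-blocks-forms = cross 0 1 2 3 ∷ tri 0 4 5 1 ∷ disj ∷ ntri 0 4 5 2 ∷ ntri 0 4 5 3 ∷ ncross 0 4 2 3 ∷ ncross 0 5 2 3 ∷ []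

  nearer-blocks-cert : Cert
  nearer-blocks-cert =
    O 0 & osplit 1 (O 1 & I 1023 ∎) (O 1 & osplit 10 (O 10 & O 11 & I 145 & split 135 (I 135 & S 12035 & K 30125 & F 61
    0 & S 50214 & F 30 0 & K 5124 ∎) (K 13045 & I 3145 & split 34 (S 3124 & K 30124 & F 51 0 ∎) (F 40 0 & S 4315 ∎)))
    (O 10 & O 11 & I 1045 & split 24 (K 4125 & F 31 0 & S 40215 & S 12034 & K 21034 & S 12405 & K 42315 & F 22 2345 & S
    20315 ∎) (K 2314 & F 51 0 & K 30124 & S 40315 & S 20314 & F 41 0 & S 12405 & I 1025 & S 20315 & F 61 0 ∎)))

  nearer-chord-forms : List Form
  nearer-chord-forms = tri 0 3 4 1 ∷ tri 0 3 4 2 ∷ cross 1 2 5 6 ∷ disj ∷ ntri 0 3 4 5 ∷ ntri 0 3 4 6 ∷ ncross 0 3 5 6 ∷ ncross 0 4 5 6 ∷ []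

  nearer-chord-cert : Cert
  nearer-chord-cert =
    O 21 & osplit 20 (O 20 & I 2156 ∎) (O 20 & osplit 0 (O 0 & O 1 & I 134 & split 234 (O 10 & O 11 & split 35 (split
    45 (S 3145 & S 3245 & K 51026 & split 46 (K 5146 & K 5246 & K 62015 ∎) (F 71 0 & S 50146 & S 15034 & K 43015 & K
    30425 & S 52136 & F 32 3456 & S 35416 & S 35426 & S 61235 ∎)) (F 40 0 & S 40135 & S 40235 & K 30415 & K 30425 & K
    51426 & S 52136 & F 32 3456 & K 45136 & K 45236 & K 62415 ∎)) (split 45 (F 41 0 & K 43015 & K 43025 & S 34105 & S
    34205 & S 52146 & K 51326 & F 31 3456 & split 36 (F 50 0 & F 62 0 & S 3246 & K 62015 & S 53106 & K 5146 ∎) (S 34106 &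
    S 34206 & K 62315 ∎)) (K 4315 & K 4325 & S 52106 & split 345 (S 34105 & S 34205 & K 51326 & F 62 0 & K 35106 & K
    35206 & K 62315 ∎) (S 40135 & S 40235 & K 51426 & F 72 0 & split 36 (F 50 0 & K 45136 & K 45236 & K 62415 ∎) (S
    5316 & S 5326 & S 61205 ∎))))) (O 10 & O 11 & I 2034 ∎)) (O 0 & O 1 & I 1034 & split 234 (O 10 & O 11 & I 234 ∎) (O
    10 & O 11 & split 45 (split 35 (S 4135 & S 4235 & K 51026 & split 345 (K 40315 & S 50146 & F 71 0 & split 36 (S
    4136 & S 4236 & K 62015 ∎) (F 51 0 & F 61 0 & S 30146 & S 30246 & K 62315 ∎)) (K 34015 & K 34025 & S 52136 & F 61 0 &
    S 35016 & S 35026 & S 61235 ∎)) (F 41 0 & S 30145 & S 30245 & K 40315 & K 40325 & K 51326 & S 52146 & F 31 3456 & K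
    35146 & K 35246 & K 62315 ∎)) (split 35 (F 40 0 & K 34015 & K 34025 & S 43105 & S 43205 & S 52136 & K 51426 & F 32
    3456 & split 46 (F 51 0 & F 72 0 & S 4136 & S 4236 & K 62015 ∎) (K 45106 & K 45206 & K 62415 ∎)) (K 3415 & K 3425 &
    S 52106 & split 46 (F 72 0 & K 50426 & S 43205 & S 30145 & S 30245 & K 51326 & F 31 3456 & K 35146 & K 35246 & K
    62315 ∎) (S 5416 & S 5426 & S 61205 ∎))))))

  before-before-forms : List Form
  before-before-forms = tri 0 4 5 1 ∷ tri 0 2 3 6 ∷ out 1 0 ∷ out 2 0 ∷ disj ∷ []

  before-before-cert : Cert
  before-before-cert =
    O 10 & O 11 & osplit 0 (O 0 & O 1 & eq? 56 (E 5614 & E 5601 & I 146 & eq? 13 (E 1306 ∎) (split 136 (I 136 & S 13046 &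
    K 64013 & F 42 1346 ∎) (eq? 12 (E 1236 ∎) (K 61023 & F 40 1236 ∎)))) (eq? 13 (E 1326 & E 1306 & I 1026 & split 156
    (eq? 46 (E 4615 ∎) (F 40 4561 & K 16045 ∎)) (I 1056 & K 12506 & S 65102 & F 41 1256 ∎)) (eq? 46 (E 4615 & E 4601 &
    I 1056 & eq? 12 (E 1206 ∎) (split 126 (F 40 1236 & S 61023 ∎) (I 1026 & K 12506 & S 65102 & F 41 1256 ∎))) (split
    146 (eq? 12 (E 1206 & E 1236 & I 136 & I 146 & S 13046 & F 42 1346 & K 64013 ∎) (split 136 (split 16 (I 136 & I 146 &
    S 13046 & K 64013 & F 42 1346 ∎) (S 61023 & K 16045 & I 1026 & K 12506 & F 41 1256 & I 1056 & S 65102 ∎)) (F 40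
    1236 & K 61023 & I 1026 & K 16045 & K 12506 & F 41 1256 & I 1056 & S 65102 ∎))) (F 40 4561 & S 16045 & I 1056 & eq?
    12 (E 1206 ∎) (split 126 (F 40 1236 & S 61023 ∎) (I 1026 & K 12506 & S 65102 & F 41 1256 ∎))))))) (O 0 & O 1 & eq?
    56 (E 5614 & E 5601 & I 1046 & eq? 13 (E 1326 & S 64102 & I 1026 & K 12406 & F 41 1246 ∎) (eq? 12 (E 1206 ∎) (split
    126 (F 40 1236 & S 61023 ∎) (I 1026 & K 12406 & S 64102 & F 41 1246 ∎)))) (eq? 13 (E 1326 & E 1306 & E 1304 & I
    1026 & eq? 46 (E 4603 ∎) (split 146 (F 41 4561 & K 16405 ∎) (I 1046 & K 12406 & S 64102 & F 41 1246 ∎))) (eq? 46 (E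
    4615 & E 4601 & I 156 & split 136 (I 136 & S 13056 & K 65013 & F 42 1356 ∎) (eq? 12 (E 1236 ∎) (K 61023 & F 40 1236
    ∎))) (split 146 (F 41 4561 & K 16405 & I 156 & split 136 (I 136 & S 13056 & K 65013 & F 42 1356 ∎) (eq? 12 (E 1236
    ∎) (K 61023 & F 40 1236 ∎))) (eq? 12 (E 1206 & E 1236 & I 136 & S 16405 & I 156 & S 13056 & K 65013 & F 42 1356 ∎)
    (split 126 (F 40 1236 & S 61023 & I 136 & S 16405 & S 13056 & F 42 1356 & I 156 & K 65013 ∎) (split 16 (K 61023 & S
    16405 & I 136 & S 13056 & F 42 1356 & I 156 & K 65013 ∎) (I 1026 & I 1046 & K 12406 & S 64102 & F 41 1246 ∎))))))))

  before-beyond-forms : List Form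
  before-beyond-forms = tri 0 3 4 1 ∷ cross 0 2 5 6 ∷ out 1 0 ∷ out 2 0 ∷ disj ∷ []

  before-beyond-cert : Cert
  before-beyond-cert =
    O 0 & O 1 & osplit 11 (O 11 & split 26 (O 10 & eq? 46 (E 4613 & E 4601 & I 136 & split 156 (eq? 12 (E 1256 ∎) (S
    60215 & F 42 1256 & K 50126 & S 26105 & S 12036 & F 42 1236 & eq? 35 (E 3501 ∎) (K 6315 & S 15036 & F 41 3562 & K
    53012 ∎))) (E 4615 & eq? 35 (E 3514 ∎) (F 41 3561 & K 15036 & K 6315 & eq? 12 (E 1205 ∎) (S 52016 & K 6215 & K
    53012 & F 42 1235 & S 12036 & F 41 3562 & S 60213 ∎)))) (eq? 36 (E 3601 & E 3614 & I 1046 & E 3602 & eq? 12 (E 1203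
    ∎) (split 126 (K 62105 & F 42 1256 & K 50126 & E 3615 & eq? 45 (E 4513 ∎) (S 15406 & F 40 4561 ∎)) (I 1026 & K
    12406 & S 64102 & F 41 1246 ∎))) (split 136 (split 16 (I 136 & eq? 12 (E 1256 & E 1205 & E 1236 & eq? 35 (E 3526 ∎)
    (K 15036 & F 41 3561 ∎)) (eq? 35 (E 3501 & E 3526 & S 60213 & E 3516 & K 50126 & F 42 1256 ∎) (split 156 (S 60215 &
    F 42 1256 & S 26105 & K 50126 & S 12036 & K 6315 & S 15036 & F 42 1235 & K 53012 ∎) (F 41 3561 & K 15036 & K 6215 &
    S 52016 & K 6315 & K 53012 & F 42 1235 & F 41 3562 & S 12036 & S 60213 ∎)))) (K 16034 & I 1046 & eq? 12 (E 1206 ∎)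
    (split 126 (K 62105 & F 42 1256 & K 50126 & eq? 45 (E 4506 ∎) (S 15406 & F 40 4561 ∎)) (I 1026 & K 12406 & S 64102 &
    F 41 1246 ∎)))) (F 40 3461 & S 16034 & I 1046 & eq? 12 (E 1206 ∎) (split 126 (K 62105 & F 42 1256 & K 50126 & eq?
    45 (E 4506 ∎) (S 15406 & F 40 4561 ∎)) (I 1026 & K 12406 & S 64102 & F 41 1246 ∎)))))) (O 10 & I 2056 ∎)) (O 11 &
    split 26 (O 10 & I 256 ∎) (O 10 & eq? 46 (E 4613 & E 4601 & E 4602 & I 136 & eq? 12 (E 1204 ∎) (split 126 (I 126 &
    S 12036 & K 63012 & F 42 1236 ∎) (S 62015 & F 41 1256 & S 50216 & E 4615 & eq? 35 (E 3514 ∎) (K 15036 & F 41 3561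
    ∎)))) (eq? 36 (E 3601 & E 3614 & I 1046 & split 156 (E 3615 & eq? 45 (E 4513 ∎) (K 60415 & F 40 4561 & S 15406 & S
    6145 & K 52406 & F 40 4562 & E 3624 & eq? 12 (E 1234 ∎) (K 52106 & K 60124 & K 26015 & K 12406 & F 41 1246 ∎)))
    (eq? 12 (E 1256 ∎) (K 60125 & F 41 1256 & S 50216 & K 26015 & K 12406 & F 41 1246 & I 124 & eq? 45 (E 4501 ∎) (F 40
    4562 & S 25406 ∎)))) (split 146 (F 40 3461 & K 16034 & I 136 & eq? 12 (E 1206 ∎) (split 126 (I 126 & S 12036 & K
    63012 & F 42 1236 ∎) (S 62015 & F 41 1256 & S 50216 & eq? 35 (E 3506 ∎) (K 15036 & F 41 3561 ∎)))) (split 16 (S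
    16034 & I 136 & eq? 12 (E 1206 ∎) (split 126 (I 126 & S 12036 & K 63012 & F 42 1236 ∎) (S 62015 & F 41 1256 & S
    50216 & eq? 35 (E 3506 ∎) (K 15036 & F 41 3561 ∎)))) (I 1046 & eq? 12 (E 1204 & E 1246 & eq? 45 (E 4526 ∎) (F 40
    4562 & S 25406 ∎)) (eq? 45 (E 4501 & E 4526 & K 60124 & E 4516 & S 50216 & F 41 1256 ∎) (split 156 (F 40 4561 & S
    15406 & K 60415 & K 52106 & S 6145 & K 52406 & I 1025 & F 40 4562 & K 60124 & F 41 1246 & K 12406 ∎) (K 60125 & F
    41 1256 & K 26015 & K 12406 & F 41 1246 & I 124 & F 40 4562 & S 25406 ∎)))))))))

  beyond-beyond-forms : List Form
  beyond-beyond-forms = cross 0 4 1 2 ∷ cross 0 3 5 6 ∷ out 1 0 ∷ out 2 0 ∷ disj ∷ []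

  beyond-beyond-cert : Cert
  beyond-beyond-cert =
    O 0 & osplit 1 (O 1 & I 1024 ∎) (O 1 & osplit 11 (O 11 & split 36 (O 10 & eq? 45 (E 4536 & E 4506 & E 4503 & eq? 13
    (E 1302 & E 1324 & K 34026 & F 42 2346 & S 43026 ∎) (eq? 23 (E 2304 ∎) (split 234 (F 40 1234 & S 41023 ∎) (S 43026 &
    F 42 2346 & K 34026 & F 21 123 & K 1324 ∎)))) (eq? 46 (E 4635 & E 4605 & E 4603 & eq? 13 (E 1304 ∎) (eq? 23 (E 2301 &
    E 2314 & S 34105 & F 41 1345 & K 43105 ∎) (split 134 (K 43105 & F 41 1345 & S 34105 & F 21 123 & S 2134 ∎) (F 40
    1234 & K 42103 ∎)))) (eq? 13 (E 1304 & E 1302 & E 1324 & split 346 (F 41 4563 & K 35046 ∎) (K 34026 & F 42 2346 & S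
    43026 & F 30 456 & S 5436 ∎)) (eq? 23 (E 2304 & E 2301 & E 2314 & split 345 (S 34105 & F 41 1345 & K 43105 & F 30
    456 & K 6345 ∎) (F 41 4563 & S 36405 ∎)) (split 134 (split 345 (split 13 (F 21 123 & S 2134 & S 41023 & K 35046 & K
    34026 & F 42 2346 & S 43026 & F 30 456 & S 5436 ∎) (split 34 (S 34105 & F 41 1345 & K 43105 & F 30 456 & K 6345 ∎)
    (K 1324 & S 41023 & K 35046 & K 34026 & F 42 2346 & S 43026 & F 30 456 & S 5436 ∎))) (F 41 4563 & S 36405 & S 41023 &
    split 23 (K 34026 & F 42 2346 & S 43026 & F 30 456 & S 5436 ∎) (F 21 123 & K 1324 ∎))) (F 40 1234 & K 42103 & split
    346 (F 41 4563 & K 35046 ∎) (split 23 (K 34026 & F 42 2346 & S 43026 & F 30 456 & S 5436 ∎) (F 21 123 & K 1324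
    ∎)))))))) (O 10 & I 3056 ∎)) (O 11 & split 35 (O 10 & eq? 45 (E 4536 & E 4506 & E 4503 & eq? 13 (E 1304 ∎) (eq? 23
    (E 2301 & E 2314 & S 34106 & F 41 1346 & K 43106 ∎) (split 134 (K 43106 & F 41 1346 & S 34106 & F 21 123 & S 2134
    ∎) (F 40 1234 & K 42103 ∎)))) (eq? 46 (E 4635 & E 4605 & E 4603 & eq? 13 (E 1302 & E 1324 & K 34025 & F 42 2345 & S
    43025 ∎) (eq? 23 (E 2304 ∎) (split 234 (F 40 1234 & S 41023 ∎) (S 43025 & F 42 2345 & K 34025 & F 21 123 & K 1324
    ∎)))) (eq? 13 (E 1304 & E 1302 & E 1324 & split 345 (F 40 4563 & K 36045 ∎) (K 34025 & F 42 2345 & S 43025 & F 31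
    456 & S 6435 ∎)) (eq? 23 (E 2304 & E 2301 & E 2314 & split 346 (S 34106 & F 41 1346 & K 43106 & F 31 456 & K 5346
    ∎) (F 40 4563 & S 35406 ∎)) (split 134 (split 346 (split 13 (F 21 123 & S 2134 & S 41023 & K 36045 & K 34025 & F 42
    2345 & S 43025 & F 31 456 & S 6435 ∎) (split 34 (S 34106 & F 41 1346 & K 43106 & F 31 456 & K 5346 ∎) (K 1324 & S
    41023 & K 36045 & K 34025 & F 42 2345 & S 43025 & F 31 456 & S 6435 ∎))) (F 40 4563 & S 35406 & S 41023 & split 23
    (K 34025 & F 42 2345 & S 43025 & F 31 456 & S 6435 ∎) (F 21 123 & K 1324 ∎))) (F 40 1234 & K 42103 & split 345 (F
    40 4563 & K 36045 ∎) (split 13 (F 21 123 & K 34025 & F 42 2345 & S 43025 & F 31 456 & S 6435 ∎) (K 1324 & K 34025 &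
    F 42 2345 & S 43025 & F 31 456 & S 6435 ∎)))))))) (O 10 & I 356 ∎)))

  behind-blocked-forms : List Form
  behind-blocked-forms = same ⟨ 0 , 2 , 1 ⟩ ⟨ 0 , 1 , 3 ⟩ ∷ same ⟨ 0 , 2 , 1 ⟩ ⟨ 0 , 2 , 3 ⟩ ∷ cross 0 2 4 5 ∷ cross 0 3 6 7 ∷ miss 1 0 1 ∷ out 1 0 ∷ nbeh 1 0 1 ∷ []

  behind-blocked-cert : Cert
  behind-blocked-cert =
    O 30 & osplit 31 (O 31 & I 3067 ∎) (osplit 0 (O 0 & O 10 & split 17 (split 24 (O 20 & osplit 21 (O 21 & I 2045 ∎)
    (split 14 (K 4215 & F 41 45 & F 61 45 ∎) (S 2134 & eq? 47 (E 4701 ∎) (K 3417 & F 42 47 & F 60 47 ∎)))) (O 20 &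
    osplit 21 (split 15 (K 5214 & F 42 45 & F 60 45 ∎) (S 2135 & eq? 57 (E 5701 ∎) (K 3517 & F 42 57 & F 60 57 ∎))) (O
    21 & I 245 ∎))) (S 7136 & F 41 67 & F 61 67 ∎)) (O 0 & O 10 & split 16 (K 6317 & F 41 67 & F 61 67 ∎) (S 3126 &
    split 24 (O 20 & osplit 21 (O 21 & I 2045 ∎) (split 15 (eq? 56 (E 5601 ∎) (K 2156 & F 41 56 & F 61 56 ∎)) (S 5124 &
    F 41 45 & F 61 45 ∎))) (O 20 & osplit 21 (split 14 (eq? 46 (E 4601 ∎) (K 2146 & F 41 46 & F 61 46 ∎)) (S 4125 & F
    42 45 & F 60 45 ∎)) (O 21 & I 245 ∎)))))

  behind-between-forms : List Form
  behind-between-forms = same ⟨ 0 , 1 , 2 ⟩ ⟨ 0 , 2 , 3 ⟩ ∷ same ⟨ 0 , 1 , 2 ⟩ ⟨ 0 , 1 , 3 ⟩ ∷ tri 0 4 5 1 ∷ tri 0 6 7 3 ∷ miss 1 0 2 ∷ out 1 0 ∷ miss 1 0 1 ∷ miss 1 0 3 ∷ nbeh 1 0 2 ∷ []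

  behind-between-cert : Cert
  behind-between-cert =
    O 30 & O 31 & I 367 & osplit 20 (O 20 & O 21 & F 63 45 & osplit 0 (O 0 & O 10 & split 26 (K 3126 & split 25 (K 5124 &
    F 42 45 & F 80 45 ∎) (eq? 56 (E 5602 ∎) (S 1526 & F 42 56 & F 80 56 ∎))) (S 6237 & F 42 67 & F 80 67 ∎)) (O 0 & O
    10 & split 24 (K 1324 & split 27 (K 7326 & F 42 67 & F 80 67 ∎) (eq? 47 (E 4702 ∎) (S 3247 & F 41 47 & F 81 47 ∎)))
    (S 4215 & F 42 45 & F 80 45 ∎))) (O 20 & O 21 & F 60 45 & osplit 0 (O 0 & O 10 & split 26 (K 3126 & eq? 56 (E 5601
    ∎) (split 56 (K 6125 & F 42 56 & F 80 56 ∎) (eq? 46 (E 4605 ∎) (K 4516 & F 51 456 ∎)))) (S 6237 & F 42 67 & F 80 67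
    ∎)) (O 0 & O 10 & split 25 (K 1325 & split 27 (K 7326 & F 42 67 & F 80 67 ∎) (eq? 57 (E 5702 ∎) (S 3257 & F 41 57 &
    F 81 57 ∎))) (S 5214 & F 41 45 & F 81 45 ∎)))

  behind-straddling-forms : List Form
  behind-straddling-forms = opp ⟨ 0 , 1 , 2 ⟩ ⟨ 0 , 1 , 3 ⟩ ∷ cross 1 2 4 5 ∷ cross 0 3 6 7 ∷ miss 1 0 1 ∷ nbeh 1 0 1 ∷ nbeh 1 1 0 ∷ []

  behind-straddling-cert : Cert
  behind-straddling-cert =
    O 11 & osplit 10 (O 10 & I 2145 ∎) (O 10 & osplit 0 (O 0 & split 14 (osplit 21 (O 21 & split 36 (O 20 & I 3067 ∎)
    (O 20 & split 16 (F 50 67 & K 7316 ∎) (eq? 46 (E 4601 ∎) (F 41 46 & F 50 46 & F 31 46 ∎)))) (O 21 & split 36 (O 20 &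
    split 16 (K 6317 & F 31 67 & F 41 67 ∎) (eq? 46 (E 4601 ∎) (F 41 46 & F 50 46 & F 31 46 ∎))) (O 20 & I 367 ∎))) (F
    40 45 & K 15204 ∎)) (O 0 & split 15 (F 40 45 & S 14025 ∎) (osplit 21 (O 21 & split 36 (O 20 & I 3067 ∎) (O 20 &
    split 17 (eq? 57 (E 5701 ∎) (F 40 57 & F 51 57 & F 32 57 ∎)) (F 50 67 & S 6137 ∎))) (O 21 & split 36 (O 20 & split
    17 (eq? 57 (E 5701 ∎) (F 40 57 & F 51 57 & F 32 57 ∎)) (S 7136 & F 31 67 & F 41 67 ∎)) (O 20 & I 367 ∎)))))

  behind-neighbour-forms : List Form
  behind-neighbour-forms = tri 0 4 5 1 ∷ cross 3 2 6 7 ∷ opp ⟨ 0 , 2 , 1 ⟩ ⟨ 0 , 2 , 3 ⟩ ∷ same ⟨ 0 , 1 , 3 ⟩ ⟨ 0 , 1 , 2 ⟩ ∷ miss 1 0 1 ∷ miss 1 0 2 ∷ miss 1 3 0 ∷ out 1 0 ∷ out 1 1 ∷ out 1 2 ∷ out 1 3 ∷ nbeh 1 0 2 ∷ []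

  behind-neighbour-cert : Cert
  behind-neighbour-cert =
    O 20 & O 30 & osplit 0 (O 0 & O 1 & I 145 & split 24 (K 1324 & osplit 11 (O 11 & split 236 (O 10 & split 26 (F 111
    67 & S 27036 ∎) (eq? 46 (E 4602 ∎) (F 111 46 & K 26034 & F 51 46 & S 3246 & S 62307 & K 42036 & F 52 67 & eq? 47 (E
    4702 ∎) (F 100 467 & K 37246 ∎)))) (O 10 & I 2367 ∎)) (O 11 & split 236 (O 10 & I 3267 ∎) (O 10 & split 26 (S 26037 &
    F 51 67 & S 72306 & F 61 67 & K 62037 ∎) (F 110 67 & eq? 46 (E 4602 ∎) (F 111 46 & F 51 46 & S 3246 & S 63207 & S
    72306 & F 61 67 ∎))))) (S 4215 & F 52 45 & F 110 45 ∎)) (O 0 & O 1 & F 40 45 & split 25 (K 1325 & osplit 11 (O 11 &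
    split 236 (O 10 & split 26 (F 111 67 & S 27036 ∎) (eq? 56 (E 5602 ∎) (F 111 56 & K 26035 & F 51 56 & S 3256 & S
    62307 & F 63 56 & F 52 67 & eq? 57 (E 5702 ∎) (F 100 567 & K 37256 ∎)))) (O 10 & I 2367 ∎)) (O 11 & split 236 (O 10 &
    I 3267 ∎) (O 10 & split 26 (S 26037 & F 51 67 & S 72306 & F 61 67 & K 62037 ∎) (F 110 67 & eq? 56 (E 5602 ∎) (F 111
    56 & F 51 56 & S 3256 & S 63207 & S 72306 & F 61 67 ∎))))) (S 5214 & F 51 45 & F 111 45 ∎))

  upper-order-forms : List Form
  upper-order-forms = cross 0 2 1 3 ∷ same ⟨ 0 , 2 , 3 ⟩ ⟨ 0 , 2 , 4 ⟩ ∷ opp ⟨ 2 , 4 , 3 ⟩ ⟨ 2 , 4 , 0 ⟩ ∷ cross 2 4 5 6 ∷ cross 2 1 7 8 ∷ miss 1 0 2 ∷ miss 1 1 3 ∷ miss 1 2 3 ∷ []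

  upper-order-cert : Cert
  upper-order-cert =
    O 1 & osplit 0 (O 0 & I 123 ∎) (O 0 & O 10 & O 20 & eq? 14 (E 1402 ∎) (S 23014 & split 128 (O 40 & osplit 41 (O 41 &
    I 1278 ∎) (O 41 & split 28 (S 28017 & F 52 78 & K 82017 & S 12308 & K 18237 & F 62 78 & K 71328 & F 71 78 & S 81237
    ∎) (K 21308 & K 21408 & split 138 (K 18237 & S 81237 & F 62 78 ∎) (S 12308 & K 32018 & eq? 58 (E 5802 & E 5824 & O
    30 & osplit 31 (O 31 & I 4256 ∎) (K 25406 & E 5826 & F 51 68 & S 1268 & I 1026 & K 3126 & S 12306 & S 12068 & S
    61038 & F 61 68 ∎)) (eq? 68 (E 6802 & E 6824 & E 6801 & O 30 & osplit 31 (K 26405 & E 6825 & F 51 56 & F 51 58 & S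
    1256 & K 85012 & K 81305 & I 1025 & S 12305 & F 61 58 ∎) (O 31 & I 2456 ∎)) (split 246 (O 30 & osplit 31 (split 26
    (S 24016 & K 21608 & F 51 68 & S 1268 & K 3126 & S 12306 & S 12068 & S 61038 & F 61 68 ∎) (K 26405 & F 51 56 &
    split 125 (K 21548 & F 51 58 & K 85012 & S 1258 & K 81305 & F 61 58 & S 12305 ∎) (I 1025 & K 26415 & S 1256 & S
    12306 & K 21306 & S 12068 & F 61 68 & K 32618 ∎))) (O 31 & I 2456 ∎)) (O 30 & osplit 31 (O 31 & I 4256 ∎) (split
    126 (K 21406 & K 21608 & F 51 68 & S 1268 & K 3126 & S 12306 & S 12068 & S 61038 & F 61 68 ∎) (K 25416 & split 26
    (S 23016 & I 2136 & S 31268 & S 26345 & F 71 56 & S 31526 & S 38526 & F 61 58 & S 12358 ∎) (S 20168 & S 23648 & I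
    2136 & S 31268 & S 26345 & F 71 56 & S 31526 & S 38526 & F 61 58 & S 12358 ∎)))))))))) (O 40 & osplit 41 (O 41 &
    split 27 (S 27018 & F 51 78 & K 72018 & S 12307 & K 17238 & F 61 78 & K 81327 & F 72 78 & S 71238 ∎) (K 21307 & S
    23407 & split 137 (K 17238 & S 71238 & F 61 78 ∎) (S 12307 & K 32017 & eq? 67 (E 6702 & E 6724 & E 6701 & O 30 &
    osplit 31 (K 26405 & E 6725 & F 51 56 & F 51 57 & S 1256 & K 75012 & K 71305 & I 1025 & S 12305 & F 61 57 ∎) (O 31 &
    I 2456 ∎)) (eq? 57 (E 5702 & E 5724 & O 30 & osplit 31 (O 31 & I 4256 ∎) (K 25406 & E 5726 & F 51 67 & S 1267 & K
    76012 & S 72306 & I 1026 & S 12306 & F 61 67 ∎)) (split 246 (O 30 & osplit 31 (split 26 (S 24016 & K 21607 & F 51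
    67 & K 76012 & S 72306 & S 1267 & F 61 67 & S 12306 ∎) (K 26405 & F 51 56 & split 125 (K 21507 & F 51 57 & K 75012 &
    S 1257 & K 71305 & F 61 57 & S 12305 ∎) (I 1025 & K 10527 & K 26415 & S 1256 & S 1257 & I 1256 & S 12306 & K 21306 &
    S 15067 & F 51 57 & F 61 67 & S 61237 & K 26547 ∎))) (O 31 & I 2456 ∎)) (O 30 & osplit 31 (O 31 & I 4256 ∎) (split
    126 (K 21406 & K 21607 & F 51 67 & S 1267 & K 76012 & S 72306 & S 12306 & F 61 67 ∎) (K 25416 & I 2156 & split 26
    (I 1026 & S 23016 & K 10627 & I 2136 & S 26345 & F 71 56 & S 31526 & K 32517 & F 61 57 & S 16357 ∎) (K 25406 & K
    21507 & F 51 57 & K 75012 & S 1257 & K 71305 & F 61 57 & S 12305 ∎))))))))) (O 41 & I 2178 ∎))))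

  upper-inside-forms : List Form
  upper-inside-forms = cross 2 4 0 1 ∷ cross 2 4 3 5 ∷ cross 2 3 0 1 ∷ ncross 3 5 0 1 ∷ same ⟨ 2 , 4 , 5 ⟩ ⟨ 2 , 4 , 1 ⟩ ∷ same ⟨ 4 , 1 , 5 ⟩ ⟨ 4 , 1 , 2 ⟩ ∷ opp ⟨ 0 , 1 , 5 ⟩ ⟨ 0 , 1 , 4 ⟩ ∷ []

  upper-inside-cert : Cert
  upper-inside-cert =
    O 1 & O 21 & O 60 & osplit 0 (O 0 & I 1024 ∎) (O 0 & O 40 & O 50 & O 10 & split 123 (O 20 & osplit 11 (O 11 & split
    135 (I 1345 & K 14035 ∎) (F 31 0 & S 31205 ∎)) (O 11 & I 3245 ∎)) (I 1234 & K 14203 ∎))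

  trapped-vy-forms : List Form
  trapped-vy-forms = cross 2 3 0 1 ∷ miss 1 2 3 ∷ miss 1 0 1 ∷ miss 1 3 1 ∷ same ⟨ 2 , 3 , 4 ⟩ ⟨ 2 , 3 , 1 ⟩ ∷ same ⟨ 3 , 1 , 4 ⟩ ⟨ 3 , 1 , 2 ⟩ ∷ same ⟨ 0 , 1 , 4 ⟩ ⟨ 0 , 1 , 3 ⟩ ∷ cross 0 3 5 6 ∷ []

  trapped-vy-cert : Cert
  trapped-vy-cert =
    O 70 & osplit 0 (O 0 & O 40 & O 50 & osplit 1 (O 1 & I 1023 ∎) (O 1 & O 60 & S 13024 & K 31024 & K 3214 & eq? 45 (E
    4503 ∎) (split 345 (K 31045 & F 32 45 & S 45013 & F 21 45 & S 1435 ∎) (K 34025 & F 12 45 & K 45213 & K 41025 & F 21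
    45 & S 1435 ∎)))) (O 0 & O 40 & O 50 & osplit 1 (O 1 & O 60 & K 13204 & S 31204 & S 3124 & eq? 46 (E 4603 ∎) (split
    346 (S 34206 & F 11 46 & S 20346 & K 21046 & S 46123 & K 14206 & F 22 46 & S 41206 ∎) (S 31406 & F 31 46 & S 12436 &
    K 14206 & K 46103 & F 22 46 ∎))) (O 1 & I 123 ∎))

  trapped-ax-forms : List Form
  trapped-ax-forms = cross 2 3 0 1 ∷ miss 1 2 3 ∷ miss 1 0 1 ∷ miss 1 3 1 ∷ same ⟨ 2 , 3 , 4 ⟩ ⟨ 2 , 3 , 1 ⟩ ∷ same ⟨ 3 , 1 , 4 ⟩ ⟨ 3 , 1 , 2 ⟩ ∷ same ⟨ 0 , 1 , 4 ⟩ ⟨ 0 , 1 , 3 ⟩ ∷ cross 2 1 5 6 ∷ []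

  trapped-ax-cert : Cert
  trapped-ax-cert =
    O 0 & O 40 & O 50 & osplit 1 (O 1 & I 1023 ∎) (O 1 & O 60 & S 13024 & S 21304 & split 125 (eq? 45 (E 4512 ∎) (split
    145 (S 14025 & F 21 45 & K 41025 & K 23145 & S 45213 & F 12 45 ∎) (I 1245 & S 13425 & K 45213 & F 32 45 ∎))) (O 70 &
    eq? 46 (E 4612 ∎) (split 146 (S 14026 & F 21 46 & K 41026 & K 23146 & S 46213 & F 12 46 ∎) (S 13426 & F 32 46 & K
    46213 & F 12 46 & K 23146 ∎))))

  -- Lying in the triangle is a condition for each of its three sides; the last form of each of the
  -- three certificates puts corner 5 beyond one side.
  inside-corner₁-forms : List Form
  inside-corner₁-forms = cross 2 3 0 1 ∷ miss 1 2 3 ∷ miss 1 0 1 ∷ miss 1 3 1 ∷ same ⟨ 2 , 3 , 4 ⟩ ⟨ 2 , 3 , 1 ⟩ ∷ same ⟨ 3 , 1 , 4 ⟩ ⟨ 3 , 1 , 2 ⟩ ∷ same ⟨ 0 , 1 , 4 ⟩ ⟨ 0 , 1 , 3 ⟩ ∷ cross 3 4 5 6 ∷ opp ⟨ 2 , 3 , 5 ⟩ ⟨ 2 , 3 , 1 ⟩ ∷ []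

  inside-corner₁-cert : Cert
  inside-corner₁-cert =
    O 1 & O 60 & osplit 0 (O 0 & I 1023 ∎) (O 0 & O 40 & O 50 & O 80 & K 13204 & split 345 (O 70 & osplit 71 (O 71 & I
    4356 ∎) (O 71 & K 35426 & F 12 56 & K 63245 & S 53426 & S 23416 & K 46123 & K 62145 & K 21345 & S 45123 & S 12046 &
    S 20315 & K 14205 & K 51026 & F 21 56 ∎)) (O 70 & I 3245 & S 31425 & K 45123 & osplit 71 (O 71 & S 35146 & K 53146 &
    F 32 56 ∎) (O 71 & I 3456 ∎)))

  inside-corner₂-forms : List Form
  inside-corner₂-forms = cross 2 3 0 1 ∷ miss 1 2 3 ∷ miss 1 0 1 ∷ miss 1 3 1 ∷ same ⟨ 2 , 3 , 4 ⟩ ⟨ 2 , 3 , 1 ⟩ ∷ same ⟨ 3 , 1 , 4 ⟩ ⟨ 3 , 1 , 2 ⟩ ∷ same ⟨ 0 , 1 , 4 ⟩ ⟨ 0 , 1 , 3 ⟩ ∷ cross 3 4 5 6 ∷ opp ⟨ 3 , 1 , 5 ⟩ ⟨ 3 , 1 , 2 ⟩ ∷ []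

  inside-corner₂-cert : Cert
  inside-corner₂-cert =
    O 0 & O 40 & O 50 & O 80 & osplit 1 (O 1 & I 1023 ∎) (O 1 & O 60 & S 13024 & K 31024 & split 345 (O 70 & osplit 71
    (O 71 & I 4356 ∎) (O 71 & K 35416 & F 31 56 & K 63145 & S 13406 & K 46013 & K 61045 & F 22 56 & K 10536 ∎)) (O 70 &
    I 3145 & S 32415 & K 45213 & osplit 71 (O 71 & S 35246 & K 53246 & F 11 56 ∎) (O 71 & I 3456 ∎)))

  inside-corner₃-forms : List Form
  inside-corner₃-forms = cross 2 3 0 1 ∷ miss 1 2 3 ∷ miss 1 0 1 ∷ miss 1 3 1 ∷ same ⟨ 2 , 3 , 4 ⟩ ⟨ 2 , 3 , 1 ⟩ ∷ same ⟨ 3 , 1 , 4 ⟩ ⟨ 3 , 1 , 2 ⟩ ∷ same ⟨ 0 , 1 , 4 ⟩ ⟨ 0 , 1 , 3 ⟩ ∷ cross 3 4 5 6 ∷ opp ⟨ 0 , 1 , 5 ⟩ ⟨ 0 , 1 , 3 ⟩ ∷ []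

  inside-corner₃-cert : Cert
  inside-corner₃-cert =
    O 1 & O 60 & O 80 & osplit 0 (O 0 & I 1023 ∎) (O 0 & O 40 & O 50 & S 31204 & split 145 (I 145 & K 13045 & S 45103 &
    O 70 & osplit 71 (O 71 & S 35146 & K 53146 & F 32 56 ∎) (O 71 & I 3456 ∎)) (split 345 (O 70 & I 1345 & osplit 71 (O
    71 & I 4356 ∎) (O 71 & K 46315 & S 53416 & F 31 56 & S 15046 & F 21 56 & K 51036 & S 31426 & K 2315 & S 31205 & S
    53026 & F 12 56 ∎)) (O 70 & K 45103 & I 3045 & osplit 71 (O 71 & S 46035 & K 53046 & K 45316 & I 146 & F 21 56 & S
    50316 & F 32 56 & S 35146 ∎) (O 71 & I 3456 ∎))))

  inside-chord₁-forms : List Form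
  inside-chord₁-forms = cross 2 3 0 1 ∷ miss 1 2 3 ∷ miss 1 0 1 ∷ miss 1 3 1 ∷ same ⟨ 2 , 3 , 5 ⟩ ⟨ 2 , 3 , 1 ⟩ ∷ same ⟨ 3 , 1 , 5 ⟩ ⟨ 3 , 1 , 2 ⟩ ∷ same ⟨ 0 , 1 , 5 ⟩ ⟨ 0 , 1 , 3 ⟩ ∷ same ⟨ 2 , 3 , 4 ⟩ ⟨ 2 , 3 , 1 ⟩ ∷ same ⟨ 3 , 1 , 4 ⟩ ⟨ 3 , 1 , 2 ⟩ ∷ same ⟨ 0 , 1 , 4 ⟩ ⟨ 0 , 1 , 3 ⟩ ∷ cross 4 5 6 7 ∷ opp ⟨ 2 , 3 , 6 ⟩ ⟨ 2 , 3 , 1 ⟩ ∷ []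

  inside-chord₁-cert : Cert
  inside-chord₁-cert =
    O 1 & O 60 & O 90 & osplit 0 (O 0 & I 1023 ∎) (O 0 & O 40 & O 50 & O 70 & O 80 & O 110 & K 13204 & K 21034 & S
    31204 & K 13205 & split 126 (K 21346 & K 21356 & osplit 101 (O 101 & osplit 100 (O 100 & I 5467 ∎) (O 100 & S 65427 &
    split 237 (F 12 67 & K 62357 & S 31526 & K 56123 & K 62157 & F 32 67 & K 32157 & S 74536 & S 36147 & S 34267 ∎) (S
    26347 & S 26357 & S 74526 ∎))) (O 101 & osplit 100 (O 100 & S 64527 & split 237 (F 12 67 & K 62347 & S 31426 & K
    46123 & K 62147 & F 32 67 & K 32157 & S 36147 & S 75436 ∎) (S 26347 & S 26357 & S 75426 ∎)) (O 100 & I 4567 ∎))) (I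
    2136 & S 20316 & S 31426 & S 31526 & split 156 (I 2156 & S 56123 ∎) (K 15206 & osplit 100 (O 100 & osplit 101 (O
    101 & I 5467 ∎) (O 101 & K 65347 & split 246 (K 43206 & S 46123 & K 61045 & K 65047 & split 256 (K 65247 & S 62517 &
    F 21 67 & F 31 67 & K 13047 & K 13057 & S 75416 ∎) (I 2456 & K 25346 ∎)) (split 267 (F 12 67 & S 26347 & S 75426 &
    S 26357 & K 46527 & K 24356 ∎) (S 64527 & S 62517 & K 24356 & S 56247 & F 31 67 & K 46527 & K 25347 & S 23517 & K
    21047 & I 2067 & F 21 67 & K 13047 & K 13057 & S 75416 ∎)))) (O 100 & osplit 101 (O 101 & K 64357 & split 246 (K
    43206 & S 46123 & S 65417 & F 31 67 & split 267 (F 12 67 & K 64257 & S 26357 & K 25346 & K 56427 ∎) (K 64027 & F 21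
    67 & K 13047 & K 13057 & S 74516 ∎)) (split 256 (I 4256 & K 24356 ∎) (S 65427 & F 12 67 & S 26347 & S 26357 & S
    74526 ∎))) (O 101 & I 4567 ∎)))))

  inside-chord₂-forms : List Form
  inside-chord₂-forms = cross 2 3 0 1 ∷ miss 1 2 3 ∷ miss 1 0 1 ∷ miss 1 3 1 ∷ same ⟨ 2 , 3 , 5 ⟩ ⟨ 2 , 3 , 1 ⟩ ∷ same ⟨ 3 , 1 , 5 ⟩ ⟨ 3 , 1 , 2 ⟩ ∷ same ⟨ 0 , 1 , 5 ⟩ ⟨ 0 , 1 , 3 ⟩ ∷ same ⟨ 2 , 3 , 4 ⟩ ⟨ 2 , 3 , 1 ⟩ ∷ same ⟨ 3 , 1 , 4 ⟩ ⟨ 3 , 1 , 2 ⟩ ∷ same ⟨ 0 , 1 , 4 ⟩ ⟨ 0 , 1 , 3 ⟩ ∷ cross 4 5 6 7 ∷ opp ⟨ 3 , 1 , 6 ⟩ ⟨ 3 , 1 , 2 ⟩ ∷ []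

  inside-chord₂-cert : Cert
  inside-chord₂-cert =
    O 100 & osplit 101 (O 101 & I 5467 ∎) (O 101 & osplit 0 (O 0 & O 40 & O 50 & O 70 & O 80 & O 110 & osplit 1 (O 1 &
    I 1023 ∎) (O 1 & O 60 & O 90 & S 13024 & K 31024 & K 31025 & split 146 (K 10346 & I 1036 & K 3146 & K 3156 & S
    30416 & S 30516 & S 64507 & K 65347 & S 63147 & F 22 67 & S 6147 & S 6157 & S 75406 ∎) (split 167 (split 137 (F 31
    67 & K 61347 & S 32416 & K 46213 & K 63247 & F 11 67 & K 31247 & K 31257 & S 75436 ∎) (S 16347 & K 46517 & S 75416 &
    K 14357 ∎)) (S 64517 & K 10356 & I 1036 & K 3146 & K 3156 & S 64507 & F 22 67 & S 6147 & S 6157 & S 75406 ∎)))) (O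
    0 & O 40 & O 50 & O 70 & O 80 & O 110 & osplit 1 (O 1 & O 60 & O 90 & S 31204 & K 13205 & S 31205 & S 3124 & S
    42103 & split 16 (I 136 & S 12036 & S 3416 & S 3516 & K 30156 & I 2136 & S 23416 & K 65047 & K 32146 & S 64537 & K
    63247 & split 167 (F 21 67 & S 62147 & S 16047 & K 46517 & K 14057 & S 75416 ∎) (F 32 67 & S 36147 & S 36157 & S
    75436 ∎)) (S 10436 & S 10536 & K 65147 & split 137 (K 16437 & K 16537 & K 74156 ∎) (F 32 67 & S 61537 & K 32156 & S
    56123 & S 63527 & F 12 67 & I 2136 & S 26317 & S 26357 & S 75426 & K 21347 ∎))) (O 1 & I 123 ∎)))

  inside-chord₃-forms : List Form
  inside-chord₃-forms = cross 2 3 0 1 ∷ miss 1 2 3 ∷ miss 1 0 1 ∷ miss 1 3 1 ∷ same ⟨ 2 , 3 , 5 ⟩ ⟨ 2 , 3 , 1 ⟩ ∷ same ⟨ 3 , 1 , 5 ⟩ ⟨ 3 , 1 , 2 ⟩ ∷ same ⟨ 0 , 1 , 5 ⟩ ⟨ 0 , 1 , 3 ⟩ ∷ same ⟨ 2 , 3 , 4 ⟩ ⟨ 2 , 3 , 1 ⟩ ∷ same ⟨ 3 , 1 , 4 ⟩ ⟨ 3 , 1 , 2 ⟩ ∷ same ⟨ 0 , 1 , 4 ⟩ ⟨ 0 , 1 , 3 ⟩ ∷ cross 4 5 6 7 ∷ opp ⟨ 0 , 1 , 6 ⟩ ⟨ 0 , 1 , 3 ⟩ ∷ []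

  inside-chord₃-cert : Cert
  inside-chord₃-cert =
    O 101 & osplit 100 (O 100 & I 5467 ∎) (O 100 & osplit 0 (O 0 & O 40 & O 50 & O 70 & O 80 & osplit 1 (O 1 & I 1023
    ∎) (O 1 & O 60 & O 90 & O 110 & K 31024 & K 31025 & split 136 (S 13406 & S 13506 & K 64157 & split 36 (K 31026 & K
    31246 & split 356 (I 356 & S 56013 ∎) (S 65437 & F 32 67 & split 237 (K 31247 & S 36257 & S 74536 ∎) (F 11 67 & K
    31027 & split 17 (F 22 67 & K 3217 & S 13027 & K 71026 ∎) (S 13407 & S 13507 & K 75146 ∎)))) (K 3146 & K 3156 & S
    65407 & F 22 67 & K 16407 & K 16507 & K 75146 ∎)) (I 1036 & S 30416 & S 30516 & K 3146 & K 3156 & K 64357 & S 65407 &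
    split 137 (F 31 67 & F 22 67 & S 13407 & S 13507 & K 75146 ∎) (K 36417 & K 36517 & K 75346 ∎)))) (O 0 & O 40 & O 50 &
    O 70 & O 80 & osplit 1 (O 1 & O 60 & O 90 & O 110 & S 31204 & K 13205 & S 31205 & K 21035 & split 136 (I 136 & S
    12036 & K 30126 & K 30146 & K 30156 & S 3416 & S 3516 & S 23516 & S 65437 & K 63057 & K 63257 & F 11 67 & S 36207 &
    split 17 (K 6417 & K 6517 & K 75046 ∎) (F 21 67 & F 32 67 & K 30147 & K 32157 & S 74536 ∎)) (K 13046 & K 13056 & S
    65417 & split 17 (S 16047 & S 16057 & K 47516 & K 56417 ∎) (F 21 67 & K 61057 & S 51206 & S 3516 & K 56123 & K 2316 &
    S 31206 & S 31426 & K 64357 & S 63027 & F 12 67 & K 36427 & K 36527 & K 75346 ∎))) (O 1 & I 123 ∎)))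

  lower-side-forms : List Form
  lower-side-forms = cross 2 3 0 1 ∷ same ⟨ 2 , 3 , 4 ⟩ ⟨ 2 , 3 , 0 ⟩ ∷ same ⟨ 0 , 2 , 4 ⟩ ⟨ 0 , 2 , 1 ⟩ ∷ cross 2 4 5 6 ∷ cross 2 1 7 8 ∷ miss 1 2 3 ∷ miss 1 0 2 ∷ nbeh 1 2 3 ∷ []

  lower-side-cert : Cert
  lower-side-cert =
    O 0 & O 10 & osplit 1 (O 1 & I 1023 ∎) (O 20 & eq? 14 (E 1423 ∎) (K 20134 & split 128 (O 40 & osplit 41 (O 41 & I
    1278 ∎) (split 237 (K 27138 & F 51 78 & F 71 78 ∎) (S 21347 & split 245 (O 30 & osplit 31 (O 31 & I 4256 ∎) (split
    236 (eq? 67 (E 6723 ∎) (K 24367 & F 51 67 & F 71 67 ∎)) (S 26345 & F 51 56 & F 71 56 ∎))) (O 30 & osplit 31 (split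
    235 (eq? 57 (E 5723 ∎) (K 24357 & F 51 57 & F 71 57 ∎)) (S 25346 & F 52 56 & F 70 56 ∎)) (O 31 & I 2456 ∎))))) (O
    40 & osplit 41 (split 238 (K 28137 & F 52 78 & F 70 78 ∎) (S 21348 & split 245 (O 30 & osplit 31 (O 31 & I 4256 ∎)
    (split 236 (eq? 68 (E 6823 ∎) (K 24368 & F 51 68 & F 71 68 ∎)) (S 26345 & F 51 56 & F 71 56 ∎))) (O 30 & osplit 31
    (split 235 (K 24135 & eq? 58 (E 5823 ∎) (S 21358 & F 51 58 & F 71 58 ∎)) (S 25346 & F 52 56 & F 70 56 ∎)) (O 31 & I
    2456 ∎)))) (O 41 & I 2178 ∎))))

  lower-inside-forms : List Form
  lower-inside-forms = cross 2 4 0 1 ∷ cross 2 4 3 5 ∷ cross 2 3 0 1 ∷ ncross 3 5 0 1 ∷ same ⟨ 2 , 4 , 5 ⟩ ⟨ 2 , 4 , 0 ⟩ ∷ opp ⟨ 0 , 2 , 5 ⟩ ⟨ 0 , 2 , 1 ⟩ ∷ ntri 2 3 5 0 ∷ []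

  lower-inside-cert : Cert
  lower-inside-cert =
    O 0 & O 40 & O 10 & osplit 1 (O 1 & I 1024 ∎) (O 21 & O 50 & osplit 11 (K 25034 & O 20 & F 60 0 & eq? 15 (E 1524 ∎)
    (K 3215 & F 32 0 & S 30215 ∎)) (O 11 & I 3245 ∎))

  lower-blocked-forms : List Form
  lower-blocked-forms = tri 1 2 4 0 ∷ cross 1 3 2 4 ∷ cross 0 2 5 6 ∷ cross 3 4 7 8 ∷ miss 1 2 4 ∷ miss 1 1 3 ∷ []

  lower-blocked-cert : Cert
  lower-blocked-cert =
    O 30 & osplit 31 (O 31 & I 4378 ∎) (O 31 & eq? 14 (E 1437 & E 1438 & F 52 78 & E 1478 ∎) (eq? 23 (E 2347 & E 2348 &
    E 2378 & F 41 78 ∎) (osplit 0 (O 0 & O 1 & I 1024 & O 11 & osplit 10 (O 10 & I 1234 ∎) (O 10 & split 247 (S 47238 &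
    F 41 78 & S 84327 & K 74238 & S 23418 & K 32418 & K 83127 & S 34127 & F 52 78 ∎) (K 43127 & split 137 (S 34127 & S
    23417 & eq? 3 (E 324 ∎) (K 21034 & S 41023 & S 23407 & K 43027 & eq? 67 (E 6724 & E 6702 & O 20 & osplit 21 (O 21 &
    S 26405 & E 6725 & F 41 56 & F 41 57 & S 52046 & S 40527 ∎) (O 21 & I 256 ∎)) (eq? 57 (E 5734 & E 5724 & E 5723 & S
    23405 & K 43025 & O 20 & osplit 21 (O 21 & I 2056 ∎) (O 21 & S 25406 & K 52406 & F 42 56 ∎)) (split 25 (O 20 &
    osplit 21 (O 21 & I 2056 ∎) (O 21 & split 245 (S 24015 & K 20345 & K 21457 & F 41 57 & S 40527 & S 41527 & K 43527 &
    K 5124 & S 2345 & K 5246 & S 50246 & K 46035 & S 50436 & I 3145 & K 52106 & F 51 56 & S 34126 & S 23456 & K 42106 &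
    S 41627 & K 14236 & F 41 67 & K 21467 ∎) (S 25406 & F 42 56 & S 62045 & K 52406 & K 42106 & K 5124 & S 41025 & S
    2345 & K 43025 & S 50436 & S 41627 & I 1025 & K 52106 & I 3145 & F 51 56 & F 41 67 & K 14236 & K 21467 ∎))) (O 20 &
    osplit 21 (O 21 & split 246 (S 24016 & K 21467 & F 41 67 & S 41627 & K 42106 & K 6245 & S 5124 & K 4235 & I 145 &
    split 245 (S 40527 & F 41 57 & S 74125 & K 75234 & K 21457 & S 23457 & F 52 57 & I 2135 ∎) (K 21405 & S 23405 & I
    2135 & S 52016 & K 50326 & F 52 56 & S 15346 ∎)) (S 26405 & F 41 56 & S 52046 & S 40527 & S 5124 & F 41 57 & S
    74125 & K 75234 & I 145 & K 21457 & F 52 57 & K 14235 ∎)) (O 21 & I 256 ∎)))))) (K 37418 & S 73418 & F 52 78 ∎))))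
    (O 0 & O 1 & I 124 & O 11 & osplit 10 (O 10 & split 248 (S 43218 & split 138 (S 38147 & K 83147 & F 52 78 ∎) (S
    14328 & K 34218 & eq? 3 (E 324 ∎) (S 21304 & K 41203 & K 23048 & S 43208 & eq? 58 (E 5824 & E 5823 & K 23045 & E
    5804 & O 20 & osplit 21 (O 21 & K 25046 & S 52046 & F 41 56 ∎) (O 21 & I 256 ∎)) (eq? 68 (E 6824 & E 6802 & E 6804 &
    O 20 & osplit 21 (O 21 & I 2056 ∎) (O 21 & K 26045 & S 62045 & F 42 56 ∎)) (split 25 (O 20 & osplit 21 (O 21 & I
    2056 ∎) (O 21 & split 45 (K 5214 & S 4325 & split 245 (S 21045 & K 23045 & K 26045 & S 24358 & I 1235 & K 52106 & K
    26035 & S 50236 & K 26508 & F 51 56 & S 32146 & F 42 68 & S 43268 ∎) (K 40258 & F 42 58 & S 85324 & S 21508 & K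
    23508 & I 1235 & K 53128 & F 51 58 ∎)) (I 245 & S 6425 & K 52406 & F 42 56 & K 40268 & F 42 68 & K 68204 & K 26508 &
    S 6258 & F 42 58 & S 82045 ∎))) (O 20 & osplit 21 (O 21 & split 245 (K 25046 & F 41 56 & S 52046 & S 5214 & K 41205 &
    S 5426 & I 1245 & K 12435 & S 43215 & K 40326 & K 40268 & S 52016 & I 4356 & F 42 68 & F 52 56 & K 23608 & K 34216
    ∎) (K 24105 & S 20435 & S 20548 & F 42 58 & K 40258 & S 43258 & S 5214 & S 5426 & K 50426 & S 46305 & I 4356 & S
    32145 & S 52016 & F 52 56 & K 34216 & K 23608 & K 23546 & F 42 68 & K 40268 ∎)) (O 21 & I 256 ∎))))))) (K 48327 & F
    41 78 & K 74238 & S 84327 & K 23147 & K 34218 & S 38147 & F 52 78 & S 73218 ∎)) (O 10 & I 2134 ∎)))))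

  straddling-forms : List Form
  straddling-forms = opp ⟨ 0 , 1 , 3 ⟩ ⟨ 0 , 1 , 2 ⟩ ∷ cross 0 2 4 5 ∷ cross 1 3 6 7 ∷ miss 1 0 1 ∷ nbeh 1 0 1 ∷ nbeh 1 1 0 ∷ []

  straddling-cert : Cert
  straddling-cert =
    O 10 & osplit 11 (O 11 & I 2045 ∎) (osplit 21 (O 21 & osplit 20 (O 20 & I 3167 ∎) (O 20 & osplit 0 (O 0 & split 17
    (split 15 (F 51 45 & K 4215 ∎) (eq? 57 (E 5701 ∎) (F 40 57 & F 51 57 & F 32 57 ∎))) (K 17306 & F 31 67 & F 50 67
    ∎)) (O 0 & split 16 (S 16037 & F 31 67 & F 50 67 ∎) (F 40 67 & split 14 (eq? 47 (E 4701 ∎) (F 41 47 & F 50 47 & F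
    31 47 ∎)) (F 51 45 & S 5124 ∎))))) (O 21 & osplit 20 (O 20 & osplit 0 (O 0 & split 16 (F 41 67 & split 15 (F 51 45 &
    K 4215 ∎) (eq? 57 (E 5701 ∎) (F 40 57 & F 51 57 & F 32 57 ∎))) (K 16307 & F 32 67 & F 51 67 ∎)) (O 0 & split 17 (S
    17036 & F 32 67 & F 51 67 ∎) (split 14 (eq? 47 (E 4701 ∎) (F 41 47 & F 50 47 & F 31 47 ∎)) (F 51 45 & S 5124 ∎))))
    (O 20 & I 1367 ∎)))

  pocket₁-forms : List Form
  pocket₁-forms = same ⟨ 0 , 1 , 2 ⟩ ⟨ 0 , 2 , 3 ⟩ ∷ same ⟨ 0 , 2 , 3 ⟩ ⟨ 0 , 1 , 3 ⟩ ∷ cross 2 4 0 1 ∷ cross 3 5 0 2 ∷ ncross 2 4 3 5 ∷ opp ⟨ 2 , 4 , 0 ⟩ ⟨ 2 , 4 , 5 ⟩ ∷ opp ⟨ 5 , 2 , 4 ⟩ ⟨ 5 , 2 , 3 ⟩ ∷ []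

  pocket₁-cert : Cert
  pocket₁-cert =
    O 0 & O 21 & O 31 & osplit 20 (O 20 & I 1024 ∎) (O 50 & O 60 & O 30 & I 2035 ∎)

  pocket₂-forms : List Form
  pocket₂-forms = same ⟨ 0 , 1 , 2 ⟩ ⟨ 0 , 2 , 3 ⟩ ∷ same ⟨ 0 , 2 , 3 ⟩ ⟨ 0 , 1 , 3 ⟩ ∷ cross 2 4 0 1 ∷ cross 3 5 0 2 ∷ ncross 2 4 3 5 ∷ opp ⟨ 2 , 4 , 0 ⟩ ⟨ 2 , 4 , 5 ⟩ ∷ opp ⟨ 3 , 5 , 4 ⟩ ⟨ 3 , 5 , 2 ⟩ ∷ []

  pocket₂-cert : Cert
  pocket₂-cert =
    O 0 & O 21 & O 31 & osplit 30 (O 30 & I 2035 ∎) (O 30 & O 60 & osplit 20 (O 20 & I 1024 ∎) (O 50 & K 25304 & F 42 0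
    ∎))

  pocket₃-forms : List Form
  pocket₃-forms = same ⟨ 0 , 1 , 2 ⟩ ⟨ 0 , 2 , 3 ⟩ ∷ same ⟨ 0 , 2 , 3 ⟩ ⟨ 0 , 1 , 3 ⟩ ∷ cross 2 4 0 1 ∷ cross 3 5 0 2 ∷ ncross 2 4 3 5 ∷ opp ⟨ 2 , 4 , 0 ⟩ ⟨ 2 , 4 , 5 ⟩ ∷ opp ⟨ 0 , 2 , 4 ⟩ ⟨ 0 , 2 , 5 ⟩ ∷ []

  pocket₃-cert : Cert
  pocket₃-cert =
    O 0 & O 21 & O 31 & O 60 & O 20 & I 1024 ∎

  fan-forms : List Form
  fan-forms = cross 2 3 0 1 ∷ cross 5 4 0 2 ∷ same ⟨ 0 , 1 , 2 ⟩ ⟨ 0 , 2 , 5 ⟩ ∷ same ⟨ 0 , 2 , 5 ⟩ ⟨ 0 , 1 , 5 ⟩ ∷ same ⟨ 2 , 3 , 0 ⟩ ⟨ 2 , 3 , 4 ⟩ ∷ same ⟨ 2 , 4 , 3 ⟩ ⟨ 2 , 4 , 0 ⟩ ∷ []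

  fan-cert : Cert
  fan-cert =
    O 0 & O 40 & O 50 & O 11 & O 20 & O 1 & I 1023 ∎

  interleaving-forms : List Form
  interleaving-forms = same ⟨ 0 , 1 , 2 ⟩ ⟨ 0 , 2 , 3 ⟩ ∷ same ⟨ 0 , 1 , 2 ⟩ ⟨ 0 , 1 , 3 ⟩ ∷ same ⟨ 0 , 1 , 2 ⟩ ⟨ 0 , 1 , 4 ⟩ ∷ same ⟨ 0 , 1 , 2 ⟩ ⟨ 0 , 4 , 2 ⟩ ∷ same ⟨ 0 , 1 , 2 ⟩ ⟨ 0 , 2 , 5 ⟩ ∷ same ⟨ 0 , 1 , 2 ⟩ ⟨ 0 , 5 , 3 ⟩ ∷ opp ⟨ 0 , 1 , 2 ⟩ ⟨ 0 , 4 , 5 ⟩ ∷ []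

  interleaving-cert : Cert
  interleaving-cert =
    O 0 & O 10 & O 20 & O 30 & O 40 & O 50 & O 60 & eq? 15 (E 1502 ∎) (K 3125 & S 1425 ∎)

-- Obstacles as seen from the vertices.

module Obstacles where

  open import Data.Nat using (ℕ; zero; suc; _≡ᵇ_)
  open import Data.Bool using (false)
  open import Data.Product using (Σ; ∃-syntax; _×_; _,_)
  open import Data.Sum using (_⊎_; inj₁; inj₂)
  open import Data.List using (List; []; _∷_; map; _++_)
  open import Data.List.Relation.Unary.All using ([]; _∷_)
  open import Data.Empty using (⊥-elim)
  open import Data.Unit using (⊤; tt)
  open import Data.Fin using (Fin; zero; suc)
  open import Relation.Nullary using (¬_)
  open import Relation.Binary.PropositionalEquality using (_≡_; _≢_; refl; sym)
  open OrderTypes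
  open Certificates

  -- Of an obstacle only its corners are kept.  There are always three obstacles, but some may have no corners.
  record Scene (V : Set) : Set₁ where
    field
      Corner : Fin 3 → Set
    Place : Set
    Place = V ⊎ Σ (Fin 3) Corner
    field
      order : OrderType Place
    open OrderType order public
    field
      apart-× : ∀ {P Q} → P ≢ Q → ∀ (s s' : Corner P) (t t' : Corner Q) →
                ¬ Cross (inj₂ (P , s)) (inj₂ (P , s')) (inj₂ (Q , t)) (inj₂ (Q , t'))
      apart-∈ : ∀ {P Q} → P ≢ Q → ∀ (s s' s'' : Corner P) (t : Corner Q) →
                ¬ InTri (inj₂ (P , s)) (inj₂ (P , s')) (inj₂ (P , s'')) (inj₂ (Q , t))
      outside : ∀ P (s s' s'' : Corner P) v → ¬ InTri (inj₂ (P , s)) (inj₂ (P , s')) (inj₂ (P , s'')) (inj₁ v)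

  data Entry (V A B : Set) : Set where
    vertex : V → Entry V A B
    first  : A → Entry V A B
    second : B → Entry V A B

  -- Numbers past the end denote `v`, which makes the assignment of points total.
  nthEntry : ∀ {V A B : Set} → V → List (Entry V A B) → ℕ → Entry V A B
  nthEntry v [] _ = vertex v
  nthEntry v (e ∷ _) zero = e
  nthEntry v (_ ∷ es) (suc n) = nthEntry v es n

  module Visibility {V : Set} (S : Scene V) where
    open Scene S

    vx : V → Place
    vx = inj₁

    ob : ∀ P → Corner P → Place
    ob P s = inj₂ (P , s)

    Blocks : Fin 3 → V → V → Set
    Blocks P u w = ∃[ s ] ∃[ t ] Cross (vx u) (vx w) (ob P s) (ob P t)

    Misses : Fin 3 → V → V → Set
    Misses P u w = ¬ Blocks P u w

    -- P meets the ray from u through w beyond w.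
    Behind : Fin 3 → V → V → Set
    Behind P u w = ∃[ s ] ∃[ t ] InTri (vx u) (ob P s) (ob P t) (vx w)

    Meet : V → V → V → V → Set
    Meet u w u' w' = Cross (vx u) (vx w) (vx u') (vx w')

    Opposed Alike : V → V → V → V → V → V → Set
    Opposed a b c a' b' c' = Opp (vx a) (vx b) (vx c) (vx a') (vx b') (vx c')
    Alike a b c a' b' c' = Opposed a b c b' a' c'

    module _ (P Q : Fin 3) (P≢Q : P ≢ Q) where
      place : Entry V (Corner P) (Corner Q) → Place
      place (vertex v) = vx v
      place (first s) = ob P s
      place (second s) = ob Q s

      kind : Entry V (Corner P) (Corner Q) → ℕ
      kind (vertex _) = 0
      kind (first _) = 1
      kind (second _) = 2

      Kind : ℕ → Place → Set
      Kind 1 p = ∃[ s ] p ≡ ob P s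
      Kind 2 p = ∃[ s ] p ≡ ob Q s
      Kind _ p = ⊤

      kind✓ : ∀ e → Kind (kind e) (place e)
      kind✓ (vertex _) = tt
      kind✓ (first s) = s , refl
      kind✓ (second s) = s , refl

      kinds-apart : ∀ e f → (kind e ≡ᵇ kind f) ≡ false → place e ≢ place f
      kinds-apart (vertex _) (first _) _ ()
      kinds-apart (vertex _) (second _) _ ()
      kinds-apart (first _) (vertex _) _ ()
      kinds-apart (first _) (second _) _ refl = P≢Q refl
      kinds-apart (second _) (vertex _) _ ()
      kinds-apart (second _) (first _) _ refl = P≢Q refl

      model₂ : V → List V → List (Corner P) → List (Corner Q) → Model
      model₂ v vs ss ts = record
        { order = order
        ; Group = Kind
        ; ρ = λ i → place (at i)
        ; tag = λ i → kind (at i)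
        ; inGroup = λ i → kind✓ (at i)
        ; apart = λ i j → kinds-apart (at i) (at j)
        } where
        at : ℕ → Entry V (Corner P) (Corner Q)
        at = nthEntry v (vertex v ∷ map vertex vs ++ map first ss ++ map second ts)

      disjoint : (∀ {s s' t t'} → Kind 1 s → Kind 1 s' → Kind 2 t → Kind 2 t' → ¬ Cross s s' t t')
               × (∀ {s s' s'' t} → Kind 1 s → Kind 1 s' → Kind 1 s'' → Kind 2 t → ¬ InTri s s' s'' t)
               × (∀ {s t t' t''} → Kind 2 t → Kind 2 t' → Kind 2 t'' → Kind 1 s → ¬ InTri t t' t'' s)
      disjoint = (λ { (s , refl) (s' , refl) (t , refl) (t' , refl) → apart-× P≢Q s s' t t' })
               , (λ { (s , refl) (s' , refl) (s'' , refl) (t , refl) → apart-∈ P≢Q s s' s'' t })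
               , (λ { (t , refl) (t' , refl) (t'' , refl) (s , refl) → apart-∈ (λ e → P≢Q (sym e)) t t' t'' s })

    another : Fin 3 → Fin 3
    another zero = suc zero
    another (suc _) = zero

    another≢ : ∀ P → P ≢ another P
    another≢ zero ()
    another≢ (suc zero) ()
    another≢ (suc (suc zero)) ()

    -- A configuration with a single obstacle: the second slot gets some other label and an empty
    -- list of corners.
    model : ∀ P → V → List V → List (Corner P) → Model
    model P v vs ss = model₂ P (another P) (another≢ P) v vs ss []

    missing : ∀ {P u w} → Misses P u w → ∀ {s t} → (∃[ s' ] s ≡ ob P s') → (∃[ t' ] t ≡ ob P t') → ¬ Cross (vx u) (vx w) s t
    missing m (s , refl) (t , refl) x = m (s , t , x)

    avoiding : ∀ {P u w} → ¬ Behind P u w → ∀ {s t} → (∃[ s' ] s ≡ ob P s') → (∃[ t' ] t ≡ ob P t') → ¬ InTri (vx u) s t (vx w)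
    avoiding n (s , refl) (t , refl) x = n (s , t , x)

    excluding : ∀ P v {s t r} → (∃[ s' ] s ≡ ob P s') → (∃[ t' ] t ≡ ob P t') → (∃[ r' ] r ≡ ob P r') → ¬ InTri s t r (vx v)
    excluding P v (s , refl) (t , refl) (r , refl) = outside P s t r v

    -- A chord from `ps` to `sq` stays in the triangle `psq`, where the part of `rs` from `s` to the
    -- crossing separates these two sides.
    sides-adjacent : ∀ {P p q r s} → Meet p q r s → Misses P p q → Misses P r s → Blocks P p s → ¬ Blocks P s q
    sides-adjacent {P} {p} {q} {r} {s} x m m' (a , b , y) (c , d , z) =
      refute (model P p (q ∷ r ∷ s ∷ []) (a ∷ b ∷ c ∷ d ∷ [])) sides-adjacent-forms
        (x ∷ y ∷ z ∷ missing m ∷ missing m' ∷ []) 20 sides-adjacent-cert refl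

    -- A chord from `ps` to `qr` stays in the convex quadrilateral `psqr` and has to cross its
    -- diagonals, which are the two edges.
    sides-opposite : ∀ {P p q r s} → Meet p q r s → Misses P p q → Misses P r s → Blocks P p s → ¬ Blocks P q r
    sides-opposite {P} {p} {q} {r} {s} x m m' (a , b , y) (c , d , z) =
      refute (model P p (q ∷ r ∷ s ∷ []) (a ∷ b ∷ c ∷ d ∷ [])) sides-opposite-forms
        (x ∷ y ∷ z ∷ missing m ∷ missing m' ∷ []) 1 sides-opposite-cert refl

    -- A chord from `ps` to a point of the ray beyond `q` would cross `rs` between `s` and the
    -- crossing with `pq`.
    sector : ∀ {P p q r s} → Meet p q r s → Misses P p q → Misses P r s → Blocks P p s → ¬ Behind P p q
    sector {P} {p} {q} {r} {s} x m m' (a , b , y) (c , d , z) =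
      refute (model P p (q ∷ r ∷ s ∷ []) (a ∷ b ∷ c ∷ d ∷ [])) sector-forms
        (x ∷ y ∷ z ∷ missing m ∷ missing m' ∷ []) 11 sector-cert refl

    -- The ray from `v` through `y` lies between the other two, so a chord from `xy` to `yz` meets
    -- it; as `P` misses `vy`, it does so beyond `y`.
    behind-middle : ∀ {P v x y z} → Alike v x y v y z → Alike v x y v x z →
      Misses P v x → Misses P v y → Misses P v z → Blocks P x y → Blocks P y z → ¬ ¬ Behind P v y
    behind-middle {P} {v} {x} {y} {z} o o' mx my mz (a , b , h) (c , d , k) n =
      refute (model P v (x ∷ y ∷ z ∷ []) (a ∷ b ∷ c ∷ d ∷ [])) behind-middle-forms
        (o ∷ o' ∷ h ∷ k ∷ missing my ∷ missing mx ∷ missing mz ∷ excluding P v ∷ excluding P y ∷ avoiding n ∷ []) 0 behind-middle-cert refl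

    -- A chord from a point beyond `x` on the ray to a point of `vy` would cross `xy`.
    behind-shields : ∀ {P v x y} → Misses P v x → Misses P x y → Behind P v x → ¬ Blocks P v y
    behind-shields {P} {v} {x} {y} m m' (a , b , h) (c , d , k) =
      refute (model P v (x ∷ y ∷ []) (a ∷ b ∷ c ∷ d ∷ [])) behind-shields-forms
        (h ∷ k ∷ missing m ∷ missing m' ∷ []) 10 behind-shields-cert refl

    -- The edge from y to z cannot pass between x and the obstacle behind it.
    between : ∀ {P v x y z} → Opposed v x y v y z → Opposed v x y v x z → Blocks P x y → Behind P v y →
      ¬ Meet y z v x → Misses P v x → Misses P v y → ¬ Misses P y z
    between {P} {v} {x} {y} {z} o o' (a , b , h) (c , d , k) n m m' m'' =
      refute (model P v (x ∷ y ∷ z ∷ []) (a ∷ b ∷ c ∷ d ∷ [])) between-forms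
        (o ∷ o' ∷ h ∷ k ∷ n ∷ missing m ∷ missing m' ∷ missing m'' ∷ []) 0 between-cert refl

    -- Seen from o, a corner of A lies before a chord of B, or a corner of B beyond a chord of A.  For disjoint
    -- obstacles either means that A is nearer on every ray from o that meets both.
    Before Beyond : V → Fin 3 → Fin 3 → Set
    Before o A B = ∃[ s ] ∃[ t ] ∃[ t' ] InTri (vx o) (ob B t) (ob B t') (ob A s)
    Beyond o A B = ∃[ t ] ∃[ s ] ∃[ s' ] Cross (vx o) (ob B t) (ob A s) (ob A s')

    Nearer : V → Fin 3 → Fin 3 → Set
    Nearer o A B = Before o A B ⊎ Beyond o A B

    -- Among the four corners involved, take the two extreme in angle from `o`. Their chord meets
    -- both rays, and beyond `x` and `y` because `A` misses `ox` and `oy`.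
    common-chord : ∀ {A o x y} → Behind A o x → Behind A o y → Misses A o x → Misses A o y →
      ¬ ¬ (∃[ s ] ∃[ t ] (InTri (vx o) (ob A s) (ob A t) (vx x) × InTri (vx o) (ob A s) (ob A t) (vx y)))
    common-chord {A} {o} {x} {y} (a , b , h) (c , d , k) m m' n =
      refute (model A o (x ∷ y ∷ []) (a ∷ b ∷ c ∷ d ∷ [])) common-chord-forms
        (h ∷ k ∷ missing m ∷ missing m' ∷ excluding A o ∷ (λ { (s , refl) (t , refl) z → n (s , t , z) }) ∷ []) 0 common-chord-cert refl

    -- On the ray through `x` the chord of `A` comes first. Turning the ray, this persists until one
    -- chord ends, since they do not cross: an end of the chord of `A` gives `Before`, an end of the
    -- chord of `B` gives `Beyond`.
    nearer-blocks : ∀ {A B o x} → A ≢ B → Blocks A o x → Behind B o x → ¬ ¬ Nearer o A B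
    nearer-blocks {A} {B} {o} {x} A≢B (a , b , h) (c , d , k) n =
      refute (model₂ A B A≢B o (x ∷ []) (a ∷ b ∷ []) (c ∷ d ∷ [])) nearer-blocks-forms
        (h ∷ k ∷ disjoint A B A≢B
         ∷ (λ z → n (inj₁ (_ , _ , _ , z))) ∷ (λ z → n (inj₁ (_ , _ , _ , z)))
         ∷ (λ z → n (inj₂ (_ , _ , _ , z))) ∷ (λ z → n (inj₂ (_ , _ , _ , z))) ∷ []) 0 nearer-blocks-cert refl

    -- The segment `xy` lies in the triangle under the chord `st`, so `B` meets a ray before `A`
    -- does; then turn the ray as in `nearer-blocks`.
    nearer-chord : ∀ {A B o x y s t} → A ≢ B →
      InTri (vx o) (ob A s) (ob A t) (vx x) → InTri (vx o) (ob A s) (ob A t) (vx y) → Blocks B x y → ¬ ¬ Nearer o B A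
    nearer-chord {A} {B} {o} {x} {y} {s} {t} A≢B h k (c , d , l) n =
      refute (model₂ A B A≢B o (x ∷ y ∷ []) (s ∷ t ∷ []) (c ∷ d ∷ [])) nearer-chord-forms
        (h ∷ k ∷ l ∷ disjoint A B A≢B
         ∷ (λ z → n (inj₁ (_ , _ , _ , z))) ∷ (λ z → n (inj₁ (_ , _ , _ , z)))
         ∷ (λ z → n (inj₂ (_ , _ , _ , z))) ∷ (λ z → n (inj₂ (_ , _ , _ , z))) ∷ []) 21 nearer-chord-cert refl

    before-beyond : ∀ {o A B} → A ≢ B → Before o A B → ¬ Beyond o B A
    before-beyond {o} {A} {B} A≢B (a , d , e , h) (g , f , f' , k) =
      refute (model₂ A B A≢B o [] (a ∷ g ∷ []) (d ∷ e ∷ f ∷ f' ∷ [])) before-beyond-forms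
        (h ∷ k ∷ excluding A o ∷ excluding B o ∷ disjoint A B A≢B ∷ []) 0 before-beyond-cert refl

    -- The rays that meet both obstacles fill one angle at `o`; a change of order within it would
    -- force the obstacles to intersect.
    nearer-asym : ∀ {o A B} → A ≢ B → Nearer o A B → ¬ Nearer o B A
    nearer-asym {o} {A} {B} A≢B (inj₁ (a , d , e , h)) (inj₁ (f , g , g' , k)) =
      refute (model₂ A B A≢B o [] (a ∷ g ∷ g' ∷ []) (d ∷ e ∷ f ∷ [])) before-before-forms
        (h ∷ k ∷ excluding A o ∷ excluding B o ∷ disjoint A B A≢B ∷ []) 10 before-before-cert refl
    nearer-asym A≢B (inj₁ h) (inj₂ k) = before-beyond A≢B h k
    nearer-asym A≢B (inj₂ h) (inj₁ k) = before-beyond (λ e → A≢B (sym e)) k h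
    nearer-asym {o} {A} {B} A≢B (inj₂ (d , a , b , h)) (inj₂ (g , f , f' , k)) =
      refute (model₂ A B A≢B o [] (a ∷ b ∷ g ∷ []) (d ∷ f ∷ f' ∷ [])) beyond-beyond-forms
        (h ∷ k ∷ excluding A o ∷ excluding B o ∷ disjoint A B A≢B ∷ []) 0 beyond-beyond-cert refl

    -- A would be nearer than B on the ray through x, but farther between x₁ and x₂.
    rays-consistent : ∀ {A B o x x₁ x₂} → A ≢ B → Blocks A o x → Behind B o x → Blocks B x₁ x₂ →
      Behind A o x₁ → Behind A o x₂ → Misses A o x₁ → ¬ Misses A o x₂
    rays-consistent A≢B bA hB bB h₁ h₂ m₁ m₂ =
      common-chord h₁ h₂ m₁ m₂ λ { (s , t , i₁ , i₂) →
      nearer-chord A≢B i₁ i₂ bB λ near →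
      nearer-blocks A≢B bA hB λ near' → nearer-asym A≢B near' near }

    -- The direction of `x` lies between those of `y` and `z`, so a chord from `oy` to `oz` meets
    -- the ray through `x`, and not on `ox`.
    behind-blocked : ∀ {P o x y z} → Alike o y x o x z → Alike o y x o y z →
      Blocks P o y → Blocks P o z → Misses P o x → ¬ ¬ Behind P o x
    behind-blocked {P} {o} {x} {y} {z} a₁ a₂ (a , b , h) (c , d , k) m n =
      refute (model P o (x ∷ y ∷ z ∷ []) (a ∷ b ∷ c ∷ d ∷ [])) behind-blocked-forms
        (a₁ ∷ a₂ ∷ h ∷ k ∷ missing m ∷ excluding P o ∷ avoiding n ∷ []) 30 behind-blocked-cert refl

    behind-between : ∀ {P o x y z} → Alike o x y o y z → Alike o x y o x z → Behind P o x → Behind P o z →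
      Misses P o x → Misses P o y → Misses P o z → ¬ ¬ Behind P o y
    behind-between {P} {o} {x} {y} {z} a₁ a₂ (a , b , h) (c , d , k) mx my mz n =
      refute (model P o (x ∷ y ∷ z ∷ []) (a ∷ b ∷ c ∷ d ∷ [])) behind-between-forms
        (a₁ ∷ a₂ ∷ h ∷ k ∷ missing my ∷ excluding P o ∷ missing mx ∷ missing mz ∷ avoiding n ∷ []) 30 behind-between-cert refl

    -- A chord from `bx` to `ad` crosses the line `ab`, but not the segment; passing behind `a` is
    -- excluded, so it passes behind `b`.
    behind-straddling : ∀ {P a b x d} → Opposed a b x a b d → Blocks P b x → Blocks P a d → Misses P a b →
      ¬ Behind P b a → ¬ ¬ Behind P a b
    behind-straddling {P} {a} {b} {x} {d} o (p , q , h) (r , s , k) m n n' =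
      refute (model P a (b ∷ x ∷ d ∷ []) (p ∷ q ∷ r ∷ s ∷ [])) behind-straddling-forms
        (o ∷ h ∷ k ∷ missing m ∷ avoiding n' ∷ avoiding n ∷ []) 11 behind-straddling-cert refl

    -- From `a`, the direction of `d` lies between those of `b` and `v`. A chord from beyond `b` to
    -- a point of `vd` therefore meets the ray through `d`.
    behind-neighbour : ∀ {P a b d v} → Behind P a b → Blocks P v d → Opposed a d b a d v → Alike a b v a b d →
      Misses P a b → Misses P a d → Misses P v a → ¬ ¬ Behind P a d
    behind-neighbour {P} {a} {b} {d} {v} (p , q , h) (r , s , k) o o' m m' m'' n =
      refute (model P a (b ∷ d ∷ v ∷ []) (p ∷ q ∷ r ∷ s ∷ [])) behind-neighbour-forms
        (h ∷ k ∷ o ∷ o' ∷ missing m ∷ missing m' ∷ missing m''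
         ∷ excluding P a ∷ excluding P b ∷ excluding P d ∷ excluding P v ∷ avoiding n ∷ []) 20 behind-neighbour-cert refl

    -- From `y` the directions come in the order `b`, `a`, `x`, `c`. A chord from `yb` to `yx`
    -- crosses `ay` if it stays in the triangle `ybc`, and `bc` if it leaves it.
    upper-order : ∀ {P a b y c x} → Meet a y b c → Alike a y c a y x → Opposed y x c y x a →
      Blocks P y x → Blocks P y b → Misses P a y → Misses P b c → ¬ Misses P y c
    upper-order {P} {a} {b} {y} {c} {x} h o o' (p , q , k) (r , s , l) m m' m'' =
      refute (model P a (b ∷ y ∷ c ∷ x ∷ []) (p ∷ q ∷ r ∷ s ∷ [])) upper-order-forms
        (h ∷ o ∷ o' ∷ k ∷ l ∷ missing m ∷ missing m' ∷ missing m'' ∷ []) 1 upper-order-cert refl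

    -- Otherwise `bc` meets the line `vx` between the points where `vx` crosses `ab` and `ay`, or
    -- between `ay` and `x`; either way on the edge `vx`.
    upper-inside : ∀ {v x a b y c} → Meet a y v x → Meet a y b c → Meet a b v x → ¬ Meet b c v x →
      Alike a y c a y x → Alike y x c y x a → ¬ Opposed v x c v x y
    upper-inside {v} {x} {a} {b} {y} {c} h k l n o o' o'' =
      refute (model zero v (x ∷ a ∷ b ∷ y ∷ c ∷ []) []) upper-inside-forms
        (h ∷ k ∷ l ∷ n ∷ o ∷ o' ∷ o'' ∷ []) 1 upper-inside-cert refl

    -- The triangle cut off by crossing edges ay, vx and the segment yx.
    Inside : V → V → V → V → Place → Set
    Inside v x a y p = Opp (vx a) (vx y) p (vx y) (vx a) (vx x) × Opp (vx y) (vx x) p (vx x) (vx y) (vx a) × Opp (vx v) (vx x) p (vx x) (vx v) (vx y)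

    module _ {P v x a y} (h : Meet a y v x) (m : Misses P a y) (m' : Misses P v x) (m'' : Misses P y x) where
      -- The sides of the triangle lie on segments that `P` misses, so `P` stays inside with its
      -- corner `p`. The segment `vy` is on the other side of `ay`.
      trapped-vy : ∀ {p} → Inside v x a y (ob P p) → ¬ Blocks P v y
      trapped-vy {p} (o , o' , o'') (r , s , k) =
        refute (model P v (x ∷ a ∷ y ∷ []) (p ∷ r ∷ s ∷ [])) trapped-vy-forms
          (h ∷ missing m ∷ missing m' ∷ missing m'' ∷ o ∷ o' ∷ o'' ∷ k ∷ []) 70 trapped-vy-cert refl

      trapped-ax : ∀ {p} → Inside v x a y (ob P p) → ¬ Blocks P a x
      trapped-ax {p} (o , o' , o'') (r , s , k) =
        refute (model P v (x ∷ a ∷ y ∷ []) (p ∷ r ∷ s ∷ [])) trapped-ax-forms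
          (h ∷ missing m ∷ missing m' ∷ missing m'' ∷ o ∷ o' ∷ o'' ∷ k ∷ []) 0 trapped-ax-cert refl

      private
        turn : ∀ u w e {p} → u ≢ w → w ≢ e → u ≢ e → ¬ Opp (vx u) (vx w) (ob P p) (vx u) (vx w) (vx e) → Opp (vx u) (vx w) (ob P p) (vx w) (vx u) (vx e)
        turn u w e {p} uw we ue n with general {vx u} {vx w} {ob P p} (λ { refl → uw refl }) (λ ()) (λ ())
                                     | general {vx u} {vx w} {vx e} (λ { refl → uw refl }) (λ { refl → we refl }) (λ { refl → ue refl })
        ... | inj₁ s | inj₁ t = inj₁ (s , t)
        ... | inj₁ s | inj₂ t = ⊥-elim (n (inj₁ (s , t)))
        ... | inj₂ s | inj₁ t = ⊥-elim (n (inj₂ (s , t)))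
        ... | inj₂ s | inj₂ t = inj₂ (s , t)

      -- The chord `pq` meets the triangle on `yc` and cannot leave it through a side, so its end
      -- `p` is inside.
      inside-corner : ∀ {c p q} → a ≢ y → a ≢ x → y ≢ x → v ≢ x → v ≢ y → Inside v x a y (vx c) →
        Cross (vx y) (vx c) (ob P p) (ob P q) → Inside v x a y (ob P p)
      inside-corner {c} {p} {q} ay ax yx vx≢ vy (o , o' , o'') k =
          turn a y x ay yx ax (λ n → refute (M₁ c p q) inside-corner₁-forms (h ∷ missing m ∷ missing m' ∷ missing m'' ∷ o ∷ o' ∷ o'' ∷ k ∷ n ∷ []) 1 inside-corner₁-cert refl)
        , turn y x a yx (λ e → ax (sym e)) (λ e → ay (sym e)) (λ n → refute (M₁ c p q) inside-corner₂-forms (h ∷ missing m ∷ missing m' ∷ missing m'' ∷ o ∷ o' ∷ o'' ∷ k ∷ n ∷ []) 0 inside-corner₂-cert refl)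
        , turn v x y vx≢ (λ e → yx (sym e)) vy (λ n → refute (M₁ c p q) inside-corner₃-forms (h ∷ missing m ∷ missing m' ∷ missing m'' ∷ o ∷ o' ∷ o'' ∷ k ∷ n ∷ []) 1 inside-corner₃-cert refl)
        where
        M₁ : V → Corner P → Corner P → Model
        M₁ c p q = model P v (x ∷ a ∷ y ∷ c ∷ []) (p ∷ q ∷ [])

      inside-chord : ∀ {b c p q} → a ≢ y → a ≢ x → y ≢ x → v ≢ x → v ≢ y → Inside v x a y (vx b) → Inside v x a y (vx c) →
        Cross (vx b) (vx c) (ob P p) (ob P q) → Inside v x a y (ob P p)
      inside-chord {b} {c} {p} {q} ay ax yx vx≢ vy (l , l' , l'') (o , o' , o'') k =
          turn a y x ay yx ax (λ n → refute M₂ inside-chord₁-forms (h ∷ missing m ∷ missing m' ∷ missing m'' ∷ o ∷ o' ∷ o'' ∷ l ∷ l' ∷ l'' ∷ k ∷ n ∷ []) 1 inside-chord₁-cert refl)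
        , turn y x a yx (λ e → ax (sym e)) (λ e → ay (sym e)) (λ n → refute M₂ inside-chord₂-forms (h ∷ missing m ∷ missing m' ∷ missing m'' ∷ o ∷ o' ∷ o'' ∷ l ∷ l' ∷ l'' ∷ k ∷ n ∷ []) 100 inside-chord₂-cert refl)
        , turn v x y vx≢ (λ e → yx (sym e)) vy (λ n → refute M₂ inside-chord₃-forms (h ∷ missing m ∷ missing m' ∷ missing m'' ∷ o ∷ o' ∷ o'' ∷ l ∷ l' ∷ l'' ∷ k ∷ n ∷ []) 101 inside-chord₃-cert refl)
        where
        M₂ : Model
        M₂ = model P v (x ∷ a ∷ y ∷ b ∷ c ∷ []) (p ∷ q ∷ [])

    -- From `a`, the direction of `c` lies between those of `v` and `y`, and `x` is on the other
    -- side of `y`; a chord from `ac` to `ax` thus meets the ray through `y`.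
    lower-side : ∀ {P v x a y c} → Meet a y v x → Alike a y c a y v → Alike v a c v a x → Blocks P a c → Blocks P a x →
      Misses P a y → Misses P v a → ¬ ¬ Behind P a y
    lower-side {P} {v} {x} {a} {y} {c} h o o' (p , q , k) (r , s , l) m m' n =
      refute (model P v (x ∷ a ∷ y ∷ c ∷ []) (p ∷ q ∷ r ∷ s ∷ [])) lower-side-forms
        (h ∷ o ∷ o' ∷ k ∷ l ∷ missing m ∷ missing m' ∷ avoiding n ∷ []) 0 lower-side-cert refl

    -- From `a`, `v` lies between `b` and `c`. If it lay beyond `bc`, the edge `vx`, which reaches
    -- `ab`, would cross `bc` on the way.
    lower-inside : ∀ {v x a b y c} → Meet a y v x → Meet a y b c → Meet a b v x → ¬ Meet b c v x →
      Alike a y c a y v → Opposed v a c v a x → ¬ ¬ InTri (vx a) (vx b) (vx c) (vx v)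
    lower-inside {v} {x} {a} {b} {y} {c} h k l n o o' n' =
      refute (model zero v (x ∷ a ∷ b ∷ y ∷ c ∷ []) []) lower-inside-forms
        (h ∷ k ∷ l ∷ n ∷ o ∷ o' ∷ n' ∷ []) 0 lower-inside-cert refl

    -- The quadrilateral `abyc` is convex. A chord from `vb` to `yc` stays in it and has its ends on
    -- different sides of the diagonal `bc`.
    lower-blocked : ∀ {P v a b y c} → InTri (vx a) (vx b) (vx c) (vx v) → Meet a y b c → Blocks P v b → Blocks P y c →
      Misses P b c → ¬ Misses P a y
    lower-blocked {P} {v} {a} {b} {y} {c} i h (p , q , k) (r , s , l) m m' =
      refute (model P v (a ∷ b ∷ y ∷ c ∷ []) (p ∷ q ∷ r ∷ s ∷ [])) lower-blocked-forms
        (i ∷ h ∷ k ∷ l ∷ missing m ∷ missing m' ∷ []) 30 lower-blocked-cert refl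

    -- A chord from `ax` to `yc` crosses the line `ay` outside the segment; not beyond `y`, hence
    -- beyond `a`.
    straddling : ∀ {P a y x c} → Opposed a y c a y x → Blocks P a x → Blocks P y c → Misses P a y →
      ¬ Behind P a y → ¬ ¬ Behind P y a
    straddling {P} {a} {y} {x} {c} o (p , q , k) (r , s , l) m n n' =
      refute (model P a (y ∷ x ∷ c ∷ []) (p ∷ q ∷ r ∷ s ∷ [])) straddling-forms
        (o ∷ k ∷ l ∷ missing m ∷ avoiding n ∷ avoiding n' ∷ []) 10 straddling-cert refl

    module _ {v x a w b d} (o : Alike v x a v a w) (o' : Alike v a w v x w) (h : Meet a b v x) (k : Meet w d v a) where
      module _ (n : ¬ Meet a b w d) (l : Opposed a b v a b d) where
        -- Seen from `a`, `b` lies between `v` and `d`. So `ab` starts into the triangle formed by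
        -- `a`, `d` and the crossing of `wd` with `va`, and ends there since it does not cross `wd`.
        -- The three lemmas treat the sides of this triangle one by one.
        pocket₁ : ¬ Opposed d a b d a w
        pocket₁ e = refute (model zero v (x ∷ a ∷ w ∷ b ∷ d ∷ []) []) pocket₁-forms (o ∷ o' ∷ h ∷ k ∷ n ∷ l ∷ e ∷ []) 0 pocket₁-cert refl
        pocket₂ : ¬ Opposed w d b w d a
        pocket₂ e = refute (model zero v (x ∷ a ∷ w ∷ b ∷ d ∷ []) []) pocket₂-forms (o ∷ o' ∷ h ∷ k ∷ n ∷ l ∷ e ∷ []) 0 pocket₂-cert refl
        pocket₃ : ¬ Opposed v a b v a d
        pocket₃ e = refute (model zero v (x ∷ a ∷ w ∷ b ∷ d ∷ []) []) pocket₃-forms (o ∷ o' ∷ h ∷ k ∷ n ∷ l ∷ e ∷ []) 0 pocket₃-cert refl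

      -- Both crossings put `b` and `d` on the side of `va` where `x` is; with `d` on the side of
      -- `ab` where `v` is, the order around `a` is `v`, `d`, `b`.
      fan : Alike a b v a b d → ¬ Alike a d b a d v
      fan l e = refute (model zero v (x ∷ a ∷ b ∷ d ∷ w ∷ []) []) fan-forms (h ∷ k ∷ o ∷ o' ∷ l ∷ e ∷ []) 0 fan-cert refl

    -- Around `o`, `m` comes between `x` and `y`, and `n` between `y` and `z`.
    interleaving : ∀ {o x y z m n} → Alike o x y o y z → Alike o x y o x z → Alike o x y o x m → Alike o x y o m y →
      Alike o x y o y n → Alike o x y o n z → ¬ Opposed o x y o m n
    interleaving {o} {x} {y} {z} {m} {n} a₁ a₂ a₃ a₄ a₅ a₆ e =
      refute (model zero o (x ∷ y ∷ z ∷ m ∷ n ∷ []) []) interleaving-forms (a₁ ∷ a₂ ∷ a₃ ∷ a₄ ∷ a₅ ∷ a₆ ∷ e ∷ []) 0 interleaving-cert refl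

-- The contradiction in a homogeneous subtree.

module Homogeneity where

  open import Data.Nat using (zero; suc; _<ᵇ_)
  open import Data.Bool using (Bool; true; false; not; T; _∧_)
  open import Data.Product using (∃-syntax; _×_; _,_; proj₁; proj₂)
  open import Data.Sum using (_⊎_; inj₁; inj₂; swap)
  open import Data.Empty using (⊥; ⊥-elim)
  open import Data.Unit using (tt)
  open import Data.Fin using (Fin; zero; suc; toℕ)
  open import Data.Fin.Patterns using (0F; 1F; 2F; 3F; 4F)
  open import Data.Fin.Properties using (_≟_; all?)
  open import Relation.Nullary using (¬_; Dec; yes; no)
  open import Relation.Nullary.Decidable using (_⊎-dec_; from-yes)
  open import Relation.Binary.PropositionalEquality using (_≡_; _≢_; refl; sym; trans; subst)
  open OrderTypes
  open Obstacles

  three-labels : ∀ (p q r s : Fin 3) → p ≡ q ⊎ p ≡ r ⊎ p ≡ s ⊎ q ≡ r ⊎ q ≡ s ⊎ r ≡ s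
  three-labels = from-yes (all? {3} λ p → all? {3} λ q → all? {3} λ r → all? {3} λ s →
    (p ≟ q) ⊎-dec (p ≟ r) ⊎-dec (p ≟ s) ⊎-dec (q ≟ r) ⊎-dec (q ≟ s) ⊎-dec (r ≟ s))

  no-four : ∀ {p q r s : Fin 3} → p ≢ q → p ≢ r → p ≢ s → q ≢ r → q ≢ s → ¬ r ≢ s
  no-four {p} {q} {r} {s} pq pr ps qr qs rs with three-labels p q r s
  ... | inj₁ e = pq e
  ... | inj₂ (inj₁ e) = pr e
  ... | inj₂ (inj₂ (inj₁ e)) = ps e
  ... | inj₂ (inj₂ (inj₂ (inj₁ e))) = qr e
  ... | inj₂ (inj₂ (inj₂ (inj₂ (inj₁ e)))) = qs e
  ... | inj₂ (inj₂ (inj₂ (inj₂ (inj₂ e)))) = rs e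

  third : ∀ {p q r s : Fin 3} → p ≢ q → r ≢ p → r ≢ q → s ≢ p → s ≢ q → r ≡ s
  third {p} {q} {r} {s} pq rp rq sp sq with r ≟ s
  ... | yes e = e
  ... | no ne = ⊥-elim (no-four pq (λ e → rp (sym e)) (λ e → sp (sym e)) (λ e → rq (sym e)) (λ e → sq (sym e)) ne)

  _<₅_ : Fin 5 → Fin 5 → Set
  i <₅ j = T (toℕ i <ᵇ toℕ j)

  module Signs {V : Set} (S : Scene V) where
    open Scene S
    open Obstacles.Visibility S

    Turn : Bool → V → V → V → Set
    Turn true a b c = Pos (vx a) (vx b) (vx c)
    Turn false a b c = Pos (vx b) (vx a) (vx c)

    turns-alike : ∀ σ {a b c a' b' c'} → Turn σ a b c → Turn σ a' b' c' → Alike a b c a' b' c'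
    turns-alike true p q = inj₁ (p , q)
    turns-alike false p q = inj₂ (p , q)

    turns-opposed : ∀ σ {a b c a' b' c'} → Turn σ a b c → Turn (not σ) a' b' c' → Opposed a b c a' b' c'
    turns-opposed true p q = inj₁ (p , q)
    turns-opposed false p q = inj₂ (p , q)

    turn-back : ∀ σ {a b c} → Turn (not σ) a b c → Turn σ a c b
    turn-back true p = rotate p
    turn-back false p = rotate (rotate p)

    turn? : ∀ σ {a b c} → a ≢ b → b ≢ c → a ≢ c → Turn σ a b c ⊎ Turn (not σ) a b c
    turn? true ab bc ac = general (λ { refl → ab refl }) (λ { refl → bc refl }) (λ { refl → ac refl })
    turn? false ab bc ac = swap (general (λ { refl → ab refl }) (λ { refl → bc refl }) (λ { refl → ac refl }))

    alike? : ∀ {a b c a' b' c'} → a ≢ b → b ≢ c → a ≢ c → a' ≢ b' → b' ≢ c' → a' ≢ c' →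
             Alike a b c a' b' c' ⊎ Opposed a b c a' b' c'
    alike? ab bc ac ab' bc' ac' with turn? true ab bc ac | turn? true ab' bc' ac'
    ... | inj₁ p | inj₁ q = inj₁ (inj₁ (p , q))
    ... | inj₁ p | inj₂ q = inj₂ (inj₁ (p , q))
    ... | inj₂ p | inj₁ q = inj₂ (inj₂ (p , q))
    ... | inj₂ p | inj₂ q = inj₁ (inj₂ (p , q))

    alike-opposed : ∀ {a b c d e f g h i} → Alike a b c d e f → Opposed a b c g h i → Opposed d e f g h i
    alike-opposed (inj₁ (p , q)) (inj₁ (p' , q')) = inj₁ (q , q')
    alike-opposed (inj₁ (p , q)) (inj₂ (p' , q')) = ⊥-elim (asym p p')
    alike-opposed (inj₂ (p , q)) (inj₁ (p' , q')) = ⊥-elim (asym p p')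
    alike-opposed (inj₂ (p , q)) (inj₂ (p' , q')) = inj₂ (q , q')

    opposed-opposed : ∀ {a b c d e f g h i} → Opposed a b c d e f → Opposed a b c g h i → Alike d e f g h i
    opposed-opposed (inj₁ (p , q)) (inj₁ (p' , q')) = inj₂ (q , q')
    opposed-opposed (inj₁ (p , q)) (inj₂ (p' , q')) = ⊥-elim (asym p p')
    opposed-opposed (inj₂ (p , q)) (inj₁ (p' , q')) = ⊥-elim (asym p p')
    opposed-opposed (inj₂ (p , q)) (inj₂ (p' , q')) = inj₁ (q , q')

    opposed-sym : ∀ {a b c d e f} → Opposed a b c d e f → Opposed d e f a b c
    opposed-sym (inj₁ (p , q)) = inj₂ (q , p)
    opposed-sym (inj₂ (p , q)) = inj₁ (q , p)

    meet-sym : ∀ {p q r s} → Meet p q r s → Meet r s p q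
    meet-sym (x , y) = y , x

    meet-flip : ∀ {p q r s} → Meet p q r s → Meet q p r s
    meet-flip (x , y) = swap x , opposed-sym y

    meet-flip′ : ∀ {p q r s} → Meet p q r s → Meet p q s r
    meet-flip′ x = meet-sym (meet-flip (meet-sym x))

    blocks-sym : ∀ {P u w} → Blocks P u w → Blocks P w u
    blocks-sym (s , t , inj₁ x , inj₁ (y , z)) = s , t , inj₂ x , inj₂ (z , y)
    blocks-sym (s , t , inj₁ x , inj₂ (y , z)) = s , t , inj₂ x , inj₁ (z , y)
    blocks-sym (s , t , inj₂ x , inj₁ (y , z)) = s , t , inj₁ x , inj₂ (z , y)
    blocks-sym (s , t , inj₂ x , inj₂ (y , z)) = s , t , inj₁ x , inj₁ (z , y)

    -- Edges pq and rs that cross are joined by an edge: otherwise all four sides of the quadrilateral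
    -- they span would need obstacles of their own.
    crossing-sides : ∀ {p q r s P₁ P₂ P₃ P₄} → Meet p q r s → (∀ P → Misses P p q) → (∀ P → Misses P r s) →
      Blocks P₁ p s → Blocks P₂ s q → Blocks P₃ q r → ¬ Blocks P₄ r p
    crossing-sides {P₁ = P₁} {P₂} {P₃} {P₄} x m m' b₁ b₂ b₃ b₄ = no-four {P₁} {P₂} {P₃} {P₄}
      (λ { refl → sides-adjacent x (m _) (m' _) b₁ b₂ })
      (λ { refl → sides-opposite x (m _) (m' _) b₁ b₃ })
      (λ { refl → sides-adjacent (meet-flip′ (meet-sym x)) (m' _) (λ b → m _ (blocks-sym b)) b₄ b₁ })
      (λ { refl → sides-adjacent (meet-sym x) (m' _) (m _) (blocks-sym b₃) (blocks-sym b₂) })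
      (λ { refl → sides-opposite (meet-flip x) (λ b → m _ (blocks-sym b)) (m' _) (blocks-sym b₂) (blocks-sym b₄) })
      (λ { refl → sides-adjacent (meet-flip (meet-flip′ x)) (λ b → m _ (blocks-sym b)) (λ b → m' _ (blocks-sym b)) b₃ b₄ })

    -- Seen from o, the edges x₁y₁, x₂y₂, x₃y₃ stay in consecutive wedges between the edges to x₀, x₁, x₂, x₃.
    -- Then Q reaches behind x₁ and x₂, and on the rays in between it is neither always nearer nor always
    -- farther than P.
    module Wedges (o : V) (x y : Fin 5 → V) (σ : Bool) (P Q : Fin 3)
      (edge-x  : ∀ i R → Misses R o (x i))
      (edge-y  : ∀ i R → Misses R (x i) (y i))
      (order-x : ∀ i j {_ : i <₅ j} → Turn σ o (x i) (x j))
      (side-y  : ∀ i → Turn (not σ) o (x i) (y i))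
      (blocks-x : ∀ i j {_ : i <₅ j} → Blocks P (x i) (x j))
      where

      order-alike : ∀ i j i' j' {l : i <₅ j} {l' : i' <₅ j'} → Alike o (x i) (x j) o (x i') (x j')
      order-alike i j i' j' {l} {l'} = turns-alike σ (order-x i j {l}) (order-x i' j' {l'})

      behind-x : ∀ i j k {_ : i <₅ j} {_ : j <₅ k} {_ : i <₅ k} → ¬ ¬ Behind P o (x j)
      behind-x i j k {ij} {jk} {ik} = behind-middle (order-alike i j j k {ij} {jk}) (order-alike i j i k {ij} {ik}) (edge-x i P) (edge-x j P) (edge-x k P)
        (blocks-x i j {ij}) (blocks-x j k {jk})

      behind₁ : ¬ ¬ Behind P o (x 1F)
      behind₁ = behind-x 0F 1F 2F
      behind₂ : ¬ ¬ Behind P o (x 2F)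
      behind₂ = behind-x 1F 2F 3F
      -- Here the fifth point enters, as the outer neighbour of `x 3F`.
      behind₃ : ¬ ¬ Behind P o (x 3F)
      behind₃ = behind-x 2F 3F 4F

      module _ (blocks-y : ∀ i → Blocks Q o (y i)) where

        -- `P` lies behind `x 1F`, and by `behind-shields` it cannot then hide a neighbour of `x 1F`
        -- from `o`.
        labels-differ : Q ≢ P
        labels-differ refl = behind₁ λ h → behind-shields (edge-x 1F _) (edge-y 1F _) h (blocks-y 1F)

        -- Otherwise the edge from `x j` to `y j` passes over `x i` and crosses a chord of `P` that
        -- joins the segment between `x i` and `x j` to the ray behind `x j`.
        wedge : ∀ i j {_ : i <₅ j} → o ≢ x i → x i ≢ y j → o ≢ y j → ¬ ¬ Behind P o (x j) → ¬ Meet (x j) (y j) o (x i) →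
                ¬ ¬ Turn σ o (x i) (y j)
        wedge i j {ij} ox xy oy bh n k with turn? σ ox xy oy
        ... | inj₁ t = k t
        ... | inj₂ t = bh λ h → between (turns-opposed σ (order-x i j {ij}) (side-y j)) (turns-opposed σ (order-x i j {ij}) t)
                         (blocks-x i j {ij}) h n (edge-x i P) (edge-x j P) (edge-y j P)

        contradiction : o ≢ x 0F → o ≢ x 1F → o ≢ x 2F → (∀ i j → x i ≢ y j) → (∀ i → o ≢ y i) → y 1F ≢ y 2F → y 2F ≢ y 3F →
          ¬ Meet (x 1F) (y 1F) o (x 0F) → ¬ Meet (x 2F) (y 2F) o (x 1F) → ¬ Meet (x 3F) (y 3F) o (x 2F) → ⊥
        contradiction ox₀ ox₁ ox₂ xy oy y₁₂ y₂₃ n₁ n₂ n₃ =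
          wedge 0F 1F ox₀ (xy 0F 1F) (oy 1F) behind₁ n₁ λ w₁ →
          wedge 1F 2F ox₁ (xy 1F 2F) (oy 2F) behind₂ n₂ λ w₂ →
          wedge 2F 3F ox₂ (xy 2F 3F) (oy 3F) behind₃ n₃ λ w₃ →
          apex w₁ w₂ w₃
          where
          module _ (w₁ : Turn σ o (x 0F) (y 1F)) (w₂ : Turn σ o (x 1F) (y 2F)) (w₃ : Turn σ o (x 2F) (y 3F)) where
            back : ∀ i → Turn σ o (y i) (x i)
            back i = turn-back σ (side-y i)

            y₁y₂ : Turn σ o (y 1F) (y 2F)
            y₁y₂ with turn? σ (oy 1F) y₁₂ (oy 2F)
            ... | inj₁ t = t
            ... | inj₂ t = ⊥-elim (interleaving {x = x 0F} {x 1F} {x 2F} (order-alike 0F 1F 1F 2F) (order-alike 0F 1F 0F 2F)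
                             (turns-alike σ (order-x 0F 1F) w₁) (turns-alike σ (order-x 0F 1F) (back 1F))
                             (turns-alike σ (order-x 0F 1F) w₂) (turns-alike σ (order-x 0F 1F) (back 2F))
                             (turns-opposed σ (order-x 0F 1F) t))

            y₂y₃ : Turn σ o (y 2F) (y 3F)
            y₂y₃ with turn? σ (oy 2F) y₂₃ (oy 3F)
            ... | inj₁ t = t
            ... | inj₂ t = ⊥-elim (interleaving {x = x 1F} {x 2F} {x 3F} (order-alike 1F 2F 2F 3F) (order-alike 1F 2F 1F 3F)
                             (turns-alike σ (order-x 1F 2F) w₂) (turns-alike σ (order-x 1F 2F) (back 2F))
                             (turns-alike σ (order-x 1F 2F) w₃) (turns-alike σ (order-x 1F 2F) (back 3F))
                             (turns-opposed σ (order-x 1F 2F) t))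

            apex : ⊥
            apex =
              behind₁ λ p₁ → behind₂ λ p₂ →
              behind-blocked {x = x 1F} {y 1F} {y 2F} (turns-alike σ (back 1F) w₂) (turns-alike σ (back 1F) y₁y₂)
                (blocks-y 1F) (blocks-y 2F) (edge-x 1F Q) λ q₁ →
              behind-blocked {x = x 2F} {y 2F} {y 3F} (turns-alike σ (back 2F) w₃) (turns-alike σ (back 2F) y₂y₃)
                (blocks-y 2F) (blocks-y 3F) (edge-x 2F Q) λ q₂ →
              behind-between {x = x 1F} {y 2F} {x 2F} (turns-alike σ w₂ (back 2F)) (turns-alike σ w₂ (order-x 1F 2F)) p₁ p₂
                (edge-x 1F P) (behind-shields (edge-x 2F P) (edge-y 2F P) p₂) (edge-x 2F P) λ p →
              -- On the ray through `y 2F` the obstacle `Q` comes before `P`; on the segment from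
              -- `x 1F` to `x 2F`, which lies before `Q`, it is `P` that comes first.
              rays-consistent labels-differ (blocks-y 2F) p (blocks-x 1F 2F) q₁ q₂ (edge-x 1F Q) (edge-x 2F Q)

  -- Names of the vertices that survive the selections. Equality and adjacency of names are Boolean
  -- functions given by clauses, so that for concrete names they hold by computation and can be left
  -- implicit.
  data Name : Set where
    root : Name
    a    : Fin 5 → Name
    b c  : Fin 5 → Fin 5 → Name

  sameIndex : Fin 5 → Fin 5 → Bool
  sameIndex 0F 0F = true
  sameIndex 1F 1F = true
  sameIndex 2F 2F = true
  sameIndex 3F 3F = true
  sameIndex 4F 4F = true
  sameIndex _ _ = false

  sameName : Name → Name → Bool
  sameName root root = true
  sameName (a i) (a j) = sameIndex i j
  sameName (b i k) (b j l) = sameIndex i j ∧ sameIndex k l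
  sameName (c i k) (c j l) = sameIndex i j ∧ sameIndex k l
  sameName _ _ = false

  joined : Name → Name → Bool
  joined root (a _) = true
  joined (a _) root = true
  joined (a i) (b j _) = sameIndex i j
  joined (b i _) (a j) = sameIndex i j
  joined (b i k) (c j l) = sameIndex i j ∧ sameIndex k l
  joined (c i k) (b j l) = sameIndex i j ∧ sameIndex k l
  joined _ _ = false

  sameIndex-refl : ∀ i → T (sameIndex i i)
  sameIndex-refl 0F = tt
  sameIndex-refl 1F = tt
  sameIndex-refl 2F = tt
  sameIndex-refl 3F = tt
  sameIndex-refl 4F = tt

  ∧-intro : ∀ {p q} → T p → T q → T (p ∧ q)
  ∧-intro {true} {true} _ _ = tt

  sameName-refl : ∀ u → T (sameName u u)
  sameName-refl root = tt
  sameName-refl (a i) = sameIndex-refl i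
  sameName-refl (b i l) = ∧-intro (sameIndex-refl i) (sameIndex-refl l)
  sameName-refl (c i l) = ∧-intro (sameIndex-refl i) (sameIndex-refl l)

  differ : ∀ {u w} → {_ : T (not (sameName u w))} → u ≢ w
  differ {u} {w} {d} refl with sameName u u | sameName-refl u
  ... | true | _ = d

  module Final (S : Scene Name) where
    open Scene S
    open Obstacles.Visibility S
    open Signs S

    record Homogeneous : Set where
      field
        edge    : ∀ {u w} → {_ : T (joined u w)} → ∀ R → Misses R u w
        blocked : ∀ {u w} → {_ : T (not (joined u w) ∧ not (sameName u w))} → (∀ R → ¬ Blocks R u w) → ⊥
        σ       : Bool
        P Q     : Fin 3
        order-a : ∀ i j {_ : i <₅ j} → Turn σ root (a i) (a j)
        side-b  : ∀ i l → Turn (not σ) root (a i) (b i l)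
        block-a : ∀ i j {_ : i <₅ j} → Blocks P (a i) (a j)
        block-b : ∀ i l → Blocks Q root (b i l)
        cross-a : (∀ i j {_ : i <₅ j} → ∀ l → Meet (a j) (b j l) root (a i))
                ⊎ (∀ i j {_ : i <₅ j} → ∃[ l ] ¬ Meet (a j) (b j l) root (a i))
        τ       : Bool
        P′ Q′   : Fin 3
        order-b : ∀ l m {_ : l <₅ m} → Turn τ (a 2F) (b 2F l) (b 2F m)
        side-c  : ∀ l → Turn (not τ) (a 2F) (b 2F l) (c 2F l)
        block-bb : ∀ l m {_ : l <₅ m} → Blocks P′ (b 2F l) (b 2F m)
        block-c : ∀ l → Blocks Q′ (a 2F) (c 2F l)
        cross-b : (∀ l m {_ : l <₅ m} → Meet (b 2F m) (c 2F m) (a 2F) (b 2F l))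
                ⊎ (∀ l m {_ : l <₅ m} → ¬ Meet (b 2F m) (c 2F m) (a 2F) (b 2F l))

    module _ (H : Homogeneous) where
      open Homogeneous H

      nonadjacent-edges : ∀ {p q r s} →
        {_ : T (joined p q)} {_ : T (joined r s)}
        {_ : T (not (joined p s) ∧ not (sameName p s))} {_ : T (not (joined s q) ∧ not (sameName s q))}
        {_ : T (not (joined q r) ∧ not (sameName q r))} {_ : T (not (joined r p) ∧ not (sameName r p))} → ¬ Meet p q r s
      nonadjacent-edges {p} {q} {r} {s} {e} {e'} {n₁} {n₂} {n₃} {n₄} x =
        blocked {p} {s} {n₁} λ _ b₁ → blocked {s} {q} {n₂} λ _ b₂ →
        blocked {q} {r} {n₃} λ _ b₃ → blocked {r} {p} {n₄} λ _ b₄ →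
        crossing-sides x (λ R → edge {p} {q} {e} R) (λ R → edge {r} {s} {e'} R) b₁ b₂ b₃ b₄

      adjacent-sides : ∀ {p q r s A B} → {_ : T (joined p q)} {_ : T (joined r s)} → Meet p q r s → Blocks A p s → Blocks B s q → A ≢ B
      adjacent-sides {p} {q} {r} {s} {_} {_} {e} {e'} x h k refl = sides-adjacent x (edge {p} {q} {e} _) (edge {r} {s} {e'} _) h k

      module WA (pick : Fin 5 → Fin 5) = Wedges root a (λ i → b i (pick i)) σ P Q
        (λ i R → edge {root} {a i} R) (λ i R → edge {a i} {b i (pick i)} {sameIndex-refl i} R)
        order-a (λ i → side-b i (pick i)) block-a

      module WB = Wedges (a 2F) (b 2F) (c 2F) τ P′ Q′
        (λ l R → edge {a 2F} {b 2F l} R) (λ l R → edge {b 2F l} {c 2F l} {∧-intro {true} tt (sameIndex-refl l)} R)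
        order-b side-c block-bb

      all-cross-a : ∀ i j {_ : i <₅ j} → ∀ l → Meet (a j) (b j l) root (a i)
      all-cross-a with cross-a
      ... | inj₁ all = all
      ... | inj₂ some = ⊥-elim (WA.contradiction pick (λ i → block-b i (pick i)) (λ ()) (λ ()) (λ ()) (λ _ _ ()) (λ _ ()) (λ ()) (λ ())
                          (proj₂ (some 0F 1F)) (proj₂ (some 1F 2F)) (proj₂ (some 2F 3F)))
        where
        -- The wedge argument asks about consecutive indices only, so one child without the crossing
        -- suffices for each upper index; `0F` is a filler.
        pick : Fin 5 → Fin 5
        pick 1F = proj₁ (some 0F 1F)
        pick 2F = proj₁ (some 1F 2F)
        pick 3F = proj₁ (some 2F 3F)
        pick _ = 0F

      all-cross-b : ∀ l m {_ : l <₅ m} → Meet (b 2F m) (c 2F m) (a 2F) (b 2F l)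
      all-cross-b with cross-b
      ... | inj₁ all = all
      ... | inj₂ none = ⊥-elim (WB.contradiction block-c (λ ()) (λ ()) (λ ()) (λ _ _ ()) (λ _ ()) (λ ()) (λ ())
                          (none 0F 1F) (none 1F 2F) (none 2F 3F))

      v x w d : Name
      v = root
      x = a 1F
      w = a 3F
      d = b 3F 0F

      a₂ : Name
      a₂ = a 2F

      B C : Fin 5 → Name
      B = b 2F
      C = c 2F

      cross-B : ∀ l → Meet a₂ (B l) v x
      cross-B l = all-cross-a 1F 2F l

      cross-d : Meet w d v a₂
      cross-d = all-cross-a 2F 3F 0F

      P≢Q : P ≢ Q
      P≢Q refl = WA.labels-differ (λ _ → 0F) (λ i → block-b i 0F) refl

      ab : ∀ l R → Misses R a₂ (B l)
      ab l = edge {a₂} {B l}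
      ba : ∀ l R → Misses R (B l) a₂
      ba l = edge {B l} {a₂}
      vx′ : ∀ R → Misses R v x
      vx′ = edge {v} {x}
      va : ∀ R → Misses R v a₂
      va = edge {v} {a₂}

      P-ax : Blocks P a₂ x
      P-ax = blocks-sym (block-a 1F 2F)

      not-P-beyond : ∀ l → ¬ Behind P a₂ (B l)
      not-P-beyond l = sector (cross-B l) (ab l P) (vx′ P) P-ax

      -- The quadrilateral with diagonals `a₂ (B l)` and `v x` has the edge `v a₂` as one side. Its
      -- sides `a₂ x` and `v (B l)` are hidden by `P` and `Q`, so the remaining side `x (B l)` needs
      -- the third obstacle.
      P≢xB : ∀ l {R} → Blocks R x (B l) → P ≢ R
      P≢xB l k = adjacent-sides {a₂} {B l} {v} {x} (cross-B l) P-ax k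

      Q≢xB : ∀ l {R} → Blocks R x (B l) → Q ≢ R
      Q≢xB l k = adjacent-sides {v} {x} {a₂} {B l} (meet-sym (cross-B l)) (block-b 2F l) (blocks-sym k)

      -- The same with diagonals `v a₂` and `w d`: the sides `v d` and `w a₂` are hidden by `Q` and
      -- `P`, which leaves the third obstacle for `a₂ d`.
      Q≢ad : ∀ {R} → Blocks R a₂ d → Q ≢ R
      Q≢ad k = adjacent-sides {v} {a₂} {w} {d} (meet-sym cross-d) (block-b 3F 0F) (blocks-sym k)

      P≢ad : ∀ {R} → Blocks R a₂ d → P ≢ R
      P≢ad k = adjacent-sides {w} {d} {v} {a₂} cross-d (blocks-sym (block-a 2F 3F)) k

      fan₁ : Alike v x a₂ v a₂ w
      fan₁ = turns-alike σ (order-a 1F 2F) (order-a 2F 3F)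

      fan₂ : Alike v a₂ w v x w
      fan₂ = turns-alike σ (order-a 2F 3F) (order-a 1F 3F)

      behind-P′ : ∀ l {_ : 0F <₅ l} {_ : l <₅ 4F} → ¬ ¬ Behind P′ a₂ (B l)
      behind-P′ 1F = WB.behind₁
      behind-P′ 2F = WB.behind₂
      behind-P′ 3F = WB.behind₃

      P′≢P : P′ ≢ P
      P′≢P e = behind-P′ 1F λ h → not-P-beyond 1F (subst (λ R → Behind R a₂ (B 1F)) e h)

      module _ {S : Fin 3} (S-ad : Blocks S a₂ d) where
        S≢P : S ≢ P
        S≢P e = P≢ad S-ad (sym e)

        S≢Q : S ≢ Q
        S≢Q e = Q≢ad S-ad (sym e)

        only-S : ∀ l {R} → Blocks R x (B l) → R ≡ S
        only-S l k = third P≢Q (λ e → P≢xB l k (sym e)) (λ e → Q≢xB l k (sym e)) S≢P S≢Q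

        S-xB : ∀ l → ¬ ¬ Blocks S x (B l)
        S-xB l n = blocked {x} {B l} λ R k → n (subst (λ R → Blocks R x (B l)) (only-S l k) k)

        -- Around `a₂`, the good order is `v`, `d`, `B l` and the bad one `v`, `B l`, `d`.
        Good Bad : Fin 5 → Set
        Good l = Alike a₂ (B l) v a₂ (B l) d
        Bad l = Opposed a₂ (B l) v a₂ (B l) d

        good? : ∀ l → Good l ⊎ Bad l
        good? l = alike? (λ ()) (λ ()) (λ ()) (λ ()) (λ ()) (λ ())

        -- `S` meets `x (B l)` and `a₂ d`, on different sides of the edge `a₂ (B l)`. By `sector` it
        -- does not pass behind `a₂`, so it passes behind `B l`.
        good-behind : ∀ l → Good l → ¬ ¬ Behind S a₂ (B l)
        good-behind l g n = S-xB l λ k →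
          behind-straddling (opposed-sym (alike-opposed g (proj₁ (cross-B l)))) (blocks-sym k) S-ad (ab l S)
            (sector (meet-flip (cross-B l)) (ba l S) (vx′ S) (blocks-sym k)) n

        -- With `P′ ≡ Q`, the obstacle `Q` also reaches behind `d`. On the ray to `d` it then comes
        -- after `S`, but between the two children it comes before `S`.
        good-pair : ∀ l m {_ : 0F <₅ l} {_ : l <₅ m} {_ : l <₅ 4F} → P′ ≡ Q → Good l → Good m → ⊥
        good-pair l m {p} {q} {r} refl g g' =
          good-behind l g λ h → good-behind m g' λ h' → behind-P′ l {p} {r} λ k →
          behind-neighbour k (block-b 3F 0F) wide g (ab l Q) (λ e → Q≢ad e refl) (va Q) λ k' →
          rays-consistent S≢Q S-ad k' (block-bb l m {q}) h h' (ab l S) (ab m S)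
          where
          wide : Opposed a₂ d (B l) a₂ d v
          wide with alike? {a₂} {d} {B l} {a₂} {d} {v} (λ ()) (λ { () }) (λ ()) (λ ()) (λ ()) (λ ())
          ... | inj₁ e = ⊥-elim (fan fan₁ fan₂ (cross-B l) cross-d g e)
          ... | inj₂ e = e

        bad-inside : ∀ l → Bad l → Inside v a₂ w d (vx (B l))
        bad-inside l g = pick (pocket₂ fan₁ fan₂ (cross-B l) cross-d apart g) (alike? (λ ()) (λ ()) (λ ()) (λ ()) (λ ()) (λ ()))
                       , pick (pocket₁ fan₁ fan₂ (cross-B l) cross-d apart g) (alike? (λ ()) (λ ()) (λ ()) (λ ()) (λ ()) (λ ()))
                       , pick (pocket₃ fan₁ fan₂ (cross-B l) cross-d apart g) (alike? (λ ()) (λ ()) (λ ()) (λ ()) (λ ()) (λ ()))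
          where
          apart : ¬ Meet a₂ (B l) w d
          apart = nonadjacent-edges {a₂} {B l} {w} {d}
          pick : ∀ {A B : Set} → ¬ B → A ⊎ B → A
          pick n (inj₁ p) = p
          pick n (inj₂ q) = ⊥-elim (n q)

        -- Hiding two points of the pocket from each other confines `Q` to the pocket, whereas `Q`
        -- also has to hide `d` from `v`.
        bad-pair : ∀ l m {_ : l <₅ m} → P′ ≡ Q → Bad l → Bad m → ⊥
        bad-pair l m {q} refl g g' with block-bb l m {q}
        ... | s , t , k = trapped-vy cross-d (edge {w} {d} Q) (va Q) Q-da
                (inside-chord cross-d (edge {w} {d} Q) (va Q) Q-da (λ ()) (λ ()) (λ ()) (λ ()) (λ ()) (bad-inside l g) (bad-inside m g') k)
                (block-b 3F 0F)
          where
          Q-da : Misses Q d a₂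
          Q-da e = Q≢ad (blocks-sym e) refl

        P′≢Q : P′ ≢ Q
        -- Two of the three children in the middle of the order agree in being good or bad.
        P′≢Q e with good? 1F | good? 2F | good? 3F
        ... | inj₁ g | inj₁ h | _      = good-pair 1F 2F e g h
        ... | inj₁ g | inj₂ _ | inj₁ h = good-pair 1F 3F e g h
        ... | inj₁ _ | inj₂ g | inj₂ h = bad-pair 2F 3F e g h
        ... | inj₂ g | inj₂ h | _      = bad-pair 1F 2F e g h
        ... | inj₂ g | inj₁ _ | inj₂ h = bad-pair 1F 3F e g h
        ... | inj₂ _ | inj₁ g | inj₁ h = good-pair 2F 3F e g h

        P′≡S : P′ ≡ S
        P′≡S = third P≢Q P′≢P P′≢Q S≢P S≢Q

        -- The quadrilateral with diagonals `a₂ y` and `β γ` has the edge `a₂ β` as one side; the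
        -- obstacles of its other sides, `S` for `y β`, `Q′` for `a₂ γ` and that of `y γ`, will be
        -- pairwise different.
        y β γ : Name
        y = B 1F
        β = B 2F
        γ = C 2F

        βγ : ∀ R → Misses R β γ
        βγ = edge {β} {γ}

        cross-y : Meet a₂ y v x
        cross-y = cross-B 1F

        cross-βγ : Meet a₂ y β γ
        cross-βγ = meet-sym (all-cross-b 1F 2F)

        S-yβ : Blocks S y β
        S-yβ = subst (λ R → Blocks R y β) P′≡S (block-bb 1F 2F)

        Q′≢S : Q′ ≢ S
        Q′≢S e = behind-P′ 1F λ h → behind-shields (ab 1F _) (edge {y} {C 1F} _) (subst (λ R → Behind R a₂ y) (trans P′≡S (sym e)) h) (block-c 1F)

        Q′≢yγ : ∀ {R} → Blocks R y γ → Q′ ≢ R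
        Q′≢yγ k = adjacent-sides {a₂} {y} {β} {γ} cross-βγ (block-c 2F) (blocks-sym k)

        S≢yγ : ∀ {R} → Blocks R y γ → S ≢ R
        S≢yγ k = adjacent-sides {β} {γ} {a₂} {y} (meet-sym cross-βγ) (blocks-sym S-yβ) k

        apart-βγ : ¬ Meet β γ v x
        apart-βγ = nonadjacent-edges {β} {γ} {v} {x}

        module Upper (u : Alike a₂ y γ a₂ y x) where
          inner : Alike y x γ y x a₂
          inner with alike? {y} {x} {γ} {y} {x} {a₂} (λ ()) (λ ()) (λ ()) (λ ()) (λ ()) (λ ())
          ... | inj₁ e = e
          ... | inj₂ e = ⊥-elim (S-xB 1F λ k → upper-order cross-βγ u e (blocks-sym k) S-yβ (ab 1F S) (βγ S) (λ k → S≢yγ k refl))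

          left : Alike v x γ v x y
          left with alike? {v} {x} {γ} {v} {x} {y} (λ ()) (λ ()) (λ ()) (λ ()) (λ ()) (λ ())
          ... | inj₁ e = e
          ... | inj₂ e = ⊥-elim (upper-inside cross-y cross-βγ (cross-B 2F) apart-βγ u inner e)

          -- `γ` has been located in the triangle bounded by `a₂ y`, `v x` and `y x`, which confines
          -- `R` to it. But `P` also has to hide `x` from `a₂`, and `Q` to hide `y` from `v`.
          trapped : ∀ {R} → Blocks R y γ → Misses R y x × ∃[ s ] Inside v x a₂ y (ob R s)
          trapped {R} k@(s , t , h) = yx , s , inside-corner cross-y (ab 1F R) (vx′ R) yx (λ ()) (λ ()) (λ ()) (λ ()) (λ ()) (u , inner , left) h
            where
            yx : Misses R y x
            yx l = S≢yγ k (sym (only-S 1F (blocks-sym l)))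

          not-P : ¬ Blocks P y γ
          not-P k with trapped k
          ... | yx , s , i = trapped-ax cross-y (ab 1F P) (vx′ P) yx i P-ax

          not-Q : ¬ Blocks Q y γ
          not-Q k with trapped k
          ... | yx , s , i = trapped-vy cross-y (ab 1F Q) (vx′ Q) yx i (block-b 2F 1F)

        module Lower (u : Opposed a₂ y γ a₂ y x) where
          below : Alike a₂ y γ a₂ y v
          below = opposed-opposed (opposed-sym u) (opposed-sym (proj₁ cross-y))

          -- `P` would meet `a₂ x` and `y γ` on different sides of the edge `a₂ y` without passing
          -- behind either end.
          not-P : ¬ Blocks P y γ
          not-P k = straddling u P-ax k (ab 1F P) (not-P-beyond 1F) (sector (meet-flip cross-βγ) (ba 1F P) (βγ P) k)

          -- If `γ` is on the side of `v a₂` where `x` is, `P` would pass behind `y`. Otherwise `v`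
          -- lies in the triangle `a₂ β γ`, and `Q` would have to cross the edge `β γ`.
          not-Q : Q′ ≡ P → ¬ Blocks Q y γ
          not-Q e k with alike? {v} {a₂} {γ} {v} {a₂} {x} (λ ()) (λ ()) (λ ()) (λ ()) (λ ()) (λ ())
          ... | inj₁ l = lower-side cross-y below l (subst (λ R → Blocks R a₂ γ) e (block-c 2F)) P-ax (ab 1F P) (va P) (not-P-beyond 1F)
          ... | inj₂ l = lower-inside cross-y cross-βγ (cross-B 2F) apart-βγ below l λ i →
                         lower-blocked i cross-βγ (block-b 2F 2F) k (βγ Q) (ab 1F Q)

        not-P-yγ : ¬ Blocks P y γ
        not-P-yγ k with alike? {a₂} {y} {γ} {a₂} {y} {x} (λ ()) (λ ()) (λ ()) (λ ()) (λ ()) (λ ())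
        ... | inj₁ u = Upper.not-P u k
        ... | inj₂ u = Lower.not-P u k

        not-Q-yγ : Q′ ≡ P → ¬ Blocks Q y γ
        not-Q-yγ e k with alike? {a₂} {y} {γ} {a₂} {y} {x} (λ ()) (λ ()) (λ ()) (λ ()) (λ ()) (λ ())
        ... | inj₁ u = Upper.not-Q u k
        ... | inj₂ u = Lower.not-Q u e k

        absurd : ⊥
        absurd = blocked {y} {γ} λ R k → cases R k (Q′ ≟ P)
          where
          cases : ∀ R → Blocks R y γ → Dec (Q′ ≡ P) → ⊥
          cases R k (yes e) = not-Q-yγ e (subst (λ R → Blocks R y γ) R≡Q k)
            where
            R≡Q : R ≡ Q
            R≡Q = third S≢P (λ e → S≢yγ k (sym e)) (λ r → Q′≢yγ k (trans e (sym r))) (λ e → S≢Q (sym e)) (λ e → P≢Q (sym e))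
          cases R k (no n) = not-P-yγ (subst (λ R → Blocks R y γ) R≡P k)
            where
            Q′≡Q : Q′ ≡ Q
            Q′≡Q = third S≢P Q′≢S n (λ e → S≢Q (sym e)) (λ e → P≢Q (sym e))
            R≡P : R ≡ P
            R≡P = third S≢Q (λ e → S≢yγ k (sym e)) (λ r → Q′≢yγ k (trans Q′≡Q (sym r))) (λ e → S≢P (sym e)) P≢Q

      impossible : ⊥
      impossible = blocked {a₂} {d} λ _ k → absurd k

-- Ordered fields: a ring solver and signs.

module Fields where

  open import Level using (0ℓ)
  open import Data.Nat using (ℕ)
  import Data.Nat as ℕ
  open import Data.Product using (∃-syntax; _×_; _,_; proj₂)
  open import Data.Sum using (_⊎_; inj₁; inj₂)
  open import Data.Maybe using (Maybe; just; nothing)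
  open import Data.Empty using (⊥-elim)
  open import Relation.Nullary using (¬_; Dec; yes; no)
  open import Relation.Binary using (tri<; tri≈; tri>)
  open import Relation.Binary.PropositionalEquality hiding ([_])
  open import Algebra.Bundles using (CommutativeRing; RawRing)
  open import Algebra.Solver.Ring.AlmostCommutativeRing using (AlmostCommutativeRing; fromCommutativeRing; _-Raw-AlmostCommutative⟶_)

  module OrderedField (F : CompleteOrderedField) where
    open CompleteOrderedField F

    commutativeRing : CommutativeRing 0ℓ 0ℓ
    commutativeRing = record
      { Carrier = R ; _≈_ = _≡_ ; _+_ = _+_ ; _*_ = _*_ ; -_ = λ z → - z ; 0# = 0# ; 1# = 1#
      ; isCommutativeRing = record
        { isRing = record
          { +-isAbelianGroup = record
            { isGroup = record
              { isMonoid = record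
                { isSemigroup = record
                  { isMagma = record { isEquivalence = isEquivalence ; ∙-cong = cong₂ _+_ }
                  ; assoc = +-assoc }
                ; identity = +-identity , λ x → trans (+-comm x 0#) (+-identity x) }
              ; inverse = (λ x → trans (+-comm (- x) x) (+-inverse x)) , +-inverse
              ; ⁻¹-cong = cong (λ z → - z) }
            ; comm = +-comm }
          ; *-cong = cong₂ _*_
          ; *-assoc = *-assoc
          ; *-identity = *-identity , λ x → trans (*-comm x 1#) (*-identity x)
          ; distrib = distrib , λ x y z → trans (*-comm (y + z) x) (trans (distrib x y z) (cong₂ _+_ (*-comm x y) (*-comm x z))) }
        ; *-comm = *-comm } }

    private
      ACR : AlmostCommutativeRing 0ℓ 0ℓ
      ACR = fromCommutativeRing commutativeRing
    open CommutativeRing commutativeRing using (semiring; +-commutativeSemigroup; ring; zeroˡ; zeroʳ; +-abelianGroup) public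
    open import Algebra.Properties.Ring ring using (-‿distribˡ-*; -‿distribʳ-*; -‿involutive) public
    open import Algebra.Properties.AbelianGroup +-abelianGroup using (⁻¹-∙-comm)
    open import Algebra.Properties.CommutativeSemigroup +-commutativeSemigroup using (interchange)
    open import Algebra.Properties.Semiring.Mult semiring using (×-homo-+; ×1-homo-*) renaming (_×_ to _·_)

    -- Integer coefficients for the ring solver, as formal differences of natural numbers.
    private
      ι : ℕ → R
      ι n = n · 1#

      ⟦_⟧ᶜ : ℕ × ℕ → R
      ⟦ a , b ⟧ᶜ = ι a + (- ι b)

      coeff : RawRing 0ℓ 0ℓ
      coeff = record
        { Carrier = ℕ × ℕ ; _≈_ = _≡_
        ; _+_ = λ { (a , b) (c , d) → a ℕ.+ c , b ℕ.+ d }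
        ; _*_ = λ { (a , b) (c , d) → a ℕ.* c ℕ.+ b ℕ.* d , a ℕ.* d ℕ.+ b ℕ.* c }
        ; -_ = λ { (a , b) → b , a }
        ; 0# = 0 , 0 ; 1# = 1 , 0 }

      minus-plus : ∀ A B C D → (A + C) + (- (B + D)) ≡ (A + (- B)) + (C + (- D))
      minus-plus A B C D = trans (cong ((A + C) +_) (sym (⁻¹-∙-comm B D))) (interchange A C (- B) (- D))

      open ≡-Reasoning
      minus-times : ∀ A B C D → (A * C + B * D) + (- (A * D + B * C)) ≡ (A + (- B)) * (C + (- D))
      minus-times A B C D = begin
        (A * C + B * D) + (- (A * D + B * C))             ≡⟨ minus-plus (A * C) (A * D) (B * D) (B * C) ⟩
        (A * C + (- (A * D))) + (B * D + (- (B * C)))      ≡⟨ cong₂ _+_ (cong (A * C +_) (-‿distribʳ-* A D)) (+-comm _ _) ⟩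
        (A * C + A * (- D)) + ((- (B * C)) + B * D)        ≡⟨ cong₂ _+_ (sym (distrib A C (- D)))
                                                                 (cong₂ _+_ (-‿distribˡ-* B C) (trans (sym (-‿involutive _)) (trans (cong (λ z → - z) (-‿distribʳ-* B D)) (-‿distribˡ-* B (- D))))) ⟩
        A * (C + (- D)) + ((- B) * C + (- B) * (- D))      ≡⟨ cong (A * (C + (- D)) +_) (sym (distrib (- B) C (- D))) ⟩
        A * (C + (- D)) + (- B) * (C + (- D))              ≡⟨ sym (proj₂ (CommutativeRing.distrib commutativeRing) _ _ _) ⟩
        (A + (- B)) * (C + (- D))                          ∎

      morphism : coeff -Raw-AlmostCommutative⟶ ACR
      morphism = record
        { ⟦_⟧ = ⟦_⟧ᶜ
        ; +-homo = λ { (a , b) (c , d) → trans (cong₂ (λ x y → x + (- y)) (×-homo-+ 1# a c) (×-homo-+ 1# b d)) (minus-plus _ _ _ _) }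
        ; *-homo = λ { (a , b) (c , d) → trans (cong₂ (λ x y → x + (- y))
                         (trans (×-homo-+ 1# (a ℕ.* c) (b ℕ.* d)) (cong₂ _+_ (×1-homo-* a c) (×1-homo-* b d)))
                         (trans (×-homo-+ 1# (a ℕ.* d) (b ℕ.* c)) (cong₂ _+_ (×1-homo-* a d) (×1-homo-* b c))))
                         (minus-times (ι a) (ι b) (ι c) (ι d)) }
        ; -‿homo = λ { (a , b) → trans (+-comm _ _) (trans (cong ((- ι a) +_) (sym (-‿involutive _))) (⁻¹-∙-comm (ι a) (- ι b))) }
        ; 0-homo = +-inverse 0#
        ; 1-homo = trans (cong₂ _+_ (trans (+-comm 1# 0#) (+-identity 1#)) (trans (sym (+-identity (- 0#))) (+-inverse 0#))) (trans (+-comm 1# 0#) (+-identity 1#))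
        }

      cancel : ∀ a b c d → a ℕ.+ d ≡ c ℕ.+ b → ⟦ a , b ⟧ᶜ ≡ ⟦ c , d ⟧ᶜ
      cancel a b c d e = begin
        ι a + (- ι b)                                ≡⟨ sym (trans (+-comm _ _) (+-identity _)) ⟩
        (ι a + (- ι b)) + 0#                         ≡⟨ cong ((ι a + (- ι b)) +_) (sym (+-inverse (ι d))) ⟩
        (ι a + (- ι b)) + (ι d + (- ι d))            ≡⟨ interchange (ι a) (- ι b) (ι d) (- ι d) ⟩
        (ι a + ι d) + ((- ι b) + (- ι d))            ≡⟨ cong (_+ ((- ι b) + (- ι d))) (trans (sym (×-homo-+ 1# a d)) (trans (cong ι e) (×-homo-+ 1# c b))) ⟩
        (ι c + ι b) + ((- ι b) + (- ι d))            ≡⟨ cong ((ι c + ι b) +_) (+-comm _ _) ⟩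
        (ι c + ι b) + ((- ι d) + (- ι b))            ≡⟨ interchange (ι c) (ι b) (- ι d) (- ι b) ⟩
        (ι c + (- ι d)) + (ι b + (- ι b))            ≡⟨ cong ((ι c + (- ι d)) +_) (+-inverse (ι b)) ⟩
        (ι c + (- ι d)) + 0#                         ≡⟨ trans (+-comm _ _) (+-identity _) ⟩
        ι c + (- ι d)                                ∎

      _coeff≟_ : ∀ p q → Maybe (⟦ p ⟧ᶜ ≡ ⟦ q ⟧ᶜ)
      (a , b) coeff≟ (c , d) with (a ℕ.+ d) ℕ.≟ (c ℕ.+ b)
      ... | yes e = just (cancel a b c d e)
      ... | no _ = nothing

    module Solver where
      open import Algebra.Solver.Ring coeff ACR morphism _coeff≟_ public

    open Solver using (solve; _:=_; _:+_; _:*_; :-_; _:-_; con) public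

    irreflexive : ∀ {x} → ¬ x < x
    irreflexive {x} p with <-tri x x
    ... | tri< _ n _ = n refl
    ... | tri≈ n _ _ = n p
    ... | tri> _ n _ = n refl

    positive-+ : ∀ {x y} → 0# < x → 0# < y → 0# < x + y
    positive-+ {x} {y} p q = <-trans q (subst (_< x + y) (+-identity y) (+-mono-< y p))

    sign : ∀ x → 0# < x ⊎ x ≡ 0# ⊎ 0# < - x
    sign x with <-tri 0# x
    ... | tri< p _ _ = inj₁ p
    ... | tri≈ _ e _ = inj₂ (inj₁ (sym e))
    ... | tri> _ _ p = inj₂ (inj₂ (subst₂ _<_ (+-inverse x) (+-identity (- x)) (+-mono-< (- x) p)))

    not-both : ∀ {x} → 0# < x → ¬ 0# < - x
    not-both {x} p q = irreflexive (subst (0# <_) (+-inverse x) (positive-+ p q))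

    not-zero : ∀ {x} → 0# < x → ¬ x ≡ 0#
    not-zero p refl = irreflexive p

    positive? : ∀ x → Dec (0# < x)
    positive? x with sign x
    ... | inj₁ p = yes p
    ... | inj₂ (inj₁ e) = no λ p → not-zero p e
    ... | inj₂ (inj₂ p) = no λ q → not-both q p

    nonneg-+ : ∀ {x y} → 0# ≤ x → 0# ≤ y → 0# ≤ x + y
    nonneg-+ (inj₁ p) (inj₁ q) = inj₁ (positive-+ p q)
    nonneg-+ {x} (inj₁ p) (inj₂ refl) = inj₁ (subst (0# <_) (trans (sym (+-identity x)) (+-comm 0# x)) p)
    nonneg-+ {y = y} (inj₂ refl) q = subst (0# ≤_) (sym (+-identity y)) q

    positive-nonneg : ∀ {x y} → 0# < x → 0# ≤ y → 0# < x + y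
    positive-nonneg p (inj₁ q) = positive-+ p q
    positive-nonneg {x} p (inj₂ refl) = subst (0# <_) (trans (sym (+-identity x)) (+-comm 0# x)) p

    nonneg-* : ∀ {x y} → 0# ≤ x → 0# ≤ y → 0# ≤ x * y
    nonneg-* (inj₁ p) (inj₁ q) = inj₁ (*-pos p q)
    nonneg-* {x} (inj₁ p) (inj₂ refl) = inj₂ (sym (zeroʳ x))
    nonneg-* {y = y} (inj₂ refl) _ = inj₂ (sym (zeroˡ y))

    nonneg-not-neg : ∀ {x} → 0# ≤ x → ¬ 0# < - x
    nonneg-not-neg (inj₁ p) q = not-both p q
    nonneg-not-neg (inj₂ refl) q = irreflexive (subst (0# <_) (trans (sym (+-identity (- 0#))) (+-inverse 0#)) q)

    factor-positive : ∀ {x y} → 0# < y → 0# < x * y → 0# < x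
    factor-positive {x} {y} p q with sign x
    ... | inj₁ r = r
    ... | inj₂ (inj₁ refl) = ⊥-elim (irreflexive (subst (0# <_) (zeroˡ y) q))
    ... | inj₂ (inj₂ r) = ⊥-elim (not-both q (subst (0# <_) (sym (-‿distribˡ-* x y)) (*-pos r p)))

    one-positive : 0# < 1#
    one-positive with sign 1#
    ... | inj₁ p = p
    ... | inj₂ (inj₁ e) = ⊥-elim (0≢1 (sym e))
    ... | inj₂ (inj₂ p) = subst (0# <_) (trans (solve 1 (λ x → (:- x) :* (:- x) := x :* x) refl 1#) (*-identity 1#)) (*-pos p p)

    recip : ∀ {x} → 0# < x → ∃[ y ] (0# < y × x * y ≡ 1#)
    recip {x} p with *-inverse x (not-zero p)
    ... | y , e = y , factor-positive p (subst (0# <_) (trans (sym e) (*-comm x y)) one-positive) , e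

-- Orientations of points in the plane, and crossings of segments.

module Planes where

  open import Data.Nat using (ℕ; zero; suc)
  open import Data.Fin using (Fin; zero; suc)
  open import Data.Product using (∃-syntax; _×_; _,_; proj₁; proj₂)
  open import Data.Sum using (_⊎_; inj₁; inj₂)
  open import Relation.Nullary using (¬_; Dec)
  open import Relation.Binary.PropositionalEquality hiding ([_])
  open Fields

  module Plane (F : CompleteOrderedField) where
    open CompleteOrderedField F
    open Geometry F
    open OrderedField F

    Left : Point → Point → Point → Set
    Left p q r = 0# < orient p q r

    private
      area : R → R → R → R → R
      area x y x' y' = (x * y') - (y * x')

    orient-rotate : ∀ p q r → orient q r p ≡ orient p q r
    orient-rotate (a , b) (c , d) (e , f) = solve 6 (λ a b c d e f →
      (e :- c) :* (b :- d) :- (f :- d) :* (a :- c) := (c :- a) :* (f :- b) :- (d :- b) :* (e :- a)) refl a b c d e f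

    orient-swap : ∀ p q r → orient q p r ≡ - orient p q r
    orient-swap (a , b) (c , d) (e , f) = solve 6 (λ a b c d e f →
      (a :- c) :* (f :- d) :- (b :- d) :* (e :- c) := :- ((c :- a) :* (f :- b) :- (d :- b) :* (e :- a))) refl a b c d e f

    -- Signed areas add when a triangle is divided at `t`, wherever `t` lies; interiority follows.
    orient-split : ∀ p q r t → orient p q r ≡ (orient t q r + orient p t r) + orient p q t
    orient-split (a , b) (c , d) (e , f) (g , h) = solve 8 (λ a b c d e f g h →
      (c :- a) :* (f :- b) :- (d :- b) :* (e :- a) :=
      (((c :- g) :* (f :- h) :- (d :- h) :* (e :- g)) :+ ((g :- a) :* (f :- b) :- (h :- b) :* (e :- a))) :+
      ((c :- a) :* (h :- b) :- (d :- b) :* (g :- a))) refl a b c d e f g h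

    area-plücker : ∀ a b c d e f g h → area c d g h * area a b e f ≡ (area a b c d * area e f g h) + (area a b g h * area c d e f)
    area-plücker = solve 8 (λ a b c d e f g h →
      (c :* h :- d :* g) :* (a :* f :- b :* e) :=
      ((a :* d :- b :* c) :* (e :* h :- f :* g)) :+ ((a :* h :- b :* g) :* (c :* f :- d :* e))) refl

    -- The three-term Grassmann-Plücker relation for vectors from `t`. As the other factors have
    -- known signs, it yields both transitivity axioms.
    plücker : ∀ t s p q r → orient t p r * orient t s q ≡ (orient t s p * orient t q r) + (orient t s r * orient t p q)
    plücker (t₁ , t₂) (s₁ , s₂) (p₁ , p₂) (q₁ , q₂) (r₁ , r₂) =
      area-plücker (s₁ - t₁) (s₂ - t₂) (p₁ - t₁) (p₂ - t₂) (q₁ - t₁) (q₂ - t₂) (r₁ - t₁) (r₂ - t₂)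

    left-rotate : ∀ {p q r} → Left p q r → Left q r p
    left-rotate {p} {q} {r} = subst (0# <_) (sym (orient-rotate p q r))

    left-swap : ∀ {p q r} → Left q p r → 0# < - orient p q r
    left-swap {p} {q} {r} = subst (0# <_) (orient-swap p q r)

    swap-left : ∀ {p q r} → 0# < - orient p q r → Left q p r
    swap-left {p} {q} {r} = subst (0# <_) (sym (orient-swap p q r))

    left-asym : ∀ {p q r} → Left p q r → ¬ Left q p r
    left-asym l l' = not-both l (left-swap l')

    left-interior : ∀ {p q r t} → Left t q r → Left p t r → Left p q t → Left p q r
    left-interior {p} {q} {r} {t} a b c = subst (0# <_) (sym (orient-split p q r t)) (positive-+ (positive-+ a b) c)

    left-source : ∀ {t s p q r} → Left t s p → Left t s q → Left t s r → Left t p q → Left t q r → Left t p r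
    left-source {t} {s} {p} {q} {r} sp sq sr pq qr =
      factor-positive sq (subst (0# <_) (sym (plücker t s p q r)) (positive-+ (*-pos sp qr) (*-pos sr pq)))

    left-sink : ∀ {t s p q r} → Left t p s → Left t q s → Left t r s → Left t p q → Left t q r → Left t p r
    left-sink {t} {s} {p} {q} {r} ps qs rs pq qr =
      factor-positive (back qs) (subst (0# <_) (sym (flip t s p q r)) (positive-+ (*-pos (back ps) qr) (*-pos (back rs) pq)))
      where
      back : ∀ {x} → Left t x s → 0# < - orient t s x
      back l = left-swap (left-rotate (left-rotate l))
      flip : ∀ t s p q r → orient t p r * (- orient t s q) ≡ ((- orient t s p) * orient t q r) + ((- orient t s r) * orient t p q)
      flip t s p q r = trans (sym (-‿distribʳ-* _ _)) (trans (cong (λ z → - z) (plücker t s p q r))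
        (solve 4 (λ a b c d → :- (a :* b :+ c :* d) := ((:- a) :* b) :+ ((:- c) :* d)) refl _ _ _ _))

    abstract
      left? : ∀ p q r → Dec (Left p q r)
      left? p q r = positive? (orient p q r)

    CrossP : Point → Point → Point → Point → Set
    CrossP u v s t = ((Left u v s × Left v u t) ⊎ (Left v u s × Left u v t)) × ((Left s t u × Left t s v) ⊎ (Left t s u × Left s t v))

    InTriP : Point → Point → Point → Point → Set
    InTriP a b c p = (Left a b p × Left b c p × Left c a p) ⊎ (Left b a p × Left c b p × Left a c p)

    ∑-cong : ∀ k {f g : Fin k → R} → (∀ i → f i ≡ g i) → ∑ k f ≡ ∑ k g
    ∑-cong zero e = refl
    ∑-cong (suc k) e = cong₂ _+_ (e zero) (∑-cong k (λ i → e (suc i)))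

    ∑-+ : ∀ k (f g : Fin k → R) → ∑ k (λ i → f i + g i) ≡ ∑ k f + ∑ k g
    ∑-+ zero f g = sym (+-identity 0#)
    ∑-+ (suc k) f g = trans (cong (f zero + g zero +_) (∑-+ k _ _))
      (solve 4 (λ a b c d → (a :+ b) :+ (c :+ d) := (a :+ c) :+ (b :+ d)) refl _ _ _ _)

    ∑-* : ∀ k a (f : Fin k → R) → ∑ k (λ i → a * f i) ≡ a * ∑ k f
    ∑-* zero a f = sym (zeroʳ a)
    ∑-* (suc k) a f = trans (cong (a * f zero +_) (∑-* k a _)) (sym (distrib a _ _))

    ∑-0 : ∀ k {f : Fin k → R} → (∀ i → f i ≡ 0#) → ∑ k f ≡ 0#
    ∑-0 zero e = refl
    ∑-0 (suc k) e = trans (cong₂ _+_ (e zero) (∑-0 k (λ i → e (suc i)))) (+-identity 0#)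

    ∑-nonneg : ∀ k {f : Fin k → R} → (∀ i → 0# ≤ f i) → 0# ≤ ∑ k f
    ∑-nonneg zero n = inj₂ refl
    ∑-nonneg (suc k) n = nonneg-+ (n zero) (∑-nonneg k (λ i → n (suc i)))

    -- The sign of `g` is asked for only where the weight is positive: in the applications the
    -- corners on the other side of a line have weight zero and `g` of the wrong sign.
    ∑-weighted : ∀ k (w g : Fin k → R) → (∀ i → 0# ≤ w i) → (∀ i → 0# < w i → 0# < g i) → 0# < ∑ k w → 0# < ∑ k (λ i → w i * g i)
    ∑-weighted zero w g _ _ p = p
    ∑-weighted (suc k) w g nn pos p with nn zero
    ... | inj₁ q = positive-nonneg (*-pos q (pos zero q)) (∑-nonneg k (λ i → term i))
      where
      term : ∀ i → 0# ≤ w (suc i) * g (suc i)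
      term i with nn (suc i)
      ... | inj₁ r = inj₁ (*-pos r (pos (suc i) r))
      ... | inj₂ e = inj₂ (trans (sym (zeroˡ (g (suc i)))) (cong (_* g (suc i)) e))
    ... | inj₂ e = subst (0# <_) (sym (trans (cong (λ z → z * g zero + rest) (sym e)) (trans (cong (_+ rest) (zeroˡ (g zero))) (+-identity rest))))
                     (∑-weighted k (λ i → w (suc i)) (λ i → g (suc i)) (λ i → nn (suc i)) (λ i → pos (suc i))
                       (subst (0# <_) (trans (cong (_+ ∑ k (λ i → w (suc i))) (sym e)) (+-identity _)) p))
      where
      rest : R
      rest = ∑ k (λ i → w (suc i) * g (suc i))

    ∑-affine : ∀ k (w x y : Fin k → R) α β γ →
      ∑ k (λ i → w i * ((α * x i + β * y i) + γ)) ≡ (α * ∑ k (λ i → w i * x i) + β * ∑ k (λ i → w i * y i)) + γ * ∑ k w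
    ∑-affine k w x y α β γ = begin
      ∑ k (λ i → w i * ((α * x i + β * y i) + γ))
        ≡⟨ ∑-cong k (λ i → solve 6 (λ w x y α β γ → w :* ((α :* x :+ β :* y) :+ γ) := (α :* (w :* x) :+ β :* (w :* y)) :+ γ :* w) refl (w i) (x i) (y i) α β γ) ⟩
      ∑ k (λ i → (α * (w i * x i) + β * (w i * y i)) + γ * w i)
        ≡⟨ trans (∑-+ k _ _) (cong₂ _+_ (trans (∑-+ k _ _) (cong₂ _+_ (∑-* k α _) (∑-* k β _))) (∑-* k γ w)) ⟩
      (α * ∑ k (λ i → w i * x i) + β * ∑ k (λ i → w i * y i)) + γ * ∑ k w ∎
      where open ≡-Reasoning

    δ : ∀ {k} → Fin k → R → Fin k → R
    δ zero a zero = a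
    δ zero a (suc j) = 0#
    δ (suc i) a zero = 0#
    δ (suc i) a (suc j) = δ i a j

    δ-nonneg : ∀ {k} (i : Fin k) {a} → 0# ≤ a → ∀ j → 0# ≤ δ i a j
    δ-nonneg zero p zero = p
    δ-nonneg zero p (suc j) = inj₂ refl
    δ-nonneg (suc i) p zero = inj₂ refl
    δ-nonneg (suc i) p (suc j) = δ-nonneg i p j

    ∑-δ : ∀ {k} (i : Fin k) a (f : Fin k → R) → ∑ k (λ j → δ i a j * f j) ≡ a * f i
    ∑-δ {suc k} zero a f = trans (cong (a * f zero +_) (∑-0 k (λ j → zeroˡ _))) (trans (+-comm _ _) (+-identity _))
    ∑-δ {suc k} (suc i) a f = trans (cong₂ _+_ (zeroˡ _) (∑-δ i a (λ j → f (suc j)))) (+-identity _)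

    ∑-δ₁ : ∀ {k} (i : Fin k) a → ∑ k (δ i a) ≡ a
    ∑-δ₁ {suc k} zero a = trans (cong (a +_) (∑-0 k (λ j → refl))) (trans (+-comm _ _) (+-identity _))
    ∑-δ₁ {suc k} (suc i) a = trans (+-identity _) (∑-δ₁ i a)

    minus-back : ∀ o t → (o - t) + t ≡ o
    minus-back = solve 2 (λ o t → (o :- t) :+ t := o) refl

    private
      rearrange : ∀ c d e → c + (- d) ≡ (((- d) + c) + e) + (- e)
      rearrange = solve 3 (λ c d e → c :+ (:- d) := (((:- d) :+ c) :+ e) :+ (:- e)) refl
      factor-z : ∀ z g e → (z * (g + (- e))) - (z * (- e)) ≡ z * g
      factor-z = solve 3 (λ z g e → (z :* (g :+ (:- e))) :- (z :* (:- e)) := z :* g) refl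
      blend : ∀ w z g a e c → w * ((z * g) * a + (z * (- e)) * c) ≡ (w * z) * ((g + (- e)) * a + (- e) * (c - a))
      blend = solve 6 (λ w z g a e c → w :* ((z :* g) :* a :+ (z :* (:- e)) :* c) := (w :* z) :* ((g :+ (:- e)) :* a :+ (:- e) :* (c :- a))) refl
      recentre : ∀ d c a e g → (c + (- d)) * a + ((- d) * (e - a) + c * (g - a)) ≡ (- d) * e + c * g
      recentre = solve 5 (λ d c a e g → (c :+ (:- d)) :* a :+ ((:- d) :* (e :- a) :+ c :* (g :- a)) := (:- d) :* e :+ c :* g) refl
      -- Cramer's rule: the linear relation between three plane vectors whose coefficients are their
      -- determinants, here for the vectors from `u` to `v`, `s` and `t`.
      key-x : ∀ p q r k m n → (- ((p * n) - (q * m))) * r + ((p * k) - (q * r)) * m ≡ (- ((r * n) - (k * m))) * p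
      key-x = solve 6 (λ p q r k m n → (:- ((p :* n) :- (q :* m))) :* r :+ ((p :* k) :- (q :* r)) :* m := (:- ((r :* n) :- (k :* m))) :* p) refl
      key-y : ∀ p q r k m n → (- ((p * n) - (q * m))) * k + ((p * k) - (q * r)) * n ≡ (- ((r * n) - (k * m))) * q
      key-y = solve 6 (λ p q r k m n → (:- ((p :* n) :- (q :* m))) :* k :+ ((p :* k) :- (q :* r)) :* n := (:- ((r :* n) :- (k :* m))) :* q) refl

    -- Both sides are the cross product of the diagonal vectors `v - u` and `s - t`.
    four-areas : ∀ u v s t → orient u v s + (- orient u v t) ≡ orient s t v + (- orient s t u)
    four-areas u v s t = trans (rearrange (orient u v s) (orient u v t) (orient s t u)) (cong (_+ (- orient s t u)) (sym split))
      where
      split : orient s t v ≡ ((- orient u v t) + orient u v s) + orient s t u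
      split = trans (orient-split s t v u) (cong (_+ orient s t u) (cong₂ _+_
                (trans (orient-swap t u v) (cong (λ z → - z) (sym (orient-rotate t u v))))
                (sym (orient-rotate s u v))))

    -- Where the segment from u to v meets a chord from s to t, as a combination of either pair.
    module Lever {u v s t : Point} (us : Left u v s) (ut : Left v u t) (tu : Left t s u) (sv : Left s t v) where
      C D E G W : R
      C = orient u v s
      D = orient u v t
      E = orient s t u
      G = orient s t v
      W = C + (- D)
      -D>0 : 0# < - D
      -D>0 = left-swap ut
      W>0 : 0# < W
      W>0 = positive-+ us -D>0
      z : R
      z = proj₁ (recip W>0)
      z>0 : 0# < z
      z>0 = proj₁ (proj₂ (recip W>0))
      Wz : W * z ≡ 1#
      Wz = proj₂ (proj₂ (recip W>0))
      -- The parameter of the crossing point is the distance of `u` from the chord, relative to the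
      -- sum of the distances of `u` and `v`.
      T : R
      T = z * (- E)
      T≥0 : 0# ≤ T
      T≥0 = nonneg-* (inj₁ z>0) (inj₁ (left-swap tu))
      W≡G-E : W ≡ G + (- E)
      W≡G-E = four-areas u v s t
      1-T : 1# - T ≡ z * G
      1-T = trans (cong (λ o → o - T) (sym (trans (*-comm z W) Wz)))
              (trans (cong (λ W → z * W - T) W≡G-E) (factor-z z G E))
      T≤1 : T ≤ 1#
      T≤1 = inj₁ (subst₂ _<_ (+-identity T) (trans (cong (_+ T) (sym 1-T)) (minus-back 1# T)) (+-mono-< T (*-pos z>0 sv)))
      coordinate : ∀ a c e g → (- D) * (e - a) + C * (g - a) ≡ (- orient u s t) * (c - a) →
                   W * ((1# - T) * a + T * c) ≡ (- D) * e + C * g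
      coordinate a c e g h = begin
        W * ((1# - T) * a + T * c)                          ≡⟨ cong (λ o → W * (o * a + T * c)) 1-T ⟩
        W * ((z * G) * a + (z * (- E)) * c)                 ≡⟨ blend W z G a E c ⟩
        (W * z) * ((G + (- E)) * a + (- E) * (c - a))       ≡⟨ cong₂ _*_ Wz (cong₂ _+_ (cong (_* a) (sym W≡G-E))
                                                                 (trans (cong (λ o → (- o) * (c - a)) (orient-rotate u s t)) (sym h))) ⟩
        1# * (W * a + ((- D) * (e - a) + C * (g - a)))      ≡⟨ *-identity _ ⟩
        W * a + ((- D) * (e - a) + C * (g - a))             ≡⟨ recentre D C a e g ⟩
        (- D) * e + C * g                                   ∎
        where open ≡-Reasoning
      along-x : W * ((1# - T) * px u + T * px v) ≡ (- D) * px s + C * px t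
      along-x = coordinate (px u) (px v) (px s) (px t) (key-x (px v - px u) (py v - py u) (px s - px u) (py s - py u) (px t - px u) (py t - py u))
      along-y : W * ((1# - T) * py u + T * py v) ≡ (- D) * py s + C * py t
      along-y = coordinate (py u) (py v) (py s) (py t) (key-y (px v - px u) (py v - py u) (px s - px u) (py s - py u) (px t - px u) (py t - py u))

    module Hull (K : ConvexPolygon) where
      open ConvexPolygon K
      N : ℕ
      N = suc (suc (suc m))

      X Y : Fin N → R
      X i = px (vert i)
      Y i = py (vert i)

      -- Nonnegative combinations of the corners, not normalised.
      Comb : R → R → R → Set
      Comb W x y = ∃[ w ] ((∀ i → 0# ≤ w i) × ∑ N w ≡ W × ∑ N (λ i → w i * X i) ≡ x × ∑ N (λ i → w i * Y i) ≡ y)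

      corner : ∀ i {a} → 0# ≤ a → Comb a (a * px (vert i)) (a * py (vert i))
      corner i {a} p = δ i a , δ-nonneg i p , ∑-δ₁ i a , ∑-δ i a X , ∑-δ i a Y

      comb-+ : ∀ {W x y W' x' y'} → Comb W x y → Comb W' x' y' → Comb (W + W') (x + x') (y + y')
      comb-+ (w , p , refl , refl , refl) (w' , p' , refl , refl , refl) =
        (λ i → w i + w' i) , (λ i → nonneg-+ (p i) (p' i)) , ∑-+ N w w'
        , sums X , sums Y
        where
        dist : ∀ a b c → (a + b) * c ≡ a * c + b * c
        dist = solve 3 (λ a b c → (a :+ b) :* c := a :* c :+ b :* c) refl
        sums : ∀ f → ∑ N (λ i → (w i + w' i) * f i) ≡ ∑ N (λ i → w i * f i) + ∑ N (λ i → w' i * f i)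
        sums f = trans (∑-cong N (λ i → dist (w i) (w' i) (f i))) (∑-+ N (λ i → w i * f i) (λ i → w' i * f i))

      normalise : ∀ {W q} → 0# < W → Comb W (W * px q) (W * py q) → InPolygon K q
      normalise {W} {q} pos (w , p , e , ex , ey) with recip pos
      ... | z , z>0 , Wz = (λ i → z * w i) , (λ i → nonneg-* (inj₁ z>0) (p i))
        , trans (∑-* N z w) (trans (cong (z *_) e) (trans (*-comm z W) Wz))
        , scaled X ex , scaled Y ey
        where
        scaled : ∀ (f : Fin N → R) {x} → ∑ N (λ i → w i * f i) ≡ W * x → ∑ N (λ i → (z * w i) * f i) ≡ x
        scaled f {x} e = trans (∑-cong N (λ i → *-assoc z (w i) (f i))) (trans (∑-* N z (λ i → w i * f i)) (trans (cong (z *_) e)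
          (trans (sym (*-assoc z W x)) (trans (cong (_* x) (trans (*-comm z W) Wz)) (*-identity x)))))

      chord-point : ∀ {u v} s t → Left u v (vert s) → Left v u (vert t) → Left (vert t) (vert s) u → Left (vert s) (vert t) v → SegmentMeets u v K
      chord-point {u} {v} s t us ut tu sv = T , T≥0 , T≤1 , normalise W>0
        (subst₂ (Comb W) (sym along-x) (sym along-y)
          (subst (λ o → Comb o ((- D) * X s + C * X t) ((- D) * Y s + C * Y t)) (+-comm (- D) C)
            (comb-+ (corner s (inj₁ -D>0)) (corner t (inj₁ us)))))
        where open Lever us ut tu sv

-- Meeting a convex polygon and crossing one of its chords.

module Hulls where

  open import Data.Nat using (zero; suc)
  open import Data.Fin using (Fin; zero; suc)
  open import Data.Fin.Properties using (any?)
  open import Data.Product using (∃-syntax; _×_; _,_; proj₁; proj₂)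
  open import Data.Sum using (_⊎_; inj₁; inj₂)
  open import Data.Empty using (⊥; ⊥-elim)
  open import Relation.Nullary using (¬_; Dec; yes; no)
  open import Relation.Nullary.Decidable using (_×-dec_)
  open import Relation.Binary.PropositionalEquality hiding ([_])
  open Fields
  open Planes

  module Hull (F : CompleteOrderedField) where
    open CompleteOrderedField F
    open Geometry F
    open OrderedField F
    open Planes.Plane F

    private
      barycentre-x : ∀ a b c d e f → ((c * f) - (d * e)) * a + (((e * b) - (f * a)) * c + ((a * d) - (b * c)) * e) ≡ 0#
      barycentre-x a b c d e f = trans (solve 6 (λ a b c d e f → ((c :* f) :- (d :* e)) :* a :+ (((e :* b) :- (f :* a)) :* c :+ ((a :* d) :- (b :* c)) :* e) := a :- a) refl a b c d e f) (+-inverse a)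
      barycentre-y : ∀ a b c d e f → ((c * f) - (d * e)) * b + (((e * b) - (f * a)) * d + ((a * d) - (b * c)) * f) ≡ 0#
      barycentre-y a b c d e f = trans (solve 6 (λ a b c d e f → ((c :* f) :- (d :* e)) :* b :+ (((e :* b) :- (f :* a)) :* d :+ ((a :* d) :- (b :* c)) :* f) := a :- a) refl a b c d e f) (+-inverse a)
      weigh : ∀ α β γ s t r p → (α * (s - p) + (β * (t - p) + γ * (r - p))) + (α + (β + γ)) * p ≡ α * s + (β * t + γ * r)
      weigh = solve 7 (λ α β γ s t r p → (α :* (s :- p) :+ (β :* (t :- p) :+ γ :* (r :- p))) :+ (α :+ (β :+ γ)) :* p := α :* s :+ (β :* t :+ γ :* r)) refl

    module Triangle {p s t r : Point} where
      α β γ W : R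
      α = orient p t r
      β = orient p r s
      γ = orient p s t
      W = α + (β + γ)
      weigh-x : W * px p ≡ α * px s + (β * px t + γ * px r)
      weigh-x = trans (sym (trans (cong (_+ W * px p) (barycentre-x (px s - px p) (py s - py p) (px t - px p) (py t - py p) (px r - px p) (py r - py p))) (+-identity _)))
                      (weigh α β γ (px s) (px t) (px r) (px p))
      weigh-y : W * py p ≡ α * py s + (β * py t + γ * py r)
      weigh-y = trans (sym (trans (cong (_+ W * py p) (barycentre-y (px s - px p) (py s - py p) (px t - px p) (py t - py p) (px r - px p) (py r - py p))) (+-identity _)))
                      (weigh α β γ (py s) (py t) (py r) (py p))

    part : ∀ {A : Set} → Dec A → R → R
    part (yes _) w = w
    part (no _) w = 0#

    part-nonneg : ∀ {A : Set} (d : Dec A) {w} → 0# ≤ w → 0# ≤ part d w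
    part-nonneg (yes _) p = p
    part-nonneg (no _) p = inj₂ refl

    part-true : ∀ {A : Set} (d : Dec A) {w} → 0# < part d w → A
    part-true (yes a) _ = a
    part-true (no _) p = ⊥-elim (irreflexive p)

    sum-zero : ∀ {x y} → 0# ≤ x → 0# ≤ y → x + y ≡ 0# → x ≡ 0# × y ≡ 0#
    sum-zero (inj₁ p) q e = ⊥-elim (not-zero (positive-nonneg p q) e)
    sum-zero {y = y} (inj₂ refl) q e = refl , trans (sym (+-identity y)) e

    ∑-zero : ∀ k (w : Fin k → R) → (∀ i → 0# ≤ w i) → ∑ k w ≡ 0# → ∀ i → w i ≡ 0#
    ∑-zero (suc k) w n e zero = proj₁ (sum-zero (n zero) (∑-nonneg k (λ i → n (suc i))) e)
    ∑-zero (suc k) w n e (suc i) = ∑-zero k (λ i → w (suc i)) (λ i → n (suc i)) (proj₂ (sum-zero (n zero) (∑-nonneg k (λ i → n (suc i))) e)) i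

    cross-product : R → R → R → R → R
    cross-product a b c d = (a * d) - (b * c)

    moment : ∀ k (w x y : Fin k → R) v₁ v₂ d e →
      ∑ k (λ i → w i * cross-product (x i - v₁) (y i - v₂) d e)
      ≡ cross-product (∑ k (λ i → w i * x i) - ∑ k w * v₁) (∑ k (λ i → w i * y i) - ∑ k w * v₂) d e
    moment k w x y v₁ v₂ d e =
      trans (∑-cong k (λ i → cong (w i *_) (expand (x i) (y i) v₁ v₂ d e)))
        (trans (∑-affine k w x y e (- d) ((v₂ * d) - (v₁ * e))) (collect _ _ _ v₁ v₂ d e))
      where
      expand : ∀ x y v₁ v₂ d e → cross-product (x - v₁) (y - v₂) d e ≡ (e * x + (- d) * y) + ((v₂ * d) - (v₁ * e))
      expand = solve 6 (λ x y v₁ v₂ d e → ((x :- v₁) :* e) :- ((y :- v₂) :* d) := (e :* x :+ (:- d) :* y) :+ ((v₂ :* d) :- (v₁ :* e))) refl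
      collect : ∀ X Y W v₁ v₂ d e → (e * X + (- d) * Y) + ((v₂ * d) - (v₁ * e)) * W ≡ cross-product (X - W * v₁) (Y - W * v₂) d e
      collect = solve 7 (λ X Y W v₁ v₂ d e → (e :* X :+ (:- d) :* Y) :+ ((v₂ :* d) :- (v₁ :* e)) :* W := ((X :- W :* v₁) :* e) :- ((Y :- W :* v₂) :* d)) refl

    ∑-neg : ∀ k (w g : Fin k → R) → ∑ k (λ i → w i * (- g i)) ≡ - ∑ k (λ i → w i * g i)
    ∑-neg k w g = trans (∑-cong k (λ i → trans (sym (-‿distribʳ-* (w i) (g i))) (minus-one (w i * g i))))
      (trans (∑-* k (- 1#) (λ i → w i * g i)) (sym (minus-one _)))
      where
      minus-one : ∀ a → - a ≡ (- 1#) * a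
      minus-one a = trans (cong (λ z → - z) (sym (*-identity a))) (-‿distribˡ-* 1# a)

    private
      cp-self : ∀ a b c d → cross-product a b (a + c) (b + d) ≡ cross-product a b c d
      cp-self = solve 4 (λ a b c d → (a :* (b :+ d)) :- (b :* (a :+ c)) := (a :* d) :- (b :* c)) refl
      cp-scale : ∀ r a b c d → cross-product a b (r * c) (r * d) ≡ r * cross-product a b c d
      cp-scale = solve 5 (λ r a b c d → (a :* (r :* d)) :- (b :* (r :* c)) := r :* ((a :* d) :- (b :* c))) refl
      cp-anti : ∀ a b c d → cross-product a b c d ≡ - cross-product c d a b
      cp-anti = solve 4 (λ a b c d → (a :* d) :- (b :* c) := :- ((c :* b) :- (d :* a))) refl
      cp-parallel : ∀ r a b → cross-product (r * a) (r * b) a b ≡ 0#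
      cp-parallel r a b = trans (solve 3 (λ r a b → ((r :* a) :* b) :- ((r :* b) :* a) := a :- a) refl r a b) (+-inverse a)
      shift : ∀ o t u v → ((o - t) * u + t * v) - o * v ≡ (o - t) * (u - v)
      shift = solve 4 (λ o t u v → ((o :- t) :* u :+ t :* v) :- o :* v := (o :- t) :* (u :- v)) refl
      shift′ : ∀ o t u v → ((o - t) * u + t * v) - o * u ≡ t * (v - u)
      shift′ = solve 4 (λ o t u v → ((o :- t) :* u :+ t :* v) :- o :* u := t :* (v :- u)) refl
      halves : ∀ a b s d r → (a - s * r) + (b - d * r) ≡ (a + b) - (s + d) * r
      halves = solve 5 (λ a b s d r → (a :- s :* r) :+ (b :- d :* r) := (a :+ b) :- (s :+ d) :* r) refl
      one-minus : ∀ {t} → t ≤ 1# → 0# ≤ 1# - t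
      one-minus {t} (inj₁ p) = inj₁ (subst (_< 1# - t) (+-inverse t) (+-mono-< (- t) p))
      one-minus {t} (inj₂ refl) = inj₂ (sym (+-inverse 1#))

    -- The two differences in `four-areas` would have opposite signs; this disposes of two of the
    -- four patterns in `CrossP`.
    consistent-signs : ∀ {u v s t} → Left u v s → Left v u t → Left s t u → ¬ Left t s v
    consistent-signs {u} {v} {s} {t} us ut su tv = not-both (positive-+ us (left-swap ut))
      (subst (0# <_) (trans (reverse (orient s t u) (orient s t v)) (cong (λ z → - z) (sym (four-areas u v s t)))) (positive-+ su (left-swap tv)))
      where
      reverse : ∀ e g → e + (- g) ≡ - (g + (- e))
      reverse = solve 2 (λ e g → e :+ (:- g) := :- (g :+ (:- e))) refl

    module Obstacle (K : ConvexPolygon) where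
      open ConvexPolygon K
      open Hull K public

      triangle-point : ∀ s t r {p} → Left (vert s) (vert t) p → Left (vert t) (vert r) p → Left (vert r) (vert s) p → InPolygon K p
      triangle-point s t r {p} st tr rs = normalise (positive-+ (from tr) (positive-+ (from rs) (from st)))
        (subst₂ (Comb W) (sym weigh-x) (sym weigh-y) (comb-+ (corner s (inj₁ (from tr))) (comb-+ (corner t (inj₁ (from rs))) (corner r (inj₁ (from st))))))
        where
        open Triangle {p} {vert s} {vert t} {vert r}
        from : ∀ {a b} → Left a b p → Left p a b
        from l = left-rotate (left-rotate l)

      in-triangle : ∀ s t r {p} → InTriP (vert s) (vert t) (vert r) p → InPolygon K p
      in-triangle s t r (inj₁ (a , b , c)) = triangle-point s t r a b c
      in-triangle s t r (inj₂ (a , b , c)) = triangle-point t s r a c b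

      corner-inside : ∀ i → InPolygon K (vert i)
      corner-inside i = normalise one-positive (corner i (inj₁ one-positive))

      segment-inside : ∀ i j {t} → 0# ≤ t → t ≤ 1# →
        InPolygon K ((1# - t) * px (vert i) + t * px (vert j) , (1# - t) * py (vert i) + t * py (vert j))
      segment-inside i j {t} t≥0 t≤1 = normalise one-positive
        (subst₂ (Comb 1#) (sym (*-identity _)) (sym (*-identity _))
          (subst (λ o → Comb o ((1# - t) * X i + t * X j) ((1# - t) * Y i + t * Y j)) (minus-back 1# t) (comb-+ (corner i (one-minus t≤1)) (corner j t≥0))))

      meets-swap : ∀ {u v} → SegmentMeets u v K → SegmentMeets v u K
      meets-swap {u} {v} (t , t≥0 , t≤1 , q) = 1# - t , one-minus t≤1 , below t≥0 , subst (InPolygon K) (cong₂ _,_ (turn (px u) (px v)) (turn (py u) (py v))) q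
        where
        turn : ∀ a b → (1# - t) * a + t * b ≡ (1# - (1# - t)) * b + (1# - t) * a
        turn a b = solve 4 (λ o t a b → (o :- t) :* a :+ t :* b := (o :- (o :- t)) :* b :+ (o :- t) :* a) refl 1# t a b
        below : 0# ≤ t → 1# - t ≤ 1#
        below (inj₁ p) = inj₁ (subst₂ _<_ (+-identity _) (solve 2 (λ o t → t :+ (o :- t) := o) refl 1# t) (+-mono-< (1# - t) p))
        below (inj₂ refl) = inj₂ (trans (cong (1# +_) (trans (sym (+-identity _)) (+-inverse 0#))) (trans (+-comm _ _) (+-identity _)))

      -- If every chord across the line uv passes beyond v, then splitting the weights of a common point by
      -- sides gives centroids whose cross product about v has the wrong sign.
      module _ {u v : Point} (off : ∀ i → ¬ orient u v (vert i) ≡ 0#)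
        (beyond : ∀ i j → Left u v (vert i) → Left v u (vert j) → Left (vert j) (vert i) v) where
        beyond-misses : ¬ SegmentMeets u v K
        beyond-misses (t , t≥0 , t≤1 , w , w≥0 , ∑w , ∑x , ∑y) = contradiction
          where
          l? : ∀ i → Dec (Left u v (vert i))
          l? i = left? u v (vert i)
          r? : ∀ i → Dec (Left v u (vert i))
          r? i = left? v u (vert i)
          w⁺ w⁻ : Fin N → R
          w⁺ i = part (l? i) (w i)
          w⁻ i = part (r? i) (w i)
          parts : ∀ i → w⁺ i + w⁻ i ≡ w i
          parts i with l? i | r? i
          ... | yes a | yes b = ⊥-elim (left-asym a b)
          ... | yes a | no _ = trans (+-comm _ _) (+-identity _)
          ... | no _ | yes b = +-identity _
          ... | no a | no b with sign (orient u v (vert i))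
          ...   | inj₁ p = ⊥-elim (a p)
          ...   | inj₂ (inj₁ e) = ⊥-elim (off i e)
          ...   | inj₂ (inj₂ p) = ⊥-elim (b (swap-left p))
          sums : ∀ (f : Fin N → R) → ∑ N (λ i → w⁺ i * f i) + ∑ N (λ i → w⁻ i * f i) ≡ ∑ N (λ i → w i * f i)
          sums f = trans (sym (∑-+ N (λ i → w⁺ i * f i) (λ i → w⁻ i * f i)))
            (∑-cong N (λ i → trans (sym (solve 3 (λ a b c → (a :+ b) :* c := a :* c :+ b :* c) refl (w⁺ i) (w⁻ i) (f i))) (cong (_* f i) (parts i))))
          S⁺ S⁻ X⁺ X⁻ Y⁺ Y⁻ : R
          S⁺ = ∑ N w⁺
          S⁻ = ∑ N w⁻
          X⁺ = ∑ N (λ i → w⁺ i * X i)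
          X⁻ = ∑ N (λ i → w⁻ i * X i)
          Y⁺ = ∑ N (λ i → w⁺ i * Y i)
          Y⁻ = ∑ N (λ i → w⁻ i * Y i)
          S : S⁺ + S⁻ ≡ 1#
          S = trans (sym (∑-+ N w⁺ w⁻)) (trans (∑-cong N parts) ∑w)
          w⁺≥0 : ∀ i → 0# ≤ w⁺ i
          w⁺≥0 i = part-nonneg (l? i) (w≥0 i)
          w⁻≥0 : ∀ i → 0# ≤ w⁻ i
          w⁻≥0 i = part-nonneg (r? i) (w≥0 i)
          f : Fin N → R
          f i = orient u v (vert i)
          -- The common point lies on the line `uv`, so its orientation, the weighted mean of those
          -- of the corners, vanishes.
          ∑wf : ∑ N (λ i → w i * f i) ≡ 0#
          ∑wf = begin
            ∑ N (λ i → w i * f i)            ≡⟨ ∑-cong N (λ i → cong (w i *_) (cp-anti (px v - px u) (py v - py u) (X i - px u) (Y i - py u))) ⟩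
            ∑ N (λ i → w i * (- g i))        ≡⟨ ∑-neg N w g ⟩
            - ∑ N (λ i → w i * g i)          ≡⟨ cong (λ z → - z) (moment N w X Y (px u) (py u) (px v - px u) (py v - py u)) ⟩
            - cross-product (∑ N (λ i → w i * X i) - ∑ N w * px u) (∑ N (λ i → w i * Y i) - ∑ N w * py u) (px v - px u) (py v - py u)
              ≡⟨ cong (λ z → - z) (cong₂ (λ a b → cross-product a b (px v - px u) (py v - py u))
                   (trans (cong₂ (λ a b → a - b * px u) ∑x ∑w) (shift′ 1# t (px u) (px v)))
                   (trans (cong₂ (λ a b → a - b * py u) ∑y ∑w) (shift′ 1# t (py u) (py v)))) ⟩
            - cross-product (t * (px v - px u)) (t * (py v - py u)) (px v - px u) (py v - py u)
              ≡⟨ cong (λ z → - z) (cp-parallel t (px v - px u) (py v - py u)) ⟩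
            - 0#                             ≡⟨ trans (sym (+-identity (- 0#))) (+-inverse 0#) ⟩
            0#                               ∎
            where
            open ≡-Reasoning
            g : Fin N → R
            g i = cross-product (X i - px u) (Y i - py u) (px v - px u) (py v - py u)
          ∑⁻ : 0# < S⁻ → 0# < ∑ N (λ i → w⁻ i * (- f i))
          ∑⁻ = ∑-weighted N w⁻ (λ i → - f i) w⁻≥0 (λ i p → left-swap (part-true (r? i) p))
          ∑⁺ : 0# < S⁺ → 0# < ∑ N (λ i → w⁺ i * f i)
          ∑⁺ = ∑-weighted N w⁺ f w⁺≥0 (λ i p → part-true (l? i) p)
          neg-sum : ∑ N (λ i → w⁻ i * (- f i)) ≡ - ∑ N (λ i → w⁻ i * f i)
          neg-sum = ∑-neg N w⁻ f
          balance : ∑ N (λ i → w⁺ i * f i) ≡ ∑ N (λ i → w⁻ i * (- f i))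
          balance = trans (trans (solve 2 (λ a b → a := (a :+ b) :+ (:- b)) refl _ _) (trans (cong (_+ (- ∑ N (λ i → w⁻ i * f i))) (trans (sums f) ∑wf)) (+-identity _))) (sym neg-sum)
          vanish : ∀ (h g : Fin N → R) → (∀ i → 0# ≤ h i) → ∑ N h ≡ 0# → ∑ N (λ i → h i * g i) ≡ 0#
          vanish h g n e = ∑-0 N (λ i → trans (cong (_* g i) (∑-zero N h n e i)) (zeroˡ (g i)))
          S⁺>0 : 0# < S⁺
          S⁺>0 with ∑-nonneg N w⁺≥0
          ... | inj₁ p = p
          ... | inj₂ e = ⊥-elim (not-zero (∑⁻ (subst (0# <_) (trans (sym S) (trans (cong (_+ S⁻) (sym e)) (+-identity S⁻))) one-positive))
                           (trans (sym balance) (vanish w⁺ f w⁺≥0 (sym e))))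
          S⁻>0 : 0# < S⁻
          S⁻>0 with ∑-nonneg N w⁻≥0
          ... | inj₁ p = p
          ... | inj₂ e = ⊥-elim (not-zero (∑⁺ S⁺>0) (trans balance (vanish w⁻ (λ i → - f i) w⁻≥0 (sym e))))
          a⁺ b⁺ a⁻ b⁻ : R
          a⁺ = X⁺ - S⁺ * px v
          b⁺ = Y⁺ - S⁺ * py v
          a⁻ = X⁻ - S⁻ * px v
          b⁻ = Y⁻ - S⁻ * py v
          inner : ∀ j → Left v u (vert j) → 0# < cross-product (X j - px v) (Y j - py v) a⁺ b⁺
          inner j l = subst (0# <_) (trans (∑-cong N (λ i → cong (w⁺ i *_) (orient-as-cp i))) (trans swap-sum (sym (cp-anti _ _ _ _))))
                        (∑-weighted N w⁺ (λ i → orient v (vert j) (vert i)) w⁺≥0 (λ i p → left-rotate (left-rotate (beyond i j (part-true (l? i) p) l))) S⁺>0)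
            where
            h : Fin N → R
            h i = cross-product (X i - px v) (Y i - py v) (X j - px v) (Y j - py v)
            orient-as-cp : ∀ i → orient v (vert j) (vert i) ≡ - h i
            orient-as-cp i = cp-anti (X j - px v) (Y j - py v) (X i - px v) (Y i - py v)
            swap-sum : ∑ N (λ i → w⁺ i * (- h i)) ≡ - cross-product a⁺ b⁺ (X j - px v) (Y j - py v)
            swap-sum = trans (∑-neg N w⁺ h) (cong (λ z → - z) (moment N w⁺ X Y (px v) (py v) (X j - px v) (Y j - py v)))
          outer : 0# < cross-product a⁻ b⁻ a⁺ b⁺
          outer = subst (0# <_) (moment N w⁻ X Y (px v) (py v) a⁺ b⁺)
                    (∑-weighted N w⁻ (λ j → cross-product (X j - px v) (Y j - py v) a⁺ b⁺) w⁻≥0 (λ j p → inner j (part-true (r? j) p)) S⁻>0)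
          wrong : 0# < - cross-product a⁻ b⁻ (px u - px v) (py u - py v)
          wrong = subst (0# <_) (trans neg-sum (cong (λ z → - z) (trans (∑-cong N (λ i → cong (w⁻ i *_) (sym (orient-rotate′ i)))) (moment N w⁻ X Y (px v) (py v) (px u - px v) (py u - py v))))) (∑⁻ S⁻>0)
            where
            orient-rotate′ : ∀ i → cross-product (X i - px v) (Y i - py v) (px u - px v) (py u - py v) ≡ f i
            orient-rotate′ i = orient-rotate u v (vert i)
          -- The moments of the two sides about `v` add up to `1 - t` times the vector from `v` to
          -- `u`.
          total : cross-product a⁻ b⁻ a⁺ b⁺ ≡ (1# - t) * cross-product a⁻ b⁻ (px u - px v) (py u - py v)
          total = trans (sym (cp-self a⁻ b⁻ a⁺ b⁺)) (trans (cong₂ (cross-product a⁻ b⁻)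
                    (join X⁻ X⁺ (px u) (px v) (trans (+-comm X⁻ X⁺) (trans (sums X) ∑x)))
                    (join Y⁻ Y⁺ (py u) (py v) (trans (+-comm Y⁻ Y⁺) (trans (sums Y) ∑y))))
                    (cp-scale (1# - t) a⁻ b⁻ (px u - px v) (py u - py v)))
            where
            join : ∀ A B p q → A + B ≡ (1# - t) * p + t * q → (A - S⁻ * q) + (B - S⁺ * q) ≡ (1# - t) * (p - q)
            join A B p q e = trans (halves A B S⁻ S⁺ q) (trans (cong₂ (λ a b → a - b * q) e (trans (+-comm S⁻ S⁺) S)) (shift 1# t p q))
          contradiction : ⊥
          contradiction = nonneg-not-neg (nonneg-* (one-minus t≤1) (inj₁ wrong))
            (subst (0# <_) (trans total (solve 2 (λ a b → a :* b := :- (a :* (:- b))) refl (1# - t) _)) outer)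

      module _ {u v : Point}
        (off : ∀ i → ¬ orient u v (vert i) ≡ 0#)
        (off-u : ∀ i j → ¬ i ≡ j → ¬ orient (vert i) (vert j) u ≡ 0#)
        (off-v : ∀ i j → ¬ i ≡ j → ¬ orient (vert i) (vert j) v ≡ 0#)
        (v∉K : ¬ InPolygon K v) where

        private
          either : ∀ p q r → ¬ orient p q r ≡ 0# → Left p q r ⊎ Left q p r
          either p q r n with sign (orient p q r)
          ... | inj₁ l = inj₁ l
          ... | inj₂ (inj₁ e) = ⊥-elim (n e)
          ... | inj₂ (inj₂ l) = inj₂ (swap-left l)

          about-v : ∀ {a b} → Left a b v → Left v a b
          about-v l = left-rotate (left-rotate l)

          sides-differ : ∀ {i j} → Left u v (vert i) → Left v u (vert j) → ¬ i ≡ j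
          sides-differ l r refl = left-asym l r

          -- Two chords from corner `i` that pass `v` on different sides enclose it in a triangle of
          -- corners, unless `j` and `j'` come in the other order, which the position of `u`
          -- excludes.
          same-i : ∀ i j j' → Left u v (vert i) → Left v u (vert j) → Left v u (vert j') →
            Left (vert j) (vert i) v → ¬ Left (vert i) (vert j') v
          same-i i j j' ui uj uj' ji ij' with either (vert j') (vert j) v (off-v j' j λ { refl → left-asym ji ij' })
          ... | inj₁ l = v∉K (triangle-point i j' j ij' l ji)
          ... | inj₂ l = left-asym (left-sink uj' (about-v l) (about-v ij') uj (about-v ji)) ui

          same-j : ∀ i i' j → Left u v (vert i) → Left u v (vert i') → Left v u (vert j) →
            Left (vert j) (vert i) v → ¬ Left (vert i') (vert j) v
          same-j i i' j ui ui' uj ji i'j with either (vert i) (vert i') v (off-v i i' λ { refl → left-asym ji i'j })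
          ... | inj₁ l = v∉K (triangle-point j i i' ji l i'j)
          ... | inj₂ l = left-asym (left-source (left-rotate ui') (about-v i'j) (about-v l) uj (about-v ji)) ui

          Beyond? : Dec (∃[ i ] ∃[ j ] (Left u v (vert i) × Left v u (vert j) × Left (vert j) (vert i) v))
          Beyond? = any? λ i → any? λ j → left? u v (vert i) ×-dec left? v u (vert j) ×-dec left? (vert j) (vert i) v

        -- If no chord crosses the segment, each chord across the line `uv` passes beyond one end.
        -- Exchanging one corner at a time shows that all pass the same end, and `beyond-misses`
        -- applies, with the ends swapped if necessary.
        chord-crosses : SegmentMeets u v K → ¬ (∀ i j → ¬ CrossP u v (vert i) (vert j))
        chord-crosses meets none with Beyond?
        ... | yes (i₀ , j₀ , ui₀ , uj₀ , h) = beyond-misses off beyond meets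
          where
          beyond : ∀ i j → Left u v (vert i) → Left v u (vert j) → Left (vert j) (vert i) v
          beyond i j ui uj with either (vert j) (vert i) v (off-v j i λ { refl → left-asym ui uj })
          ... | inj₁ l = l
          ... | inj₂ l with either (vert j) (vert i₀) v (off-v j i₀ λ { refl → left-asym ui₀ uj })
          ...   | inj₁ l' = ⊥-elim (same-j i₀ i j ui₀ ui uj l' l)
          ...   | inj₂ l' = ⊥-elim (same-i i₀ j₀ j ui₀ uj₀ uj h l')
        ... | no ¬h = beyond-misses off′ beyond (meets-swap meets)
          where
          off′ : ∀ i → ¬ orient v u (vert i) ≡ 0#
          off′ i e = off i (trans (sym (-‿involutive _)) (trans (cong (λ z → - z) (trans (sym (orient-swap u v (vert i))) e))
                       (trans (sym (+-identity _)) (+-inverse 0#))))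
          beyond : ∀ j i → Left v u (vert j) → Left u v (vert i) → Left (vert i) (vert j) u
          beyond j i uj ui with either (vert i) (vert j) u (off-u i j (sides-differ ui uj))
          ... | inj₁ l = l
          ... | inj₂ l with either (vert i) (vert j) v (off-v i j (sides-differ ui uj))
          ...   | inj₁ l' = ⊥-elim (none i j (inj₁ (ui , uj) , inj₂ (l , l')))
          ...   | inj₂ l' = ⊥-elim (¬h (i , j , ui , uj , l'))

      crossing-point : ∀ {u v} s t → CrossP u v (vert s) (vert t) → SegmentMeets u v K
      crossing-point s t (inj₁ (us , ut) , inj₂ (tu , sv)) = chord-point s t us ut tu sv
      crossing-point s t (inj₂ (us , ut) , inj₁ (su , tv)) = chord-point t s ut us su tv
      crossing-point s t (inj₁ (us , ut) , inj₁ (su , tv)) = ⊥-elim (consistent-signs us ut su tv)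
      crossing-point s t (inj₂ (us , ut) , inj₂ (tu , sv)) = ⊥-elim (consistent-signs ut us tu sv)

-- From a representation to a scene.

module Representations where

  open import Data.Nat using (ℕ; zero; suc) renaming (_≤_ to _≤ℕ_)
  import Data.Nat as ℕ
  import Data.Nat.Properties as ℕₚ
  open import Data.Fin using (Fin; zero; suc; toℕ; fromℕ<)
  open import Data.Fin.Properties using (any?; toℕ-injective; toℕ<n; toℕ-fromℕ<)
  open import Data.Product using (Σ; ∃-syntax; _×_; _,_; proj₁; proj₂)
  open import Data.Sum using (_⊎_; inj₁; inj₂)
  open import Data.Empty using (⊥-elim)
  open import Relation.Nullary using (¬_; Dec)
  open import Relation.Nullary.Decidable using (_×-dec_; _⊎-dec_; map′)
  open import Relation.Binary.PropositionalEquality hiding ([_])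
  open OrderTypes using (OrderType)
  open Obstacles using (Scene; module Visibility)
  open Fields
  open Planes
  open Hulls

  module Represented (F : CompleteOrderedField) {n h : ℕ} {G : Graph n} (h≤3 : h ≤ℕ 3)
    (rep : Geometry.DisjointConvexObstacleRep F G h) where
    open CompleteOrderedField F
    open Geometry F
    open OrderedField F
    open Planes.Plane F
    open Hulls.Hull F
    open DisjointConvexObstacleRep rep

    -- Label `P` stands for the obstacle with the same number; if there are too few obstacles, the
    -- type is empty.
    Corner : Fin 3 → Set
    Corner P = Σ (Fin h) λ k → toℕ k ≡ toℕ P × Fin (suc (suc (suc (ConvexPolygon.m (obstacle k)))))

    cornerIndex : ∀ P → Corner P → Index n h obstacle
    cornerIndex P (k , _ , i) = inj₂ (k , i)

    cornerPoint : ∀ P → Corner P → Point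
    cornerPoint P s = pt pos obstacle (cornerIndex P s)

    BlocksAt : Fin 3 → Fin n → Fin n → Set
    BlocksAt P u w = ∃[ s ] ∃[ t ] CrossP (pos u) (pos w) (cornerPoint P s) (cornerPoint P t)

    abstract
      cross? : ∀ p q r s → Dec (CrossP p q r s)
      cross? p q r s = ((left? p q r ×-dec left? q p s) ⊎-dec (left? q p r ×-dec left? p q s))
                 ×-dec ((left? r s p ×-dec left? s r q) ⊎-dec (left? s r p ×-dec left? r s q))

      blocks? : ∀ P u w → Dec (BlocksAt P u w)
      blocks? P u w = map′ (λ { (k , e , i , j , c) → (k , e , i) , (k , e , j) , c }) back
        (any? λ k → (toℕ k ℕ.≟ toℕ P) ×-dec (any? λ i → any? λ j → cross? (pos u) (pos w) (ConvexPolygon.vert (obstacle k) i) (ConvexPolygon.vert (obstacle k) j)))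
        where
        back : BlocksAt P u w → ∃[ k ] (toℕ k ≡ toℕ P × ∃[ i ] ∃[ j ] CrossP (pos u) (pos w) (ConvexPolygon.vert (obstacle k) i) (ConvexPolygon.vert (obstacle k) j))
        back ((k , e , i) , (k' , e' , j) , c) with toℕ-injective (trans e (sym e'))
        ... | refl = k , e , i , j , c

    unadjacent : ∀ {u w} → ¬ u ≡ w → ¬ Adj G u w → ¬ (∀ o → ¬ SegmentMeets (pos u) (pos w) (obstacle o))
    unadjacent ne na none = na (proj₂ (represents _ _ ne) none)

    adjacent-misses : ∀ {u w} → ¬ u ≡ w → Adj G u w → ∀ P → ¬ BlocksAt P u w
    adjacent-misses ne adj P ((k , e , i) , (k' , e' , j) , c) with toℕ-injective (trans e (sym e'))
    ... | refl = proj₁ (represents _ _ ne) adj k (Obstacle.crossing-point (obstacle k) i j c)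

    -- The vertex is the point with parameter zero on its edge, and an edge meets no obstacle.
    outside-all : ∀ {u w} → ¬ u ≡ w → Adj G u w → ∀ k → ¬ InPolygon (obstacle k) (pos u)
    outside-all {u} {w} ne adj k q = proj₁ (represents u w ne) adj k
      (0# , inj₂ refl , inj₁ one-positive , subst (InPolygon (obstacle k)) (cong₂ _,_ (start (px (pos u)) (px (pos w))) (start (py (pos u)) (py (pos w)))) q)
      where
      start : ∀ a b → a ≡ (1# - 0#) * a + 0# * b
      start a b = sym (trans (cong₂ _+_ (trans (cong (_* a) (trans (cong (1# +_) (trans (sym (+-identity _)) (+-inverse 0#))) (trans (+-comm _ _) (+-identity 1#)))) (*-identity a)) (zeroˡ b))
                        (trans (+-comm _ _) (+-identity a)))

    module Restricted {V : Set} (e : V → Fin n) (injective : ∀ {u v} → e u ≡ e v → u ≡ v)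
      (neighbour : ∀ v → ∃[ u ] (¬ e v ≡ u × Adj G (e v) u)) where

      index : V ⊎ Σ (Fin 3) Corner → Index n h obstacle
      index (inj₁ v) = inj₁ (e v)
      index (inj₂ (P , s)) = cornerIndex P s

      point : V ⊎ Σ (Fin 3) Corner → Point
      point p = pt pos obstacle (index p)

      index-injective : ∀ p q → index p ≡ index q → p ≡ q
      index-injective (inj₁ u) (inj₁ v) eq with e u in eu | e v in ev
      index-injective (inj₁ u) (inj₁ v) refl | _ | _ = cong inj₁ (injective (trans eu (sym ev)))
      index-injective (inj₂ (P , k , a , i)) (inj₂ (Q , k' , b , j)) refl with toℕ-injective (trans (sym a) b)
      ... | refl = cong (λ c → inj₂ (P , k , c , i)) (ℕₚ.≡-irrelevant a b)

      orderType : OrderType (V ⊎ Σ (Fin 3) Corner)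
      orderType = record
        { Pos = λ p q r → Left (point p) (point q) (point r)
        ; rotate = left-rotate
        ; asym = left-asym
        ; interior = left-interior
        ; source = left-source
        ; sink = left-sink
        ; general = λ {p} {q} {r} pq qr pr → general p q r pq qr pr
        }
        where
        general : ∀ p q r → p ≢ q → q ≢ r → p ≢ r → Left (point p) (point q) (point r) ⊎ Left (point q) (point p) (point r)
        general p q r pq qr pr with sign (orient (point p) (point q) (point r))
        ... | inj₁ l = inj₁ l
        ... | inj₂ (inj₁ z) = ⊥-elim (noCollinear (index p) (index q) (index r)
                (λ x → pq (index-injective p q x)) (λ x → qr (index-injective q r x)) (λ x → pr (index-injective p r x)) z)
        ... | inj₂ (inj₂ l) = inj₂ (swap-left l)

      outside-corner : ∀ v k → ¬ InPolygon (obstacle k) (pos (e v))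
      outside-corner v k = outside-all (proj₁ (proj₂ (neighbour v))) (proj₂ (proj₂ (neighbour v))) k

      scene : Scene V
      scene = record
        { Corner = Corner
        ; order = orderType
        ; apart-× = λ { {P} {Q} P≢Q (k , a , i) (k₁ , a₁ , i₁) (l , b , j) (l₁ , b₁ , j₁) c → chords P≢Q a a₁ b b₁ c }
        ; apart-∈ = λ { {P} {Q} P≢Q (k , a , i) (k₁ , a₁ , i₁) (k₂ , a₂ , i₂) (l , b , j) c → corners P≢Q a a₁ a₂ b c }
        ; outside = λ { P (k , a , i) (k₁ , a₁ , i₁) (k₂ , a₂ , i₂) v c → vertices {P} a a₁ a₂ v c }
        }
        where
        vert : ∀ k → Fin (suc (suc (suc (ConvexPolygon.m (obstacle k))))) → Point
        vert k = ConvexPolygon.vert (obstacle k)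
        different : ∀ {P Q : Fin 3} → P ≢ Q → ∀ {k l : Fin h} → toℕ k ≡ toℕ P → toℕ l ≡ toℕ Q → ¬ k ≡ l
        different P≢Q a b refl = P≢Q (toℕ-injective (trans (sym a) b))
        chords : ∀ {P Q} → P ≢ Q → ∀ {k k₁ l l₁ i i₁ j j₁} → toℕ k ≡ toℕ P → toℕ k₁ ≡ toℕ P → toℕ l ≡ toℕ Q → toℕ l₁ ≡ toℕ Q →
          ¬ CrossP (vert k i) (vert k₁ i₁) (vert l j) (vert l₁ j₁)
        chords P≢Q {k} {l = l} {i = i} {i₁ = i₁} {j = j} {j₁ = j₁} a a₁ b b₁ c with toℕ-injective (trans a (sym a₁)) | toℕ-injective (trans b (sym b₁))
        -- The crossing point belongs to `l`, and to `k` because it lies on a chord of `k`.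
        ... | refl | refl with Obstacle.crossing-point (obstacle l) j j₁ c
        ...   | t , t≥0 , t≤1 , q = disjoint k l (different P≢Q a b) _ (on-chord , q)
          where
          on-chord : InPolygon (obstacle k) ((1# - t) * px (vert k i) + t * px (vert k i₁) , (1# - t) * py (vert k i) + t * py (vert k i₁))
          on-chord = Obstacle.segment-inside (obstacle k) i i₁ t≥0 t≤1
        corners : ∀ {P Q} → P ≢ Q → ∀ {k k₁ k₂ l i i₁ i₂ j} → toℕ k ≡ toℕ P → toℕ k₁ ≡ toℕ P → toℕ k₂ ≡ toℕ P → toℕ l ≡ toℕ Q →
          ¬ InTriP (vert k i) (vert k₁ i₁) (vert k₂ i₂) (vert l j)
        corners P≢Q {k} {l = l} {i = i} {i₁ = i₁} {i₂ = i₂} {j = j} a a₁ a₂ b c with toℕ-injective (trans a (sym a₁)) | toℕ-injective (trans a (sym a₂))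
        ... | refl | refl = disjoint k l (different P≢Q a b) _ (Obstacle.in-triangle (obstacle k) i i₁ i₂ c , Obstacle.corner-inside (obstacle l) j)
        vertices : ∀ {P : Fin 3} {k k₁ k₂ i i₁ i₂} → toℕ k ≡ toℕ P → toℕ k₁ ≡ toℕ P → toℕ k₂ ≡ toℕ P → ∀ v →
          ¬ InTriP (vert k i) (vert k₁ i₁) (vert k₂ i₂) (pos (e v))
        vertices {k = k} {i = i} {i₁ = i₁} {i₂ = i₂} a a₁ a₂ v c with toℕ-injective (trans a (sym a₁)) | toℕ-injective (trans a (sym a₂))
        ... | refl | refl = outside-corner v k (Obstacle.in-triangle (obstacle k) i i₁ i₂ c)

      open Visibility scene using (Blocks; Misses)

      edge-misses : ∀ u w → ¬ u ≡ w → Adj G (e u) (e w) → ∀ P → Misses P u w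
      edge-misses u w ne adj = adjacent-misses (λ x → ne (injective x)) adj

      nonedge-blocked : ∀ u w → ¬ u ≡ w → ¬ Adj G (e u) (e w) → ¬ (∀ P → ¬ Blocks P u w)
      nonedge-blocked u w ne nadj none = unadjacent (λ x → ne (injective x)) nadj λ k meets →
        Obstacle.chord-crosses (obstacle k) (off k) (off-end k u) (off-end k w) (outside-corner w k) meets
          (λ i j c → none (label k) ((k , label-eq k , i) , (k , label-eq k , j) , c))
        where
        label : Fin h → Fin 3
        label k = fromℕ< (ℕₚ.<-≤-trans (toℕ<n k) h≤3)
        label-eq : ∀ k → toℕ k ≡ toℕ (label k)
        label-eq k = sym (toℕ-fromℕ< _)
        off : ∀ k i → ¬ orient (pos (e u)) (pos (e w)) (ConvexPolygon.vert (obstacle k) i) ≡ 0#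
        off k i = noCollinear (inj₁ (e u)) (inj₁ (e w)) (inj₂ (k , i)) (λ { x → ne (injective (inj x)) }) (λ ()) (λ ())
          where
          inj : ∀ {a b : Fin n} {B : Set} → inj₁ {B = B} a ≡ inj₁ b → a ≡ b
          inj refl = refl
        off-end : ∀ k v i j → ¬ i ≡ j → ¬ orient (ConvexPolygon.vert (obstacle k) i) (ConvexPolygon.vert (obstacle k) j) (pos (e v)) ≡ 0#
        off-end k v i j i≢j = noCollinear (inj₂ (k , i)) (inj₂ (k , j)) (inj₁ (e v)) (λ { refl → i≢j refl }) (λ ()) (λ ())

-- Ramsey's theorem for several two-colourings at once.

module Ramsey where

  open import Data.Nat using (ℕ; zero; suc; _+_; _≤_; s≤s)
  import Data.Nat.Properties as ℕₚ
  open import Data.Bool using (Bool; true; false)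
  open import Data.Bool.Properties using () renaming (_≟_ to _≟ᵇ_)
  open import Data.Fin using (Fin; zero; suc; toℕ)
  open import Data.Product using (Σ; ∃-syntax; _×_; _,_)
  open import Data.Sum using (_⊎_; inj₁; inj₂)
  open import Data.List using (List; []; _∷_; length; lookup; filter; allFin)
  open import Data.List.Properties using (length-tabulate)
  open import Data.List.Relation.Unary.All as All using (All; []; _∷_)
  open import Data.List.Relation.Unary.All.Properties using (all-filter)
  open import Data.List.Relation.Unary.AllPairs using (AllPairs; []; _∷_)
  open import Data.List.Relation.Unary.Unique.Propositional.Properties using (allFin⁺)
  open import Data.List.Relation.Binary.Sublist.Propositional using (_⊆_; []; _∷_; _∷ʳ_; ⊆-trans; minimum)
  open import Data.List.Relation.Binary.Sublist.Propositional.Properties using (All-resp-⊆; filter-⊆)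
  open import Relation.Nullary using (yes; no)
  open import Relation.Binary.PropositionalEquality

  module _ {A : Set} where

    pairs-⊆ : ∀ {R : A → A → Set} {xs ys} → xs ⊆ ys → AllPairs R ys → AllPairs R xs
    pairs-⊆ [] [] = []
    pairs-⊆ (_ ∷ʳ τ) (_ ∷ ps) = pairs-⊆ τ ps
    pairs-⊆ (refl ∷ τ) (p ∷ ps) = All-resp-⊆ τ p ∷ pairs-⊆ τ ps

    lookup-all : ∀ {P : A → Set} {xs} → All P xs → ∀ i → P (lookup xs i)
    lookup-all (p ∷ _) zero = p
    lookup-all (_ ∷ ps) (suc i) = lookup-all ps i

    lookup-pairs : ∀ {R : A → A → Set} {xs} → AllPairs R xs → ∀ {i j} → suc (toℕ i) ≤ toℕ j → R (lookup xs i) (lookup xs j)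
    lookup-pairs (p ∷ _) {zero} {suc j} _ = lookup-all p j
    lookup-pairs (_ ∷ ps) {suc i} {suc j} (s≤s l) = lookup-pairs ps l

    matching : (p : A → Bool) (β : Bool) → List A → List A
    matching p β = filter (λ x → p x ≟ᵇ β)

    matching-length : ∀ p xs → length (matching p true xs) + length (matching p false xs) ≡ length xs
    matching-length p [] = refl
    matching-length p (x ∷ xs) with p x
    ... | true = cong suc (matching-length p xs)
    ... | false = trans (ℕₚ.+-suc _ _) (cong suc (matching-length p xs))

    Homogeneous : (A → A → Bool) → Bool → List A → ℕ → Set
    Homogeneous χ β xs m = ∃[ ys ] (ys ⊆ xs × length ys ≡ m × AllPairs (λ x y → χ x y ≡ β) ys)

  -- The first element splits the others by colour, and one of the two parts is large enough for the
  -- induction.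
  bound : ℕ → ℕ → ℕ
  bound zero n = zero
  bound (suc m) zero = zero
  bound (suc m) (suc n) = suc (bound m (suc n) + bound (suc m) n)

  large-part : ∀ a b {p q} → a + b ≤ p + q → a ≤ p ⊎ b ≤ q
  large-part a b {p} {q} le with a ℕₚ.≤? p
  ... | yes a≤p = inj₁ a≤p
  ... | no a≰p = inj₂ (ℕₚ.+-cancelˡ-≤ p b q (ℕₚ.≤-trans (ℕₚ.+-monoˡ-≤ b (ℕₚ.<⇒≤ (ℕₚ.≰⇒> a≰p))) le))

  module _ {A : Set} where
    ramsey₂ : ∀ m n (χ : A → A → Bool) xs → bound m n ≤ length xs → Homogeneous χ true xs m ⊎ Homogeneous χ false xs n
    ramsey₂ zero n χ xs _ = inj₁ ([] , minimum xs , refl , [])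
    ramsey₂ (suc m) zero χ xs _ = inj₂ ([] , minimum xs , refl , [])
    ramsey₂ (suc m) (suc n) χ (x ∷ xs) (s≤s le)
      with large-part (bound m (suc n)) (bound (suc m) n) (subst (bound m (suc n) + bound (suc m) n ≤_) (sym (matching-length (χ x) xs)) le)
    ... | inj₁ l with ramsey₂ m (suc n) χ (matching (χ x) true xs) l
    ...   | inj₁ (ys , τ , e , ps) = inj₁ (x ∷ ys , refl ∷ ⊆-trans τ (filter-⊆ _ xs) , cong suc e , All-resp-⊆ τ (all-filter _ xs) ∷ ps)
    ...   | inj₂ (ys , τ , e , ps) = inj₂ (ys , x ∷ʳ ⊆-trans τ (filter-⊆ _ xs) , e , ps)
    ramsey₂ (suc m) (suc n) χ (x ∷ xs) (s≤s le) | inj₂ l with ramsey₂ (suc m) n χ (matching (χ x) false xs) l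
    ...   | inj₁ (ys , τ , e , ps) = inj₁ (ys , x ∷ʳ ⊆-trans τ (filter-⊆ _ xs) , e , ps)
    ...   | inj₂ (ys , τ , e , ps) = inj₂ (x ∷ ys , refl ∷ ⊆-trans τ (filter-⊆ _ xs) , cong suc e , All-resp-⊆ τ (all-filter _ xs) ∷ ps)

  -- The colourings are treated one after another, each inside a set homogeneous for the previous
  -- ones.
  multiBound : ℕ → ℕ → ℕ
  multiBound zero m = m
  multiBound (suc t) m = bound (multiBound t m) (multiBound t m)

  module _ {A : Set} where
    shorten : ∀ m (xs : List A) → m ≤ length xs → ∃[ ys ] (ys ⊆ xs × length ys ≡ m)
    shorten zero xs _ = [] , minimum xs , refl
    shorten (suc m) (x ∷ xs) (s≤s l) with shorten m xs l
    ... | ys , τ , e = x ∷ ys , refl ∷ τ , cong suc e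

    ramsey : ∀ t m (χ : Fin t → A → A → Bool) xs → multiBound t m ≤ length xs →
      ∃[ ys ] (ys ⊆ xs × length ys ≡ m × Σ (Fin t → Bool) λ κ → ∀ s → AllPairs (λ x y → χ s x y ≡ κ s) ys)
    ramsey zero m χ xs l with shorten m xs l
    ... | ys , τ , e = ys , τ , e , (λ ()) , λ ()
    ramsey (suc t) m χ xs l = combine (ramsey₂ (multiBound t m) (multiBound t m) (χ zero) xs l)
      where
      extend : ∀ β → Homogeneous (χ zero) β xs (multiBound t m) →
        ∃[ ys ] (ys ⊆ xs × length ys ≡ m × Σ (Fin (suc t) → Bool) λ κ → ∀ s → AllPairs (λ x y → χ s x y ≡ κ s) ys)
      extend β (ys , τ , e , ps) with ramsey t m (λ s → χ (suc s)) ys (ℕₚ.≤-reflexive (sym e))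
      ... | zs , τ′ , e′ , κ , qs = zs , ⊆-trans τ′ τ , e′ , (λ { zero → β ; (suc s) → κ s }) ,
            λ { zero → pairs-⊆ τ′ ps ; (suc s) → qs s }
      combine : Homogeneous (χ zero) true xs (multiBound t m) ⊎ Homogeneous (χ zero) false xs (multiBound t m) →
        ∃[ ys ] (ys ⊆ xs × length ys ≡ m × Σ (Fin (suc t) → Bool) λ κ → ∀ s → AllPairs (λ x y → χ s x y ≡ κ s) ys)
      combine (inj₁ h) = extend true h
      combine (inj₂ h) = extend false h

  record Selection {t N : ℕ} (m : ℕ) (χ : Fin t → Fin N → Fin N → Bool) : Set where
    field
      pick     : Fin m → Fin N
      distinct : ∀ {i j} → suc (toℕ i) ≤ toℕ j → pick i ≢ pick j
      colour   : Fin t → Bool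
      uniform  : ∀ s {i j} → suc (toℕ i) ≤ toℕ j → χ s (pick i) (pick j) ≡ colour s

  private
    selection : ∀ {t N m} {χ : Fin t → Fin N → Fin N → Bool} ys → length ys ≡ m → AllPairs _≢_ ys →
      ∀ κ → (∀ s → AllPairs (λ x y → χ s x y ≡ κ s) ys) → Selection m χ
    selection ys refl ds κ ps = record
      { pick = lookup ys ; distinct = lookup-pairs ds ; colour = κ ; uniform = λ s → lookup-pairs (ps s) }

  abstract
    -- Opaque, because the values that occur are far too large to be evaluated.
    ramseyNumber : ℕ → ℕ → ℕ
    ramseyNumber = multiBound

    select : ∀ {t m} (χ : Fin t → Fin (ramseyNumber t m) → Fin (ramseyNumber t m) → Bool) → Selection m χ
    select {t} {m} χ with ramsey t m χ (allFin (multiBound t m)) (ℕₚ.≤-reflexive (sym (length-tabulate (λ i → i))))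
    ... | ys , τ , e , κ , ps = selection ys e (pairs-⊆ τ (allFin⁺ _)) κ ps

-- The tree.

module Trees where

  open import Data.Nat using (ℕ; zero; suc; z≤n; s≤s) renaming (_≤_ to _≤ℕ_; _*_ to _*ℕ_)
  import Data.Nat.Properties as ℕₚ
  open import Data.Bool using (Bool; true; false; _∧_; _∨_)
  open import Data.Bool.Properties using (∨-comm)
  open import Data.Fin using (Fin; zero; suc; toℕ; inject₁; fromℕ; combine; remQuot)
  open import Data.Fin.Properties using (_≟_; remQuot-combine; combine-remQuot; toℕ-inject₁)
  open import Data.Fin.Relation.Unary.Top using (view; ‵fromℕ; ‵inject₁)
  open import Data.Product using (∃-syntax; _×_; _,_; proj₁; proj₂; uncurry)
  open import Data.Sum using (inj₁; inj₂)
  open import Data.Empty using (⊥; ⊥-elim)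
  open import Relation.Nullary using (yes; does)
  open import Relation.Nullary.Decidable using (dec-true)
  open import Relation.Binary.PropositionalEquality

  -- The root has D children, each of these has E children, and each of those one child.
  module Spider (D E : ℕ) where

    data Node : Set where
      root : Node
      A    : Fin D → Node
      B C  : Fin D → Fin E → Node

    -- The root is followed by `D` blocks, each made of one `A` and `E` pairs of a `B` with its `C`;
    -- `combine` and `remQuot` convert the mixed-radix numbers.
    size : ℕ
    size = suc (D *ℕ suc (E *ℕ 2))

    leaf : Fin D → Fin E × Fin 2 → Node
    leaf i (j , zero) = B i j
    leaf i (j , suc zero) = C i j

    branch : Fin D → Fin (suc (E *ℕ 2)) → Node
    branch i zero = A i
    branch i (suc y) = leaf i (remQuot {E} 2 y)

    decode : Fin size → Node
    decode zero = root
    decode (suc x) = uncurry branch (remQuot {D} (suc (E *ℕ 2)) x)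

    encode : Node → Fin size
    encode root = zero
    encode (A i) = suc (combine i zero)
    encode (B i j) = suc (combine i (suc (combine j zero)))
    encode (C i j) = suc (combine i (suc (combine j (suc zero))))

    decode-encode : ∀ u → decode (encode u) ≡ u
    decode-encode root = refl
    decode-encode (A i) = cong (uncurry branch) (remQuot-combine {D} {suc (E *ℕ 2)} i zero)
    decode-encode (B i j) = trans (cong (uncurry branch) (remQuot-combine {D} {suc (E *ℕ 2)} i (suc (combine j zero))))
                                  (cong (leaf i) (remQuot-combine {E} {2} j zero))
    decode-encode (C i j) = trans (cong (uncurry branch) (remQuot-combine {D} {suc (E *ℕ 2)} i (suc (combine j (suc zero)))))
                                  (cong (leaf i) (remQuot-combine {E} {2} j (suc zero)))

    encode-leaf : ∀ i p → encode (leaf i p) ≡ suc (combine i (suc (uncurry combine p)))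
    encode-leaf i (j , zero) = refl
    encode-leaf i (j , suc zero) = refl

    encode-branch : ∀ i y → encode (branch i y) ≡ suc (combine i y)
    encode-branch i zero = refl
    encode-branch i (suc y) = trans (encode-leaf i (remQuot {E} 2 y)) (cong (λ z → suc (combine i (suc z))) (combine-remQuot {E} 2 y))

    encode-decode : ∀ x → encode (decode x) ≡ x
    encode-decode zero = refl
    encode-decode (suc x) = trans (encode-branch _ _) (cong suc (combine-remQuot {D} (suc (E *ℕ 2)) x))

    encode-injective : ∀ {u w} → encode u ≡ encode w → u ≡ w
    encode-injective {u} {w} e = trans (sym (decode-encode u)) (trans (cong decode e) (decode-encode w))

    childOf : Node → Node → Bool
    childOf (A i) root = true
    childOf (B i j) (A i') = does (i ≟ i')
    childOf (C i j) (B i' j') = does (i ≟ i') ∧ does (j ≟ j')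
    childOf _ _ = false

    linked : Node → Node → Bool
    linked u w = childOf u w ∨ childOf w u

    parent : Node → Node
    parent root = root
    parent (A i) = root
    parent (B i j) = A i
    parent (C i j) = B i j

    depth : Node → ℕ
    depth root = 0
    depth (A _) = 1
    depth (B _ _) = 2
    depth (C _ _) = 3

    childOf-parent : ∀ u w → childOf u w ≡ true → w ≡ parent u × depth u ≡ suc (depth w)
    childOf-parent (A i) root e = refl , refl
    childOf-parent (B i j) (A i') e with i ≟ i'
    ... | yes refl = refl , refl
    childOf-parent (C i j) (B i' j') e with i ≟ i' | j ≟ j'
    ... | yes refl | yes refl = refl , refl

    childOf-self : ∀ u → childOf u u ≡ false
    childOf-self root = refl
    childOf-self (A i) = refl
    childOf-self (B i j) = refl
    childOf-self (C i j) = refl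

    graph : Graph size
    graph = record
      { adj = λ x y → linked (decode x) (decode y)
      ; adj-sym = λ x y → ∨-comm (childOf (decode x) (decode y)) (childOf (decode y) (decode x))
      ; adj-irrefl = λ x → cong₂ _∨_ (childOf-self (decode x)) (childOf-self (decode x))
      }

    adjacent : ∀ u w → linked u w ≡ true → Adj graph (encode u) (encode w)
    adjacent u w e rewrite decode-encode u | decode-encode w = e

    adjacent⁻ : ∀ u w → Adj graph (encode u) (encode w) → linked u w ≡ true
    adjacent⁻ u w e rewrite decode-encode u | decode-encode w = e

    up-A : ∀ i → Walk graph (encode (A i)) (encode root)
    up-A i = step (adjacent (A i) root refl) here

    up-B : ∀ i j → Walk graph (encode (B i j)) (encode root)
    up-B i j = step (adjacent (B i j) (A i) (cong (_∨ false) (dec-true (i ≟ i) refl))) (up-A i)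

    up : ∀ u → Walk graph (encode u) (encode root)
    up root = here
    up (A i) = up-A i
    up (B i j) = up-B i j
    up (C i j) = step (adjacent (C i j) (B i j) (cong (_∨ false) (cong₂ _∧_ (dec-true (i ≟ i) refl) (dec-true (j ≟ j) refl)))) (up-B i j)

    append : ∀ {u v w} → Walk graph u v → Walk graph v w → Walk graph u w
    append here q = q
    append (step e p) q = step e (append p q)

    reverse : ∀ {u v} → Walk graph u v → Walk graph v u
    reverse here = here
    reverse (step {u} {w} e p) = append (reverse p) (step (trans (Graph.adj-sym graph w u) e) here)

    connected : Connected graph
    connected x y = subst₂ (Walk graph) (encode-decode x) (encode-decode y) (append (up (decode x)) (reverse (up (decode y))))

    highest : ∀ {k} (f : Fin (suc k) → ℕ) → ∃[ i ] (∀ j → f j ≤ℕ f i)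
    highest {zero} f = zero , λ { zero → ℕₚ.≤-refl }
    highest {suc k} f with highest (λ i → f (suc i))
    ... | i , p with ℕₚ.≤-total (f zero) (f (suc i))
    ...   | inj₁ q = suc i , λ { zero → q ; (suc j) → p j }
    ...   | inj₂ q = zero , λ { zero → ℕₚ.≤-refl ; (suc j) → ℕₚ.≤-trans (p j) q }

    -- The deepest vertex of a cycle would have its parent as both neighbours.
    acyclic : Acyclic graph
    acyclic cycle with highest (λ i → depth (decode (Cycle.c cycle i)))
    ... | i , deepest = contradiction (neighbours i)
      where
      open Cycle cycle
      -- The first and the last position have one neighbour through `close`; at inner positions the
      -- indices differ by two.
      neighbours : ∀ i → ∃[ p ] ∃[ q ] (p ≢ q × Adj graph (c p) (c i) × Adj graph (c i) (c q))
      neighbours zero = fromℕ _ , suc zero , (λ ()) , close , edges zero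
      neighbours (suc j) with view j
      ... | ‵fromℕ = inject₁ (fromℕ _) , zero , (λ ()) , edges (fromℕ _) , close
      ... | ‵inject₁ j' = inject₁ (inject₁ j') , suc (suc j') , apart , edges (inject₁ j') , edges (suc j')
        where
        apart : inject₁ (inject₁ j') ≢ suc (suc j')
        apart e = ℕₚ.<⇒≢ (ℕₚ.m<n⇒m<1+n (ℕₚ.n<1+n _)) (trans (sym (trans (toℕ-inject₁ _) (toℕ-inject₁ j'))) (cong toℕ e))
      child : ∀ j → linked (decode (c i)) (decode (c j)) ≡ true → decode (c j) ≡ parent (decode (c i))
      child j e with childOf (decode (c i)) (decode (c j)) in eq
      ... | true = proj₁ (childOf-parent _ _ eq)
      ... | false = ⊥-elim (ℕₚ.1+n≰n (subst (_≤ℕ depth (decode (c i))) (proj₂ (childOf-parent _ _ e)) (deepest j)))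
      contradiction : ∃[ p ] ∃[ q ] (p ≢ q × Adj graph (c p) (c i) × Adj graph (c i) (c q)) → ⊥
      contradiction (p , q , p≢q , e , e') = p≢q (inj p q
        (trans (sym (encode-decode (c p))) (trans (cong encode (trans (child p (trans (Graph.adj-sym graph (c i) (c p)) e)) (sym (child q e')))) (encode-decode (c q)))))

    tree : IsTree graph
    tree = s≤s z≤n , connected , acyclic

-- Selecting a homogeneous subtree.

module Selections where

  open import Data.Nat using (ℕ; zero; suc; s≤s) renaming (_≤_ to _≤ℕ_; _≤?_ to _≤ℕ?_)
  import Data.Nat.Properties as ℕₚ
  open import Data.Bool using (Bool; true; false; not; _∧_; _∨_; T; _xor_)
  open import Data.Bool.Properties using (not-involutive; not-¬; ∨-identityʳ; ∨-comm; T-≡)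
  open import Data.Fin using (Fin; zero; suc; toℕ; _↑ʳ_)
  open import Data.Fin.Patterns
  open import Data.Fin.Properties using (_≟_; all?; ¬∀⟶∃¬; <-cmp)
  open import Data.Vec using (Vec; []; _∷_; lookup)
  open import Data.Product using (Σ; ∃-syntax; _×_; _,_; proj₁; proj₂)
  open import Data.Sum using (_⊎_; inj₁; inj₂)
  open import Data.Empty using (⊥; ⊥-elim)
  open import Data.Unit using (tt)
  open import Function.Bundles using (Equivalence)
  open import Relation.Nullary using (¬_; Dec; yes; no; does)
  open import Relation.Nullary.Decidable using (from-yes; _→-dec_; dec-true; dec-false; ¬?)
  open import Relation.Binary using (tri<; tri≈; tri>)
  open import Relation.Binary.PropositionalEquality
  open Obstacles using (Scene; module Visibility)
  open Homogeneity using (Name; root; a; b; c; sameIndex; sameIndex-refl; sameName; sameName-refl; joined; _<₅_; module Signs; module Final)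
  open Fields
  open Planes
  open Hulls
  open Representations
  open Ramsey
  open Trees

  -- Positions of five members of a six-element selection, in one of the two directions; the sixth
  -- is only there so that attributes of single elements are also uniform on the five.
  place : Bool → Fin 5 → Fin 6
  place true  0F = 0F
  place true  1F = 1F
  place true  2F = 2F
  place true  3F = 3F
  place true  4F = 4F
  place false 0F = 4F
  place false 1F = 3F
  place false 2F = 2F
  place false 3F = 1F
  place false 4F = 0F

  place-forward : ∀ (i j : Fin 5) → suc (toℕ i) ≤ℕ toℕ j → suc (toℕ (place true i)) ≤ℕ toℕ (place true j)
  place-forward = from-yes (all? {5} λ i → all? {5} λ j → (suc (toℕ i) ≤ℕ? toℕ j) →-dec (suc (toℕ (place true i)) ≤ℕ? toℕ (place true j)))

  place-backward : ∀ (i j : Fin 5) → suc (toℕ i) ≤ℕ toℕ j → suc (toℕ (place false j)) ≤ℕ toℕ (place false i)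
  place-backward = from-yes (all? {5} λ i → all? {5} λ j → (suc (toℕ i) ≤ℕ? toℕ j) →-dec (suc (toℕ (place false j)) ≤ℕ? toℕ (place false i)))

  place-last : ∀ r i → suc (toℕ (place r i)) ≤ℕ 5
  place-last true = from-yes (all? {5} λ i → suc (toℕ (place true i)) ≤ℕ? 5)
  place-last false = from-yes (all? {5} λ i → suc (toℕ (place false i)) ≤ℕ? 5)

  sameIndex-sym : ∀ i j → sameIndex i j ≡ sameIndex j i
  sameIndex-sym = from-yes (all? {5} λ i → all? {5} λ j → sameIndex i j Data.Bool.≟ sameIndex j i)
    where import Data.Bool

  sameIndex-≢ : ∀ i j → i ≢ j → sameIndex i j ≡ false
  sameIndex-≢ = from-yes (all? {5} λ i → all? {5} λ j → ¬? (i ≟ j) →-dec (sameIndex i j Data.Bool.≟ false))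
    where import Data.Bool

  module Five {t N : ℕ} {χ : Fin t → Fin N → Fin N → Bool} (sel : Selection 6 χ) (r : Bool) where
    open Selection sel

    five : Fin 5 → Fin N
    five i = pick (place r i)

    below : ∀ {i j : Fin 5} → i <₅ j → suc (toℕ i) ≤ℕ toℕ j
    below {i} {j} = ℕₚ.<ᵇ⇒< (toℕ i) (toℕ j)

    increasing : r ≡ true → ∀ s {i j} → i <₅ j → χ s (five i) (five j) ≡ colour s
    increasing refl s {i} {j} l = uniform s (place-forward i j (below l))

    decreasing : r ≡ false → ∀ s {i j} → i <₅ j → χ s (five j) (five i) ≡ colour s
    decreasing refl s {i} {j} l = uniform s (place-backward i j (below l))

    single : ∀ s i → χ s (five i) (pick 5F) ≡ colour s
    single s i = uniform s (place-last r i)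

    apart : ∀ r {i j} → suc (toℕ i) ≤ℕ toℕ j → pick (place r i) ≢ pick (place r j)
    apart true {i} {j} l = distinct (place-forward i j l)
    apart false {i} {j} l e = distinct (place-backward i j l) (sym e)

    five-injective : ∀ {i j} → five i ≡ five j → i ≡ j
    five-injective {i} {j} e with <-cmp i j
    ... | tri≈ _ i≡j _ = i≡j
    ... | tri< l _ _ = ⊥-elim (apart r l e)
    ... | tri> _ _ l = ⊥-elim (apart r l (sym e))

  holds : ∀ {P : Set} (d : Dec P) → does d ≡ true → P
  holds (yes p) _ = p

  fails : ∀ {P : Set} (d : Dec P) → does d ≡ false → ¬ P
  fails (no n) _ = n

  otherwise : ∀ {P Q : Set} → P ⊎ Q → ¬ P → Q
  otherwise (inj₁ p) n = ⊥-elim (n p)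
  otherwise (inj₂ q) _ = q

  one-of : ∀ {p q} {P : Set} → (p ≡ true → P) → (q ≡ true → P) → p ∨ q ≡ true → P
  one-of {true} f _ _ = f refl
  one-of {false} _ g e = g e

  -- Attributes of a pair: 0 order, 1 side of the next generation, 2 and 3 crossings for either direction of the
  -- order, and, for each obstacle, whether it hides certain vertices from each other.  Attribute 4 of inner is
  -- the side of the children themselves, which is attribute 1 of outer.
  obstacles : ∀ {k} → (Fin 3 → Bool) → Vec Bool k → Vec Bool (suc (suc (suc k)))
  obstacles f bs = f 0F ∷ f 1F ∷ f 2F ∷ bs

  -- Four attributes and two triples of obstacle attributes make 10 for `outer`; five and three
  -- triples make 14 for `inner`. Each selection has six members.
  D E : ℕ
  D = ramseyNumber 10 6
  E = ramseyNumber 14 6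

  open Spider D E

  same-index : ∀ {N} {f : Fin 5 → Fin N} → (∀ {i j} → f i ≡ f j → i ≡ j) → ∀ i j → does (f i ≟ f j) ≡ sameIndex i j
  same-index {f = f} injective i j = cases (i ≟ j)
    where
    cases : Dec (i ≡ j) → does (f i ≟ f j) ≡ sameIndex i j
    cases (yes refl) = trans (dec-true (f i ≟ f i) refl) (sym (Equivalence.to T-≡ (sameIndex-refl i)))
    cases (no ne) = trans (dec-false (f i ≟ f j) (λ e → ne (injective e))) (sym (sameIndex-≢ i j ne))

  module Placement (member : Fin 5 → Fin D) (child : Fin D → Fin 5 → Fin E)
    (member-injective : ∀ {i j} → member i ≡ member j → i ≡ j)
    (child-injective : ∀ x {l m} → child x l ≡ child x m → l ≡ m) where

    node : Name → Node
    node root = root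
    node (a i) = A (member i)
    node (b i l) = B (member i) (child (member i) l)
    node (c i l) = C (member i) (child (member i) l)

    same-member : ∀ i j → does (member i ≟ member j) ≡ sameIndex i j
    same-member = same-index member-injective

    same-child : ∀ x l m → does (child x l ≟ child x m) ≡ sameIndex l m
    same-child x = same-index (child-injective x)

    same-children : ∀ i j l m → does (member i ≟ member j) ∧ does (child (member i) l ≟ child (member j) m) ≡ sameIndex i j ∧ sameIndex l m
    same-children i j l m = cases (i ≟ j)
      where
      cases : Dec (i ≡ j) → does (member i ≟ member j) ∧ does (child (member i) l ≟ child (member j) m) ≡ sameIndex i j ∧ sameIndex l m
      cases (yes refl) = cong₂ _∧_ (same-member i i) (same-child (member i) l m)
      cases (no ne) = trans (cong (_∧ does (child (member i) l ≟ child (member j) m)) (trans (same-member i j) (sameIndex-≢ i j ne)))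
                            (sym (cong (_∧ sameIndex l m) (sameIndex-≢ i j ne)))

    linked-node : ∀ u w → linked (node u) (node w) ≡ joined u w
    linked-node root root = refl
    linked-node root (a j) = refl
    linked-node root (b j m) = refl
    linked-node root (c j m) = refl
    linked-node (a i) root = refl
    linked-node (a i) (a j) = refl
    linked-node (a i) (b j m) = trans (same-member j i) (sameIndex-sym j i)
    linked-node (a i) (c j m) = refl
    linked-node (b i l) root = refl
    linked-node (b i l) (a j) = trans (∨-identityʳ _) (same-member i j)
    linked-node (b i l) (b j m) = refl
    linked-node (b i l) (c j m) = trans (same-children j i m l) (cong₂ _∧_ (sameIndex-sym j i) (sameIndex-sym m l))
    linked-node (c i l) root = refl
    linked-node (c i l) (a j) = refl
    linked-node (c i l) (b j m) = trans (∨-identityʳ _) (same-children i j l m)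
    linked-node (c i l) (c j m) = refl

    A-injective : ∀ {i j} → A i ≡ A j → i ≡ j
    A-injective refl = refl
    B-injective : ∀ {i j k l} → B i k ≡ B j l → i ≡ j × k ≡ l
    B-injective refl = refl , refl
    C-injective : ∀ {i j k l} → C i k ≡ C j l → i ≡ j × k ≡ l
    C-injective refl = refl , refl

    children-injective : ∀ {i j l m} → member i ≡ member j × child (member i) l ≡ child (member j) m → i ≡ j × l ≡ m
    children-injective {i} {j} (e , e') = together (member-injective {i} {j} e) e'
      where
      together : ∀ {i j l m} → i ≡ j → child (member i) l ≡ child (member j) m → i ≡ j × l ≡ m
      together {i} refl e' = refl , child-injective (member i) e'

    node-injective : ∀ u w → node u ≡ node w → u ≡ w
    node-injective root root e = refl
    node-injective (a i) (a j) e = cong a (member-injective (A-injective e))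
    node-injective (b i l) (b j m) e with children-injective {i} {j} {l} {m} (B-injective e)
    ... | refl , refl = refl
    node-injective (c i l) (c j m) e with children-injective {i} {j} {l} {m} (C-injective e)
    ... | refl , refl = refl

    embed : Name → Fin size
    embed u = encode (node u)

    embed-injective : ∀ {u w} → embed u ≡ embed w → u ≡ w
    embed-injective {u} {w} e = node-injective u w (encode-injective e)

    joined-adjacent : ∀ u w → joined u w ≡ true → Adj graph (embed u) (embed w)
    joined-adjacent u w e = adjacent (node u) (node w) (trans (linked-node u w) e)

    joined-apart : ∀ u w → joined u w ≡ true → ¬ u ≡ w
    joined-apart u .u e refl = irreflexive u e
      where
      irreflexive : ∀ u → ¬ joined u u ≡ true
      irreflexive root ()
      irreflexive (a _) ()
      irreflexive (b _ _) ()
      irreflexive (c _ _) ()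

    neighbour : ∀ u → ∃[ x ] (¬ embed u ≡ x × Adj graph (embed u) x)
    neighbour u = embed (next u) , (λ e → joined-apart u (next u) (next-joined u) (embed-injective e)) , joined-adjacent u (next u) (next-joined u)
      where
      next : Name → Name
      next root = a 0F
      next (a i) = root
      next (b i l) = a i
      next (c i l) = b i l
      next-joined : ∀ u → joined u (next u) ≡ true
      next-joined root = refl
      next-joined (a i) = refl
      next-joined (b i l) = Equivalence.to T-≡ (sameIndex-refl i)
      next-joined (c i l) = cong₂ _∧_ (Equivalence.to T-≡ (sameIndex-refl i)) (Equivalence.to T-≡ (sameIndex-refl l))

  module Contradiction (F : CompleteOrderedField) {h : ℕ} (h≤3 : h ≤ℕ 3) (rep : Geometry.DisjointConvexObstacleRep F graph h) where
    open Geometry F using (Point; DisjointConvexObstacleRep)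
    open DisjointConvexObstacleRep rep using (pos)
    open Planes.Plane F using (left?; CrossP)
    open Represented F h≤3 rep

    at : Node → Point
    at u = pos (encode u)

    leftᵇ : Node → Node → Node → Bool
    leftᵇ u w x = does (left? (at u) (at w) (at x))

    crossᵇ : Node → Node → Node → Node → Bool
    crossᵇ u w u' w' = does (cross? (at u) (at w) (at u') (at w'))

    -- Symmetrised, so that the attribute of a pair survives reversal of the order.
    blocksᵇ : Node → Node → Fin 3 → Bool
    blocksᵇ u w R = does (blocks? R (encode u) (encode w)) ∨ does (blocks? R (encode w) (encode u))

    inner : Fin D → Fin 14 → Fin E → Fin E → Bool
    inner i s j k = lookup
      ( leftᵇ (A i) (B i j) (B i k)
      ∷ leftᵇ (A i) (B i j) (C i j)
      ∷ crossᵇ (B i k) (C i k) (A i) (B i j)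
      ∷ crossᵇ (B i j) (C i j) (A i) (B i k)
      ∷ leftᵇ root (A i) (B i j)
      ∷ obstacles (blocksᵇ (B i j) (B i k)) (obstacles (blocksᵇ (A i) (C i j)) (obstacles (blocksᵇ root (B i j)) []))) s

    abstract
      inner-selection : ∀ i → Selection 6 (inner i)
      inner-selection i = select (inner i)

    shade : Fin D → Fin 14 → Bool
    shade i = Selection.colour (inner-selection i)

    -- `Wedges` requires opposite signs for order and side; reading a selection backwards changes
    -- the sign of the order only.
    inner-direction : Fin D → Bool
    inner-direction i = shade i 0F xor shade i 1F

    module Inner (i : Fin D) = Five (inner-selection i) (inner-direction i)

    child : Fin D → Fin 5 → Fin E
    child i = Inner.five i

    -- Quantifying over the selected children turns the crossings into an attribute of a pair of `A`
    -- vertices; hence the inner selections precede the outer one.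
    allCross : Fin D → Fin D → Bool
    allCross j i = does (all? λ l → cross? (at (A j)) (at (B j (child j l))) (at root) (at (A i)))

    outer : Fin 10 → Fin D → Fin D → Bool
    outer s i j = lookup
      ( leftᵇ root (A i) (A j)
      ∷ shade i 4F
      ∷ allCross j i
      ∷ allCross i j
      ∷ obstacles (blocksᵇ (A i) (A j)) (obstacles (λ R → shade i (11 ↑ʳ R)) [])) s

    abstract
      outer-selection : Selection 6 outer
      outer-selection = select outer

    hue : Fin 10 → Bool
    hue = Selection.colour outer-selection

    outer-direction : Bool
    outer-direction = hue 0F xor hue 1F

    module Outer = Five outer-selection outer-direction

    member : Fin 5 → Fin D
    member = Outer.five

    open Placement member child (λ {i} {j} → Outer.five-injective {i} {j}) (λ x {l} {m} → Inner.five-injective x {l} {m})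

    open Restricted embed embed-injective neighbour
    open Visibility scene
    open Signs scene
    open Final scene using (impossible)

    turn : ∀ {β} u w x → leftᵇ (node u) (node w) (node x) ≡ β → ¬ u ≡ w → ¬ w ≡ x → ¬ u ≡ x → Turn β u w x
    turn {true} u w x e uw wx ux = holds (left? (at (node u)) (at (node w)) (at (node x))) e
    turn {false} u w x e uw wx ux = otherwise (turn? true uw wx ux) (fails (left? (at (node u)) (at (node w)) (at (node x))) e)

    crossing : ∀ u w u' w' → crossᵇ (node u) (node w) (node u') (node w') ≡ true → Meet u w u' w'
    crossing u w u' w' = holds (cross? (at (node u)) (at (node w)) (at (node u')) (at (node w')))

    no-crossing : ∀ u w u' w' → crossᵇ (node u) (node w) (node u') (node w') ≡ false → ¬ Meet u w u' w'
    no-crossing u w u' w' = fails (cross? (at (node u)) (at (node w)) (at (node u')) (at (node w')))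

    blocking : ∀ u w R → blocksᵇ (node u) (node w) R ≡ true → Blocks R u w
    blocking u w R e = one-of {does (blocks? R (embed u) (embed w))} {does (blocks? R (embed w) (embed u))} (holds (blocks? R (embed u) (embed w))) (λ e → blocks-sym (holds (blocks? R (embed w) (embed u)) e)) e

    blocked⇒ : ∀ u w R → Blocks R u w → blocksᵇ (node u) (node w) R ≡ true
    blocked⇒ u w R x = cong (_∨ does (blocks? R (embed w) (embed u))) (dec-true (blocks? R (embed u) (embed w)) x)

    distinct-names : ∀ u w → sameName u w ≡ false → ¬ u ≡ w
    distinct-names u .u e refl = not-¬ refl (trans (sym e) (Equivalence.to T-≡ (sameName-refl u)))

    edge : ∀ {u w} → {_ : T (joined u w)} → ∀ R → Misses R u w
    edge {u} {w} {e} = edge-misses u w (joined-apart u w (Equivalence.to T-≡ e)) (joined-adjacent u w (Equivalence.to T-≡ e))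

    blocked : ∀ {u w} → {_ : T (not (joined u w) ∧ not (sameName u w))} → ¬ (∀ R → ¬ Blocks R u w)
    blocked {u} {w} {e} = nonedge-blocked u w (distinct-names u w (proj₂ (split {joined u w} {sameName u w} e))) λ adj →
      not-¬ refl (trans (sym (proj₁ (split {joined u w} {sameName u w} e))) (trans (sym (linked-node u w)) (adjacent⁻ (node u) (node w) adj)))
      where
      split : ∀ {p q} → T (not p ∧ not q) → p ≡ false × q ≡ false
      split {false} {false} _ = refl , refl

    -- If the order and the side have different signs, the second points lie on the side of the earlier
    -- first points; otherwise they do once the order is reversed.
    order-turn : ∀ p q {u y z} → (p xor q ≡ true → leftᵇ (node u) (node y) (node z) ≡ p) → (p xor q ≡ false → leftᵇ (node u) (node z) (node y) ≡ p) →
      ¬ u ≡ y → ¬ y ≡ z → ¬ u ≡ z → Turn (not q) u y z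
    order-turn true true {u} {y} {z} f g uy yz uz = turn-back false (turn u z y (g refl) uz (λ e → yz (sym e)) uy)
    order-turn true false {u} {y} {z} f g uy yz uz = turn u y z (f refl) uy yz uz
    order-turn false true {u} {y} {z} f g uy yz uz = turn u y z (f refl) uy yz uz
    order-turn false false {u} {y} {z} f g uy yz uz = turn-back true (turn u z y (g refl) uz (λ e → yz (sym e)) uy)

    uniformly : ∀ {I : Set} (r : Bool) {p q : Bool} {f : I → Bool} → (r ≡ true → ∀ i → f i ≡ p) → (r ≡ false → ∀ i → f i ≡ q) → ∃[ v ] (∀ i → f i ≡ v)
    uniformly true {p} f g = p , f refl
    uniformly false {q = q} f g = q , g refl

    either-way : ∀ (r : Bool) {p q : Bool} → (r ≡ true → q ≡ p) → (r ≡ false → q ≡ p) → q ≡ p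
    either-way true f g = f refl
    either-way false f g = g refl

    Pair : Set
    Pair = Σ (Fin 5 × Fin 5) λ { (i , j) → i <₅ j }

    five-apart : ∀ {i j} → i <₅ j → ¬ i ≡ j
    five-apart {i} l refl = ℕₚ.n≮n (toℕ i) (ℕₚ.<ᵇ⇒< (toℕ i) (toℕ i) l)

    x : Fin D
    x = member 2F

    -- Positions of the obstacle attributes in the vectors, by the kind of pair they concern.
    bb ac : Fin 3 → Fin 14
    bb 0F = 5F
    bb 1F = 6F
    bb 2F = 7F
    ac 0F = 8F
    ac 1F = 9F
    ac 2F = suc 9F

    aa ab : Fin 3 → Fin 10
    aa 0F = 4F
    aa 1F = 5F
    aa 2F = 6F
    ab 0F = 7F
    ab 1F = 8F
    ab 2F = 9F

    inner-bb : ∀ i R j k → inner i (bb R) j k ≡ blocksᵇ (B i j) (B i k) R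
    inner-bb i 0F j k = refl
    inner-bb i 1F j k = refl
    inner-bb i 2F j k = refl

    inner-ac : ∀ i R j k → inner i (ac R) j k ≡ blocksᵇ (A i) (C i j) R
    inner-ac i 0F j k = refl
    inner-ac i 1F j k = refl
    inner-ac i 2F j k = refl

    inner-ab : ∀ i R j k → inner i (11 ↑ʳ R) j k ≡ blocksᵇ root (B i j) R
    inner-ab i 0F j k = refl
    inner-ab i 1F j k = refl
    inner-ab i 2F j k = refl

    outer-aa : ∀ R i j → outer (aa R) i j ≡ blocksᵇ (A i) (A j) R
    outer-aa 0F i j = refl
    outer-aa 1F i j = refl
    outer-aa 2F i j = refl

    outer-ab : ∀ R i j → outer (ab R) i j ≡ shade i (11 ↑ʳ R)
    outer-ab 0F i j = refl
    outer-ab 1F i j = refl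
    outer-ab 2F i j = refl

    blocksᵇ-comm : ∀ u w R → blocksᵇ u w R ≡ blocksᵇ w u R
    blocksᵇ-comm u w R = ∨-comm (does (blocks? R (encode u) (encode w))) (does (blocks? R (encode w) (encode u)))

    block-pair-b : ∀ R {l m} → l <₅ m → blocksᵇ (node (b 2F l)) (node (b 2F m)) R ≡ shade x (bb R)
    block-pair-b R {l} {m} lt = either-way (inner-direction x)
      (λ r → trans (sym (inner-bb x R (child x l) (child x m))) (Inner.increasing x r (bb R) lt))
      (λ r → trans (blocksᵇ-comm (node (b 2F l)) (node (b 2F m)) R) (trans (sym (inner-bb x R (child x m) (child x l))) (Inner.decreasing x r (bb R) lt)))

    block-pair-a : ∀ R {i j} → i <₅ j → blocksᵇ (node (a i)) (node (a j)) R ≡ hue (aa R)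
    block-pair-a R {i} {j} lt = either-way outer-direction
      (λ r → trans (sym (outer-aa R (member i) (member j))) (Outer.increasing r (aa R) lt))
      (λ r → trans (blocksᵇ-comm (node (a i)) (node (a j)) R) (trans (sym (outer-aa R (member j) (member i))) (Outer.decreasing r (aa R) lt)))

    block-ac : ∀ R l → blocksᵇ (node (a 2F)) (node (c 2F l)) R ≡ shade x (ac R)
    block-ac R l = trans (sym (inner-ac x R (child x l) (Selection.pick (inner-selection x) 5F))) (Inner.single x (ac R) l)

    block-ab : ∀ R i l → blocksᵇ root (node (b i l)) R ≡ hue (ab R)
    block-ab R i l = trans (sym (inner-ab (member i) R (child (member i) l) (Selection.pick (inner-selection (member i)) 5F)))
      (trans (Inner.single (member i) (11 ↑ʳ R) l) (trans (sym (outer-ab R (member i) (Selection.pick outer-selection 5F))) (Outer.single (ab R) i)))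

    crossings-b : ∃[ v ] ∀ (p : Pair) → let ((l , m) , _) = p in crossᵇ (node (b 2F m)) (node (c 2F m)) (node (a 2F)) (node (b 2F l)) ≡ v
    crossings-b = uniformly (inner-direction x)
      (λ { r (_ , lt) → Inner.increasing x r 2F lt })
      (λ { r (_ , lt) → Inner.decreasing x r 3F lt })

    crossings-a : ∃[ v ] ∀ (p : Pair) → let ((i , j) , _) = p in allCross (member j) (member i) ≡ v
    crossings-a = uniformly outer-direction
      (λ { r (_ , lt) → Outer.increasing r 2F lt })
      (λ { r (_ , lt) → Outer.decreasing r 3F lt })

    absurd : ⊥
    absurd =
      -- Each label is read off at a single nonadjacent pair, and uniformity carries it to all pairs
      -- of that kind.
      blocked {a 0F} {a 1F} λ P p → blocked {root} {b 0F 0F} λ Q q →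
      blocked {b 2F 0F} {b 2F 1F} λ P′ p′ → blocked {a 2F} {c 2F 0F} λ Q′ q′ →
      impossible record
        { edge = λ {u} {w} {e} → edge {u} {w} {e}
        ; blocked = λ {u} {w} {e} → blocked {u} {w} {e}
        ; σ = not (hue 1F)
        ; P = P
        ; Q = Q
        ; order-a = λ i j {lt} → order-turn (hue 0F) (hue 1F) {root} {a i} {a j}
            (λ r → Outer.increasing r 0F lt) (λ r → Outer.decreasing r 0F lt) (λ ()) (λ { refl → five-apart {i} lt refl }) (λ ())
        ; side-b = λ i l → subst (λ β → Turn β root (a i) (b i l)) (sym (not-involutive (hue 1F)))
            (turn root (a i) (b i l) (trans (Inner.single (member i) 4F l) (Outer.single 1F i)) (λ ()) (λ ()) (λ ()))
        ; block-a = λ i j {lt} → blocking (a i) (a j) P (trans (block-pair-a P lt) (trans (sym (block-pair-a P {0F} {1F} tt)) (blocked⇒ (a 0F) (a 1F) P p)))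
        ; block-b = λ i l → blocking root (b i l) Q (trans (block-ab Q i l) (trans (sym (block-ab Q 0F 0F)) (blocked⇒ root (b 0F 0F) Q q)))
        ; cross-a = cases-a crossings-a
        ; τ = not (shade x 1F)
        ; P′ = P′
        ; Q′ = Q′
        ; order-b = λ l m {lt} → order-turn (shade x 0F) (shade x 1F) {a 2F} {b 2F l} {b 2F m}
            (λ r → Inner.increasing x r 0F lt) (λ r → Inner.decreasing x r 0F lt) (λ ()) (λ { refl → five-apart {l} lt refl }) (λ ())
        ; side-c = λ l → subst (λ β → Turn β (a 2F) (b 2F l) (c 2F l)) (sym (not-involutive (shade x 1F)))
            (turn (a 2F) (b 2F l) (c 2F l) (Inner.single x 1F l) (λ ()) (λ ()) (λ ()))
        ; block-bb = λ l m {lt} → blocking (b 2F l) (b 2F m) P′ (trans (block-pair-b P′ lt) (trans (sym (block-pair-b P′ {0F} {1F} tt)) (blocked⇒ (b 2F 0F) (b 2F 1F) P′ p′)))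
        ; block-c = λ l → blocking (a 2F) (c 2F l) Q′ (trans (block-ac Q′ l) (trans (sym (block-ac Q′ 0F)) (blocked⇒ (a 2F) (c 2F 0F) Q′ q′)))
        ; cross-b = cases-b crossings-b
        }
      where
      cases-b : (∃[ v ] ∀ (p : Pair) → let ((l , m) , _) = p in crossᵇ (node (b 2F m)) (node (c 2F m)) (node (a 2F)) (node (b 2F l)) ≡ v) →
          (∀ l m {_ : l <₅ m} → Meet (b 2F m) (c 2F m) (a 2F) (b 2F l)) ⊎ (∀ l m {_ : l <₅ m} → ¬ Meet (b 2F m) (c 2F m) (a 2F) (b 2F l))
      cases-b (true , f) = inj₁ λ l m {lt} → crossing (b 2F m) (c 2F m) (a 2F) (b 2F l) (f ((l , m) , lt))
      cases-b (false , f) = inj₂ λ l m {lt} → no-crossing (b 2F m) (c 2F m) (a 2F) (b 2F l) (f ((l , m) , lt))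
      every? : ∀ i j → Dec (∀ l → CrossP (at (node (a j))) (at (node (b j l))) (at root) (at (node (a i))))
      every? i j = all? λ l → cross? (at (node (a j))) (at (node (b j l))) (at root) (at (node (a i)))
      cases-a : (∃[ v ] ∀ (p : Pair) → let ((i , j) , _) = p in allCross (member j) (member i) ≡ v) →
          (∀ i j {_ : i <₅ j} → ∀ l → Meet (a j) (b j l) root (a i)) ⊎ (∀ i j {_ : i <₅ j} → ∃[ l ] ¬ Meet (a j) (b j l) root (a i))
      cases-a (true , f) = inj₁ λ i j {lt} → holds (every? i j) (f ((i , j) , lt))
      cases-a (false , f) = inj₂ λ i j {lt} → ¬∀⟶∃¬ 5 _ (λ l → cross? (at (node (a j))) (at (node (b j l))) (at root) (at (node (a i)))) (fails (every? i j) (f ((i , j) , lt)))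

theorem2 : (ℝ : CompleteOrderedField) →
    ∃[ n ] Σ (Graph n) (λ T → IsTree T × Geometry.DcobsAtLeast ℝ T 4)
theorem2 ℝ = size , graph , tree , λ { h (s≤s h≤3) rep → Contradiction.absurd ℝ h≤3 rep }
  where
  open import Data.Nat using (s≤s)
  open import Data.Product using (_,_)
  open Selections
  open Trees.Spider D E
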